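{- For every composition $\eta\in\mathbb{N}^n$ we have $x^{\underline\eta}=\sum_{G\in\mathcal{G}(\eta)}w(G)$.
   Context: Fix $n\ge1$; $r$ is an indeterminate, $\alpha=1/r$, $\mathbb{F}=\mathbb{Q}(r)$, polynomials lie in $\mathbb{F}[x_1,\dots,x_n]$. Compositions are $\eta\in\mathbb{N}^n$, $|\eta|=\sum\eta_i$, $x^\eta=\prod x_i^{\eta_i}$; partitions are weakly decreasing compositions; $\delta=(n-1,\dots,0)$; permutations act on vectors by $(wv)_{w(i)}=v_i$; for a composition $\gamma$, $w_\gamma$ is the minimal-length permutation with $w_\gamma^{ -1}(\gamma)$ a partition, and $\overline\gamma=\gamma+w_\gamma(r\delta)$. Let $E_\eta^{r\delta}$ be the unique polynomial of degree $|\eta|$ vanishing at all $\overline\gamma$ with $\gamma\neq\eta$, $|\gamma|\le|\eta|$, with coefficient $1$ on $x^\eta$, and $E_\eta^{(\alpha)}$ its top homogeneous component. With $a_\eta(i,j)=\eta_i-j$, $l_\eta(i,j)=\#\{k>i:j\le\eta_k\le\eta_i\}+\#\{k<i:j\le\eta_k+1\le\eta_i\}$ and $d_\eta(\alpha)=\prod_{\text{boxes }(i,j),\,1\le j\le\eta_i}(\alpha(a_\eta(i,j)+1)+l_\eta(i,j)+1)$, put $F_\eta^{(\alpha)}=d_\eta E_\eta^{(\alpha)}$, $F_\eta^{r\delta}(x)=(-1)^{|\eta|}d_\eta E_\eta^{r\delta}(-x)$; $\Xi$ is the unique $\mathbb{F}$-linear operator with $\Xi(F_\eta^{(\alpha)})=F_\eta^{r\delta}$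 for all $\eta$, and $x^{\underline\eta}=\Xi(x^\eta)$. Combinatorics. For $\eta\ne0$ let $m=\max_i\eta_i$ and $k=\min\{i:\eta_i=m\}$ (critical row); the critical leg is $l[\eta]=\#\{i>k:\eta_i=m\}+\#\{i<k:\eta_i=m-1\}$. Let $\eta^*$ be $\eta$ with $\eta_k$ replaced by $m-1$. A glissade $\eta\gtrdot\gamma$ means: either $\gamma=\eta^*$, or there exist $j\ne k$ and an integer $l>0$ with $\gamma_j=\eta_j+l$, $\gamma_k=m-1-l$, $\gamma_i=\eta_i$ for $i\ne j,k$, and $\varepsilon=m-1-\eta_j-l$ satisfies $\varepsilon>0$ if $j<k$ and $\varepsilon\ge0$ if $j>k$ (i.e., after deleting the box $(k,m)$, $l$ boxes are moved from the end of row $k$ to the end of row $j$, landing above and strictly left or below and weakly left of their old positions). The weight of $\eta$ is $w_\eta=x_k+(m-1)+r(n-1-l[\eta])$, and the weight of $\eta\gtrdot\gamma$ is $w_\eta$ if $\gamma=\eta^*$ and $r$ otherwise. A bar game on $\eta$ is a chain $\eta=\eta^{(0)}\gtrdot\eta^{(1)}\gtrdot\cdots\gtrdot\eta^{(d)}=0$ with $d=|\eta|$; its weight $w(G)$ is the product of the weights of its $d$ steps. $\mathcal{G}(\eta)$ is the set of bar games on $\eta$ (for $\eta=0$ it consists of the empty game of weight $1$). -}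

module Defs where

open import Data.Nat as ℕ using (ℕ; zero; suc; _+_; _<_; _≤_; _∸_; _⊔_; _≤ᵇ_; _<ᵇ_; _≡ᵇ_)
open import Data.Bool using (Bool; true; false; if_then_else_; _∧_)
open import Data.Fin as Fin using (Fin; zero; suc; toℕ)
open import Data.Vec as Vec using (Vec; []; _∷_; lookup; tabulate; replicate; zipWith; _[_]≔_)
open import Data.Vec.Properties using (≡-dec)
open import Data.List as List using (List; []; _∷_; _++_; map; concatMap; foldr; filter)
open import Data.List.Relation.Unary.All as All using (All; []; _∷_)
open import Data.Product using (_×_; _,_; proj₁; proj₂)
open import Data.Integer as ℤ using (ℤ)
open import Data.Rational as ℚ using (ℚ; 0ℚ; 1ℚ)
open import Data.Rational.Properties using () renaming (_≟_ to _≟ℚ_)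
open import Relation.Nullary using (¬_; yes; no; Dec)
open import Relation.Binary.PropositionalEquality using (_≡_; _≢_)

-- ℚ[r] : polynomials in r with rational coefficients (coefficient lists,
-- lowest degree first); equality = difference has all coefficients 0.

QP : Set
QP = List ℚ

infixl 6 _+P_
infixl 7 _*P_

_+P_ : QP → QP → QP
[]      +P q       = q
(a ∷ p) +P []      = a ∷ p
(a ∷ p) +P (b ∷ q) = (a ℚ.+ b) ∷ (p +P q)

scaleP : ℚ → QP → QP
scaleP c = map (c ℚ.*_)

_*P_ : QP → QP → QP
[]      *P q = []
(a ∷ p) *P q = scaleP a q +P (0ℚ ∷ (p *P q))

negP : QP → QP
negP = map (λ a → ℚ.- a)

IsZeroP : QP → Set
IsZeroP p = All (_≡ 0ℚ) p

isZeroP? : (p : QP) → Dec (IsZeroP p)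
isZeroP? = All.all? (_≟ℚ 0ℚ)

_≈P_ : QP → QP → Set
p ≈P q = IsZeroP (p +P negP q)

record 𝔽 : Set where
  constructor frac
  field
    num : QP
    den : QP
    den≢0 : ¬ IsZeroP den
open 𝔽 public

infix 4 _≈F_
_≈F_ : 𝔽 → 𝔽 → Set
a ≈F b = (num a *P den b) ≈P (num b *P den a)

one≢0 : ¬ IsZeroP (1ℚ ∷ [])
one≢0 (() ∷ [])

polyF : QP → 𝔽
polyF p = frac p (1ℚ ∷ []) one≢0

0F 1F rF αF : 𝔽
0F = polyF []
1F = polyF (1ℚ ∷ [])
rF = polyF (0ℚ ∷ 1ℚ ∷ [])
αF = frac (1ℚ ∷ []) (0ℚ ∷ 1ℚ ∷ []) λ { (_ ∷ () ∷ []) }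

-- smart constructor p/q; the fallback branch (q = 0) is never used below,
-- since products of nonzero polynomials are nonzero.
_÷_ : QP → QP → 𝔽
p ÷ q with isZeroP? q
... | yes _  = 0F
... | no q≢0 = frac p q q≢0

infixl 6 _+F_
infixl 7 _*F_

_+F_ : 𝔽 → 𝔽 → 𝔽
a +F b = (num a *P den b +P num b *P den a) ÷ (den a *P den b)

_*F_ : 𝔽 → 𝔽 → 𝔽
a *F b = (num a *P num b) ÷ (den a *P den b)

negF : 𝔽 → 𝔽
negF a = frac (negP (num a)) (den a) (den≢0 a)

ℕF : ℕ → 𝔽
ℕF k = polyF ((ℤ.+ k) ℚ./ 1 ∷ [])

signF : ℕ → 𝔽
signF zero    = 1F
signF (suc k) = negF (signF k)

_^F_ : 𝔽 → ℕ → 𝔽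
a ^F zero  = 1F
a ^F suc k = a *F (a ^F k)

-- Polynomials in x_1..x_N over 𝔽: finite sums of terms (exponent, coeff).

size : ∀ {N} → Vec ℕ N → ℕ
size = Vec.sum

MPoly : ℕ → Set
MPoly N = List (Vec ℕ N × 𝔽)

module _ {N : ℕ} where

  coeff : Vec ℕ N → MPoly N → 𝔽
  coeff β = foldr (λ t acc → if Dec.does (≡-dec ℕ._≟_ β (proj₁ t))
                              then proj₂ t +F acc else acc) 0F

  infix 4 _≈M_
  _≈M_ : MPoly N → MPoly N → Set
  p ≈M q = ∀ β → coeff β p ≈F coeff β q

  infixl 6 _+M_
  _+M_ : MPoly N → MPoly N → MPoly N
  _+M_ = _++_

  scaleM : 𝔽 → MPoly N → MPoly N
  scaleM c = map (λ t → proj₁ t , c *F proj₂ t)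

  _*M_ : MPoly N → MPoly N → MPoly N
  p *M q = concatMap (λ t → map (λ s → zipWith ℕ._+_ (proj₁ t) (proj₁ s) , proj₂ t *F proj₂ s) q) p

  constM : 𝔽 → MPoly N
  constM c = (replicate N 0 , c) ∷ []

  monoM : Vec ℕ N → MPoly N
  monoM η = (η , 1F) ∷ []

  varM : Fin N → MPoly N
  varM k = monoM (replicate N 0 [ k ]≔ 1)

  sumM : List (MPoly N) → MPoly N
  sumM = foldr _+M_ []

  evalM : MPoly N → Vec 𝔽 N → 𝔽
  evalM p v = foldr (λ t acc → proj₂ t *F Vec.foldr _ _*F_ 1F (zipWith _^F_ v (proj₁ t)) +F acc) 0F p

  DegLe : ℕ → MPoly N → Set
  DegLe d p = ∀ β → d ℕ.< size β → coeff β p ≈F 0F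

  topComp : ℕ → MPoly N → MPoly N
  topComp d = filter (λ t → size (proj₁ t) ℕ.≟ d)

  countFin : (Fin N → Bool) → ℕ
  countFin P = List.length (List.filterᵇ P (List.allFin N))

  --  \overline γ = γ + w_γ(rδ).  w_γ sorts γ stably into decreasing order, so
  --  (w_γ(rδ))_j = r·(n - rank_j), rank_j = 1 + #{k : γ_k > γ_j} + #{k < j : γ_k = γ_j},
  --  i.e. r·(#{k : γ_k < γ_j} + #{k > j : γ_k = γ_j}).
  barPt : Vec ℕ N → Vec 𝔽 N
  barPt γ = tabulate λ j →
    ℕF (lookup γ j) +F rF *F ℕF (countFin (λ k → lookup γ k <ᵇ lookup γ j)
                                + countFin (λ k → (toℕ j <ᵇ toℕ k) ∧ (lookup γ k ≡ᵇ lookup γ j)))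

  legη : Vec ℕ N → Fin N → ℕ → ℕ
  legη η i j = countFin (λ k → (toℕ i <ᵇ toℕ k) ∧ (j ≤ᵇ lookup η k) ∧ (lookup η k ≤ᵇ lookup η i))
             + countFin (λ k → (toℕ k <ᵇ toℕ i) ∧ (j ≤ᵇ suc (lookup η k)) ∧ (suc (lookup η k) ≤ᵇ lookup η i))

  -- d_η(α) = ∏_{boxes (i,j), 1 ≤ j ≤ η_i} (α (a_η(i,j)+1) + l_η(i,j) + 1)
  dη : Vec ℕ N → 𝔽
  dη η = foldr _*F_ 1F (concatMap (λ i → map (λ j → αF *F ℕF (lookup η i ∸ j + 1) +F ℕF (legη η i j + 1))
                                              (List.map suc (List.upTo (lookup η i))))
                                   (List.allFin N))



module _ {n : ℕ} where

  private
    N = suc n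

  mx : Vec ℕ N → ℕ
  mx = Vec.foldr _ _⊔_ 0

  firstIdx : ∀ {k} → (ℕ → Bool) → Vec ℕ (suc k) → Fin (suc k)
  firstIdx P (x ∷ [])     = zero
  firstIdx P (x ∷ y ∷ xs) = if P x then zero else suc (firstIdx P (y ∷ xs))

  crit : Vec ℕ N → Fin N
  crit η = firstIdx (λ a → a ≡ᵇ mx η) η

  critLeg : Vec ℕ N → ℕ
  critLeg η = countFin (λ i → (toℕ (crit η) <ᵇ toℕ i) ∧ (lookup η i ≡ᵇ mx η))
            + countFin (λ i → (toℕ i <ᵇ toℕ (crit η)) ∧ (lookup η i ≡ᵇ mx η ∸ 1))

  starOf : Vec ℕ N → Vec ℕ N
  starOf η = η [ crit η ]≔ (mx η ∸ 1)

  moveOf : Vec ℕ N → Fin N → ℕ → Vec ℕ N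
  moveOf η j l = (η [ crit η ]≔ (mx η ∸ 1 ∸ l)) [ j ]≔ (lookup η j + l)

  wη : Vec ℕ N → MPoly N
  wη η = varM (crit η) +M constM (ℕF (mx η ∸ 1) +F rF *F ℕF (N ∸ 1 ∸ critLeg η))

  -- glissades η ⋗ γ (only for η ≠ 0, i.e. 0 < max η).
  -- In 'up' (j < k): ε = m-1-η_j-l > 0; in 'down' (j > k): ε ≥ 0.
  data Glissade (η : Vec ℕ N) : Vec ℕ N → Set where
    star : 0 < mx η → Glissade η (starOf η)
    up   : (j : Fin N) (l : ℕ) → 0 < l → j Fin.< crit η →
           lookup η j + l < mx η ∸ 1 → Glissade η (moveOf η j l)
    down : (j : Fin N) (l : ℕ) → 0 < l → crit η Fin.< j →
           lookup η j + l ≤ mx η ∸ 1 → Glissade η (moveOf η j l)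

  glWeight : ∀ {η γ} → Glissade η γ → MPoly N
  glWeight {η} (star _)       = wη η
  glWeight (up _ _ _ _ _)     = constM rF
  glWeight (down _ _ _ _ _)   = constM rF

  -- bar games: chains of glissades ending at 0
  -- (each glissade lowers |η| by one, so the length is automatically |η|)
  data Game : Vec ℕ N → Set where
    done : Game (replicate N 0)
    step : ∀ {η γ} → Glissade η γ → Game γ → Game η

  gameWeight : ∀ {η} → Game η → MPoly N
  gameWeight done       = constM 1F
  gameWeight (step g G) = glWeight g *M gameWeight G

-- Interpolation Jack polynomials and the operator Ξ (characterised by
-- their defining properties).

module _ {N : ℕ} where

  IsInterpolation : (Vec ℕ N → MPoly N) → Set
  IsInterpolation E = ∀ η →
      DegLe (size η) (E η)
    × coeff η (E η) ≈F 1F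
    × (∀ γ → γ ≢ η → size γ ≤ size η → evalM (E η) (barPt γ) ≈F 0F)

  Fα : (Vec ℕ N → MPoly N) → Vec ℕ N → MPoly N
  Fα E η = scaleM (dη η) (topComp (size η) (E η))

  -- F_η^{rδ}(x) = (-1)^{|η|} d_η E_η^{rδ}(-x)
  Frδ : (Vec ℕ N → MPoly N) → Vec ℕ N → MPoly N
  Frδ E η = map (λ t → proj₁ t , signF (size η + size (proj₁ t)) *F dη η *F proj₂ t) (E η)

  IsΞ : (Vec ℕ N → MPoly N) → (MPoly N → MPoly N) → Set
  IsΞ E Ξ =
      (∀ p q → p ≈M q → Ξ p ≈M Ξ q)
    × (∀ p q → Ξ (p +M q) ≈M Ξ p +M Ξ q)
    × (∀ c p → Ξ (scaleM c p) ≈M scaleM c (Ξ p))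
    × (∀ η → Ξ (Fα E η) ≈M Frδ E η)

module Submission where

-- The polynomial x^{\underline η} is characterised by having leading term x^η and
-- vanishing at −γ̄ for |γ| < |η|.  Interpolation at the points γ̄ is unisolvent, since the
-- points with γ_n = 0 are those on the hyperplane x_n = 0 and the others arise from
-- smaller ones by the rotation (a, β) ↦ (β, a + 1).  By this characterisation the
-- adjacent swaps and the rotation of exponents correspond under Ξ to the operators
-- s_i − r ∂_i and f ↦ x_n f(x_n + 1, x_1, …, x_{n−1}), and every composition arises from 0
-- by these moves.  Along them one propagates the relation Ξ(x_k f) = x_k Ξ(f) + Ξ(Y_k f)
-- at the points −γ̄, with Y_k = x_k d/dx_k + r Σ_{j<k} x_k ∂_{kj} + r Σ_{j>k} ∂_{kj} x_k.  For
-- the critical row k and f = x^{η*} the terms of Y_k f are exactly the glissades of η, so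
-- the relation is the recursion satisfied by the bar games.

open import Level using (0ℓ)
open import Algebra.Bundles using (CommutativeRing; RawRing)
open import Data.Bool using (Bool; true; false; if_then_else_; _∧_)
import Data.Bool.Properties as Bool
open import Data.Nat as ℕ using (ℕ; zero; suc; _≤_; _<_; _<ᵇ_; _≡ᵇ_; _∸_; _⊔_; z≤n; s≤s; z<s)
import Data.Nat.Properties as ℕ
open import Data.Fin as Fin using (Fin; zero; suc; inject₁; fromℕ; toℕ; fromℕ<)
import Data.Fin.Properties as Fin
open import Data.Fin.Relation.Unary.Top using (view; ‵fromℕ; ‵inject₁)
open import Data.Vec as Vec using (Vec; []; _∷_; lookup; _∷ʳ_; init; last; initLast; replicate; zipWith; _[_]≔_)
import Data.Vec.Properties as Vec
open import Data.List as List using (List; []; _∷_; _++_; map; foldr; concatMap; allFin; upTo; filter)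
import Data.List.Properties as List
open import Data.List.Membership.Propositional using (_∈_; lose)
open import Data.List.Membership.Propositional.Properties using (∈-map⁺; ∈-map⁻; ∈-++⁺ˡ; ∈-++⁺ʳ; ∈-++⁻; ∈-concatMap⁺; ∈-concatMap⁻; ∈-allFin; ∈-upTo⁺)
open import Data.List.Relation.Unary.Any using (here; there; satisfied)
open import Data.List.Relation.Unary.All as All using (All; []; _∷_)
import Data.List.Relation.Unary.All.Properties as All
open import Data.List.Relation.Unary.Unique.Propositional using (Unique; []; _∷_)
open import Data.Product using (_×_; _,_; proj₁; proj₂; map₁; map₂; ∃; ∃-syntax; Σ)
open import Data.Sum using (_⊎_; inj₁; inj₂; [_,_]′)
open import Function using (_∘_; id; mk⇔)
open import Relation.Nullary using (¬_; yes; no; contradiction; does; Dec)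
open import Relation.Binary.PropositionalEquality as ≡ using (_≡_; _≢_)
open import Data.Maybe using (Maybe; just; nothing)
open import Data.Fin.Induction using (>-weakInduction)
open import Data.List.Relation.Binary.Permutation.Propositional as ↭ using (_↭_)

open import Defs using (size; mx; firstIdx; crit; critLeg; starOf; moveOf; Glissade; star; up; down; Game; done; step)

-- Why the characterisation holds: (-1)^|η| E_η(-x) has top component E_η^(α) and vanishes at -γ̄
-- for γ ≠ η, |γ| ≤ |η|. So Ξ completes the top component of any combination of those with |η| = d
-- by lower terms that make it vanish at the points with |γ| < d. Lagrange interpolation puts x^ζ
-- among these top components. The obstacle to the swap is γ_i = γ_{i+1}: the transposed point is
-- then no interpolation point. But there the two coordinates differ by exactly -r, and s_i - r ∂_i
-- weights the transposed value by x_i - x_{i+1} + r, which is zero. Swap relations are thus stated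
-- after multiplication by x_i - x_{i+1}, which vanishes at none of the points. The relation for x_k
-- is kept at the level of values: for fixed γ, x^ζ ↦ Ξ(x^ζ)(-γ̄) is a linear form, and Y_k acts on
-- forms. The correction from commuting Y_k with a swap cancels against the change of the k-th
-- coordinate. The critical row is longest, so each ∂_{kj} expands with coefficients +1. One of its
-- terms may be x^{η*} itself; the rows j ≠ k outside the critical leg give one such term each, in
-- all r(n - 1 - l[η]).

-- A ring solver with integer coefficients.

module IntegerSolver (R : CommutativeRing 0ℓ 0ℓ) where

  open CommutativeRing R
  open import Algebra.Properties.Ring ring
  open import Algebra.Properties.Semiring.Mult semiring renaming (_×_ to _·_)
  open import Algebra.Solver.Ring.AlmostCommutativeRing
  import Algebra.Solver.Ring
  open import Algebra.Solver.Ring.NaturalCoefficients.Default commutativeSemiring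
    using () renaming (solve to solveℕ; _:=_ to _⊜_; _:+_ to _⊕_; _:*_ to _⊗_)
  open import Relation.Binary.Reasoning.Setoid setoid

  -- Natural coefficients cannot cancel `x - x`. Integers enter as formal differences of naturals,
  -- whose images in any ring are built from multiples of `1#`.
  value : ℕ × ℕ → Carrier
  value (m , n) = m · 1# - n · 1#

  value-cong : ∀ m n m′ n′ → m ℕ.+ n′ ≡ m′ ℕ.+ n → value (m , n) ≈ value (m′ , n′)
  value-cong m n m′ n′ eq = x-y≈x′-y′ (trans (sym (×-homo-+ 1# m n′)) (trans (reflexive (≡.cong (_· 1#) eq)) (×-homo-+ 1# m′ n)))
    where
    x-y≈x′-y′ : ∀ {x y x′ y′} → x + y′ ≈ x′ + y → x - y ≈ x′ - y′
    x-y≈x′-y′ {x} {y} {x′} {y′} e = begin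
      x - y ≈⟨ +-identityʳ _ ⟨
      x - y + 0# ≈⟨ +-cong refl (-‿inverseʳ y′) ⟨
      x - y + (y′ - y′) ≈⟨ solveℕ 4 (λ a b c d → (a ⊕ b) ⊕ (c ⊕ d) ⊜ (a ⊕ c) ⊕ (b ⊕ d)) refl _ _ _ _ ⟩
      (x + y′) + (- y - y′) ≈⟨ +-cong e refl ⟩
      (x′ + y) + (- y - y′) ≈⟨ solveℕ 4 (λ a b c d → (a ⊕ b) ⊕ (c ⊕ d) ⊜ (a ⊕ d) ⊕ (b ⊕ c)) refl _ _ _ _ ⟩
      (x′ - y′) + (y - y) ≈⟨ +-cong refl (-‿inverseʳ y) ⟩
      x′ - y′ + 0# ≈⟨ +-identityʳ _ ⟩
      x′ - y′ ∎

  -- The solver compares normal forms syntactically.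
  norm : ℕ × ℕ → ℕ × ℕ
  norm (suc m , suc n) = norm (m , n)
  norm c = c

  value-norm : ∀ m n → value (norm (m , n)) ≈ value (m , n)
  value-norm zero n = refl
  value-norm (suc m) zero = refl
  value-norm (suc m) (suc n) = trans (value-norm m n) (value-cong m n (suc m) (suc n) (ℕ.+-suc m n))

  -- A pair (m , n) stands for the integer coefficient m − n.
  Differences : RawRing 0ℓ 0ℓ
  Differences = record
    { Carrier = ℕ × ℕ
    ; _≈_ = λ { (m , n) (m′ , n′) → m ℕ.+ n′ ≡ m′ ℕ.+ n }
    ; _+_ = λ { (m , n) (m′ , n′) → norm (m ℕ.+ m′ , n ℕ.+ n′) }
    ; _*_ = λ { (m , n) (m′ , n′) → norm (m ℕ.* m′ ℕ.+ n ℕ.* n′ , m ℕ.* n′ ℕ.+ n ℕ.* m′) }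
    ; -_ = λ { (m , n) → n , m }
    ; 0# = 0 , 0
    ; 1# = 1 , 0
    }

  -- The solver interprets the coefficients 0 and 1 on the nose.
  ⟦_⟧ᶜ : ℕ × ℕ → Carrier
  ⟦ 0 , 0 ⟧ᶜ = 0#
  ⟦ 1 , 0 ⟧ᶜ = 1#
  ⟦ c ⟧ᶜ = value c

  ⟦⟧ᶜ≈value : ∀ c → ⟦ c ⟧ᶜ ≈ value c
  ⟦⟧ᶜ≈value (0 , 0) = sym (-‿inverseʳ 0#)
  ⟦⟧ᶜ≈value (1 , 0) = sym (trans (+-cong (+-identityʳ 1#) (trans (sym (+-identityˡ _)) (-‿inverseʳ 0#))) (+-identityʳ 1#))
  ⟦⟧ᶜ≈value (0 , suc n) = refl
  ⟦⟧ᶜ≈value (1 , suc n) = refl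
  ⟦⟧ᶜ≈value (suc (suc m) , n) = refl

  differences⟶R : Differences -Raw-AlmostCommutative⟶ fromCommutativeRing R
  differences⟶R = record
    { ⟦_⟧ = ⟦_⟧ᶜ
    ; +-homo = λ { (m , n) (m′ , n′) → begin
        ⟦ norm (m ℕ.+ m′ , n ℕ.+ n′) ⟧ᶜ
          ≈⟨ trans (⟦⟧ᶜ≈value (norm (m ℕ.+ m′ , n ℕ.+ n′))) (value-norm (m ℕ.+ m′) (n ℕ.+ n′)) ⟩
        (m ℕ.+ m′) · 1# - (n ℕ.+ n′) · 1#
          ≈⟨ +-cong (×-homo-+ 1# m m′) (trans (-‿cong (×-homo-+ 1# n n′)) (sym (⁻¹-∙-comm _ _))) ⟩
        (m · 1# + m′ · 1#) + (- (n · 1#) + - (n′ · 1#))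
          ≈⟨ solveℕ 4 (λ a b c d → (a ⊕ b) ⊕ (c ⊕ d) ⊜ (a ⊕ c) ⊕ (b ⊕ d)) refl _ _ _ _ ⟩
        value (m , n) + value (m′ , n′)
          ≈⟨ +-cong (⟦⟧ᶜ≈value (m , n)) (⟦⟧ᶜ≈value (m′ , n′)) ⟨
        ⟦ m , n ⟧ᶜ + ⟦ m′ , n′ ⟧ᶜ ∎ }
    ; *-homo = λ { (m , n) (m′ , n′) → begin
        ⟦ norm (m ℕ.* m′ ℕ.+ n ℕ.* n′ , m ℕ.* n′ ℕ.+ n ℕ.* m′) ⟧ᶜ
          ≈⟨ trans (⟦⟧ᶜ≈value (norm (m ℕ.* m′ ℕ.+ n ℕ.* n′ , m ℕ.* n′ ℕ.+ n ℕ.* m′)))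
                   (value-norm (m ℕ.* m′ ℕ.+ n ℕ.* n′) (m ℕ.* n′ ℕ.+ n ℕ.* m′)) ⟩
        (m ℕ.* m′ ℕ.+ n ℕ.* n′) · 1# - (m ℕ.* n′ ℕ.+ n ℕ.* m′) · 1#
          ≈⟨ +-cong (trans (×-homo-+ 1# (m ℕ.* m′) (n ℕ.* n′)) (+-cong (×1-homo-* m m′) (×1-homo-* n n′)))
                    (-‿cong (trans (×-homo-+ 1# (m ℕ.* n′) (n ℕ.* m′)) (+-cong (×1-homo-* m n′) (×1-homo-* n m′)))) ⟩
        (m · 1#) * (m′ · 1#) + (n · 1#) * (n′ · 1#) - ((m · 1#) * (n′ · 1#) + (n · 1#) * (m′ · 1#))
          ≈⟨ +-cong (+-cong refl (trans (sym (-‿involutive _)) (trans (-‿cong (-‿distribˡ-* _ _)) (-‿distribʳ-* _ _))))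
                    (trans (sym (⁻¹-∙-comm _ _)) (+-cong (-‿distribʳ-* _ _) (-‿distribˡ-* _ _))) ⟩
        (m · 1#) * (m′ · 1#) + (- (n · 1#)) * (- (n′ · 1#)) + ((m · 1#) * (- (n′ · 1#)) + (- (n · 1#)) * (m′ · 1#))
          ≈⟨ solveℕ 4 (λ a b c d → (a ⊗ c ⊕ b ⊗ d) ⊕ (a ⊗ d ⊕ b ⊗ c) ⊜ (a ⊕ b) ⊗ (c ⊕ d)) refl _ _ _ _ ⟩
        value (m , n) * value (m′ , n′)
          ≈⟨ *-cong (⟦⟧ᶜ≈value (m , n)) (⟦⟧ᶜ≈value (m′ , n′)) ⟨
        ⟦ m , n ⟧ᶜ * ⟦ m′ , n′ ⟧ᶜ ∎ }
    ; -‿homo = λ { (m , n) → begin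
        ⟦ n , m ⟧ᶜ ≈⟨ ⟦⟧ᶜ≈value (n , m) ⟩
        n · 1# - m · 1# ≈⟨ +-comm _ _ ⟩
        - (m · 1#) + n · 1# ≈⟨ +-cong refl (sym (-‿involutive _)) ⟩
        - (m · 1#) + - - (n · 1#) ≈⟨ ⁻¹-∙-comm _ _ ⟩
        - value (m , n) ≈⟨ -‿cong (⟦⟧ᶜ≈value (m , n)) ⟨
        - ⟦ m , n ⟧ᶜ ∎ }
    ; 0-homo = refl
    ; 1-homo = refl
    }
    where open import Algebra.Properties.AbelianGroup +-abelianGroup using (⁻¹-∙-comm)

  -- Distinct integers may have equal images in positive characteristic; answering `nothing` instead
  -- of a refutation is sound in every ring.
  _≟ᵈ_ : ∀ c d → Maybe (⟦ c ⟧ᶜ ≈ ⟦ d ⟧ᶜ)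
  (m , n) ≟ᵈ (m′ , n′) with m ℕ.+ n′ ℕ.≟ m′ ℕ.+ n
  ... | yes eq = just (trans (⟦⟧ᶜ≈value (m , n)) (trans (value-cong m n m′ n′ eq) (sym (⟦⟧ᶜ≈value (m′ , n′)))))
  ... | no _ = nothing

  open Algebra.Solver.Ring Differences (fromCommutativeRing R) differences⟶R _≟ᵈ_ public
    using (solve; _:=_; _:+_; _:*_; _:-_; :-_; con)

  :0 :1 : ∀ {n} → Algebra.Solver.Ring.Polynomial Differences (fromCommutativeRing R) differences⟶R _≟ᵈ_ n
  :0 = con (0 , 0)
  :1 = con (1 , 0)

-- The field ℚ(r) as fractions of coefficient lists.

module RationalFunctions where

  open import Defs
  open import Data.Integer as ℤ using (ℤ)
  import Data.Integer.Properties as ℤ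
  open import Data.Rational as ℚ using (ℚ; 0ℚ; 1ℚ)
  import Data.Rational.Properties as ℚ
  import Data.Rational.Unnormalised as ℚᵘ
  import Data.Rational.Unnormalised.Properties as ℚᵘ
  open import Relation.Binary using (IsEquivalence; Setoid)

  private module ℚ-Solver = IntegerSolver ℚ.+-*-commutativeRing

  infixl 9 _⟨_⟩
  _⟨_⟩ : QP → ℕ → ℚ
  [] ⟨ i ⟩ = 0ℚ
  (a ∷ p) ⟨ zero ⟩ = a
  (a ∷ p) ⟨ suc i ⟩ = p ⟨ i ⟩

  infix 4 _≋_
  -- Comparing coefficients at every index ignores trailing zeros, so the ring laws can be checked
  -- pointwise. The record keeps `p` and `q` inferable.
  record _≋_ (p q : QP) : Set where
    constructor ≋-intro
    field at : ∀ i → p ⟨ i ⟩ ≡ q ⟨ i ⟩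
  open _≋_

  module _ where
    open ≡.≡-Reasoning
    open ℚ-Solver

    +P-at : ∀ p q i → (p +P q) ⟨ i ⟩ ≡ p ⟨ i ⟩ ℚ.+ q ⟨ i ⟩
    +P-at [] q i = ≡.sym (ℚ.+-identityˡ _)
    +P-at (a ∷ p) [] i = ≡.sym (ℚ.+-identityʳ _)
    +P-at (a ∷ p) (b ∷ q) zero = ≡.refl
    +P-at (a ∷ p) (b ∷ q) (suc i) = +P-at p q i

    scaleP-at : ∀ c p i → scaleP c p ⟨ i ⟩ ≡ c ℚ.* p ⟨ i ⟩
    scaleP-at c [] i = ≡.sym (ℚ.*-zeroʳ c)
    scaleP-at c (a ∷ p) zero = ≡.refl
    scaleP-at c (a ∷ p) (suc i) = scaleP-at c p i

    negP-at : ∀ p i → negP p ⟨ i ⟩ ≡ ℚ.- (p ⟨ i ⟩)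
    negP-at [] i = ≡.refl
    negP-at (a ∷ p) zero = ≡.refl
    negP-at (a ∷ p) (suc i) = negP-at p i

    IsZeroP⇒≋ : ∀ {p} → IsZeroP p → p ≋ []
    IsZeroP⇒≋ z = ≋-intro (go z)
      where
      go : ∀ {p} → IsZeroP p → ∀ i → p ⟨ i ⟩ ≡ 0ℚ
      go [] i = ≡.refl
      go (z ∷ zs) zero = z
      go (z ∷ zs) (suc i) = go zs i

    ≋⇒IsZeroP : ∀ {p} → p ≋ [] → IsZeroP p
    ≋⇒IsZeroP {[]} e = []
    ≋⇒IsZeroP {a ∷ p} e = at e zero ∷ ≋⇒IsZeroP (≋-intro λ i → at e (suc i))

    ≋-isEquivalence : IsEquivalence _≋_
    ≋-isEquivalence = record
      { refl = ≋-intro λ _ → ≡.refl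
      ; sym = λ e → ≋-intro λ i → ≡.sym (at e i)
      ; trans = λ e f → ≋-intro λ i → ≡.trans (at e i) (at f i)
      }

    ≈P⇒≋ : ∀ {p q} → p ≈P q → p ≋ q
    ≈P⇒≋ {p} {q} e = ≋-intro λ i → begin
      p ⟨ i ⟩ ≡⟨ solve 2 (λ x y → x := (x :- y) :+ y) ≡.refl (p ⟨ i ⟩) (q ⟨ i ⟩) ⟩
      p ⟨ i ⟩ ℚ.- q ⟨ i ⟩ ℚ.+ q ⟨ i ⟩ ≡⟨ ≡.cong (ℚ._+ q ⟨ i ⟩) (≡.trans (≡.cong (p ⟨ i ⟩ ℚ.+_) (≡.sym (negP-at q i))) (≡.trans (≡.sym (+P-at p (negP q) i)) (at (IsZeroP⇒≋ e) i))) ⟩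
      0ℚ ℚ.+ q ⟨ i ⟩ ≡⟨ ℚ.+-identityˡ _ ⟩
      q ⟨ i ⟩ ∎

    ≋⇒≈P : ∀ {p q} → p ≋ q → p ≈P q
    ≋⇒≈P {p} {q} e = ≋⇒IsZeroP (≋-intro λ i → begin
      (p +P negP q) ⟨ i ⟩ ≡⟨ +P-at p (negP q) i ⟩
      p ⟨ i ⟩ ℚ.+ negP q ⟨ i ⟩ ≡⟨ ≡.cong₂ ℚ._+_ (at e i) (negP-at q i) ⟩
      q ⟨ i ⟩ ℚ.- q ⟨ i ⟩ ≡⟨ ℚ.+-inverseʳ (q ⟨ i ⟩) ⟩
      0ℚ ∎)

    open IsEquivalence ≋-isEquivalence using () renaming (refl to ≋-refl; sym to ≋-sym; trans to ≋-trans)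

    ∷-cong : ∀ {a b p q} → a ≡ b → p ≋ q → a ∷ p ≋ b ∷ q
    ∷-cong e f = ≋-intro λ { zero → e ; (suc i) → at f i }

    0∷[] : ∀ {p} → p ≋ [] → 0ℚ ∷ p ≋ []
    0∷[] e = ≋-intro λ { zero → ≡.refl ; (suc i) → at e i }

    +P-cong : ∀ {p p′ q q′} → p ≋ p′ → q ≋ q′ → p +P q ≋ p′ +P q′
    +P-cong {p} {p′} {q} {q′} e f = ≋-intro λ i →
      ≡.trans (+P-at p q i) (≡.trans (≡.cong₂ ℚ._+_ (at e i) (at f i)) (≡.sym (+P-at p′ q′ i)))

    scaleP-cong : ∀ {c p q} → p ≋ q → scaleP c p ≋ scaleP c q
    scaleP-cong {c} {p} {q} e = ≋-intro λ i →
      ≡.trans (scaleP-at c p i) (≡.trans (≡.cong (c ℚ.*_) (at e i)) (≡.sym (scaleP-at c q i)))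

    negP-cong : ∀ {p q} → p ≋ q → negP p ≋ negP q
    negP-cong {p} {q} e = ≋-intro λ i →
      ≡.trans (negP-at p i) (≡.trans (≡.cong ℚ.-_ (at e i)) (≡.sym (negP-at q i)))

    +P-identityʳ : ∀ p → p +P [] ≋ p
    +P-identityʳ [] = ≋-refl
    +P-identityʳ (a ∷ p) = ≋-refl

    +P-assoc : ∀ p q s → (p +P q) +P s ≋ p +P (q +P s)
    +P-assoc p q s = ≋-intro pointwise
      where
      pointwise : ∀ i → ((p +P q) +P s) ⟨ i ⟩ ≡ (p +P (q +P s)) ⟨ i ⟩
      pointwise i rewrite +P-at (p +P q) s i | +P-at p q i | +P-at p (q +P s) i | +P-at q s i = ℚ.+-assoc (p ⟨ i ⟩) (q ⟨ i ⟩) (s ⟨ i ⟩)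

    +P-comm : ∀ p q → p +P q ≋ q +P p
    +P-comm p q = ≋-intro λ i →
      ≡.trans (+P-at p q i) (≡.trans (ℚ.+-comm (p ⟨ i ⟩) (q ⟨ i ⟩)) (≡.sym (+P-at q p i)))

    +P-interchange : ∀ p q s t → (p +P q) +P (s +P t) ≋ (p +P s) +P (q +P t)
    +P-interchange p q s t =
      ≋-trans (+P-assoc p q (s +P t))
      (≋-trans (+P-cong (≋-refl {p}) (≋-trans (≋-sym (+P-assoc q s t)) (≋-trans (+P-cong (+P-comm q s) (≋-refl {t})) (+P-assoc s q t))))
      (≋-sym (+P-assoc p s (q +P t))))

    scaleP-+P : ∀ c p q → scaleP c (p +P q) ≋ scaleP c p +P scaleP c q
    scaleP-+P c p q = ≋-intro pointwise
      where
      pointwise : ∀ i → scaleP c (p +P q) ⟨ i ⟩ ≡ (scaleP c p +P scaleP c q) ⟨ i ⟩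
      pointwise i rewrite scaleP-at c (p +P q) i | +P-at p q i | +P-at (scaleP c p) (scaleP c q) i | scaleP-at c p i | scaleP-at c q i =
        ℚ.*-distribˡ-+ c (p ⟨ i ⟩) (q ⟨ i ⟩)

    +ℚ-scaleP : ∀ a b p → scaleP (a ℚ.+ b) p ≋ scaleP a p +P scaleP b p
    +ℚ-scaleP a b p = ≋-intro pointwise
      where
      pointwise : ∀ i → scaleP (a ℚ.+ b) p ⟨ i ⟩ ≡ (scaleP a p +P scaleP b p) ⟨ i ⟩
      pointwise i rewrite scaleP-at (a ℚ.+ b) p i | +P-at (scaleP a p) (scaleP b p) i | scaleP-at a p i | scaleP-at b p i =
        ℚ.*-distribʳ-+ (p ⟨ i ⟩) a b

    scaleP-scaleP : ∀ a b p → scaleP a (scaleP b p) ≋ scaleP (a ℚ.* b) p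
    scaleP-scaleP a b p = ≋-intro pointwise
      where
      pointwise : ∀ i → scaleP a (scaleP b p) ⟨ i ⟩ ≡ scaleP (a ℚ.* b) p ⟨ i ⟩
      pointwise i rewrite scaleP-at a (scaleP b p) i | scaleP-at b p i | scaleP-at (a ℚ.* b) p i = ≡.sym (ℚ.*-assoc a b (p ⟨ i ⟩))

    scaleP-zero : ∀ p → scaleP 0ℚ p ≋ []
    scaleP-zero p = ≋-intro λ i → ≡.trans (scaleP-at 0ℚ p i) (ℚ.*-zeroˡ (p ⟨ i ⟩))

    scaleP-one : ∀ p → scaleP 1ℚ p ≋ p
    scaleP-one p = ≋-intro λ i → ≡.trans (scaleP-at 1ℚ p i) (ℚ.*-identityˡ (p ⟨ i ⟩))

    scaleP-0∷ : ∀ c p → scaleP c (0ℚ ∷ p) ≋ 0ℚ ∷ scaleP c p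
    scaleP-0∷ c p = ∷-cong (ℚ.*-zeroʳ c) ≋-refl

    *P-cong₂ : ∀ p {q q′} → q ≋ q′ → p *P q ≋ p *P q′
    *P-cong₂ [] e = ≋-refl
    *P-cong₂ (a ∷ p) e = +P-cong (scaleP-cong {a} e) (∷-cong ≡.refl (*P-cong₂ p e))

    *P-distribʳ : ∀ s p q → (p +P q) *P s ≋ p *P s +P q *P s
    *P-distribʳ s [] q = ≋-refl
    *P-distribʳ s (a ∷ p) [] = ≋-sym (+P-identityʳ _)
    *P-distribʳ s (a ∷ p) (b ∷ q) =
      ≋-trans (+P-cong (+ℚ-scaleP a b s) (∷-cong ≡.refl (*P-distribʳ s p q)))
              (+P-interchange (scaleP a s) (scaleP b s) (0ℚ ∷ p *P s) (0ℚ ∷ q *P s))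

    scaleP-*P : ∀ c p q → scaleP c p *P q ≋ scaleP c (p *P q)
    scaleP-*P c [] q = ≋-refl
    scaleP-*P c (a ∷ p) q =
      ≋-trans (+P-cong (≋-sym (scaleP-scaleP c a q))
                       (≋-trans (∷-cong ≡.refl (scaleP-*P c p q)) (≋-sym (scaleP-0∷ c (p *P q)))))
              (≋-sym (scaleP-+P c (scaleP a q) (0ℚ ∷ p *P q)))

    0∷-*P : ∀ p q → (0ℚ ∷ p) *P q ≋ 0ℚ ∷ p *P q
    0∷-*P p q = +P-cong (scaleP-zero q) ≋-refl

    *P-∷ : ∀ p b q → p *P (b ∷ q) ≋ scaleP b p +P (0ℚ ∷ p *P q)
    *P-∷ [] b q = ≋-sym (0∷[] ≋-refl)
    *P-∷ (a ∷ p) b q = ∷-cong (≡.cong (ℚ._+ 0ℚ) (ℚ.*-comm a b))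
      (≋-trans (+P-cong (≋-refl {scaleP a q}) (*P-∷ p b q))
      (≋-trans (≋-sym (+P-assoc (scaleP a q) (scaleP b p) (0ℚ ∷ p *P q)))
      (≋-trans (+P-cong (+P-comm (scaleP a q) (scaleP b p)) ≋-refl)
               (+P-assoc (scaleP b p) (scaleP a q) (0ℚ ∷ p *P q)))))

    *P-zeroʳ : ∀ p → p *P [] ≋ []
    *P-zeroʳ [] = ≋-refl
    *P-zeroʳ (a ∷ p) = 0∷[] (*P-zeroʳ p)

    *P-comm : ∀ p q → p *P q ≋ q *P p
    *P-comm [] q = ≋-sym (*P-zeroʳ q)
    *P-comm (a ∷ p) q = ≋-trans (+P-cong (≋-refl {scaleP a q}) (∷-cong ≡.refl (*P-comm p q))) (≋-sym (*P-∷ q a p))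

    *P-cong : ∀ {p p′ q q′} → p ≋ p′ → q ≋ q′ → p *P q ≋ p′ *P q′
    *P-cong {p} {p′} {q} {q′} e f =
      ≋-trans (*P-cong₂ p f) (≋-trans (*P-comm p q′) (≋-trans (*P-cong₂ q′ e) (*P-comm q′ p′)))

    *P-assoc : ∀ p q s → (p *P q) *P s ≋ p *P (q *P s)
    *P-assoc [] q s = ≋-refl
    *P-assoc (a ∷ p) q s =
      ≋-trans (*P-distribʳ s (scaleP a q) (0ℚ ∷ p *P q))
              (+P-cong (scaleP-*P a q s) (≋-trans (0∷-*P (p *P q) s) (∷-cong ≡.refl (*P-assoc p q s))))

    *P-identityˡ : ∀ p → (1ℚ ∷ []) *P p ≋ p
    *P-identityˡ p = ≋-trans (+P-cong (scaleP-one p) (0∷[] ≋-refl)) (+P-identityʳ p)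

    +P-inverseʳ : ∀ p → p +P negP p ≋ []
    +P-inverseʳ p = IsZeroP⇒≋ (≋⇒≈P (≋-refl {p}))

    ℚ[r] : CommutativeRing 0ℓ 0ℓ
    ℚ[r] = record
      { Carrier = QP ; _≈_ = _≋_ ; _+_ = _+P_ ; _*_ = _*P_ ; -_ = negP ; 0# = [] ; 1# = 1ℚ ∷ []
      ; isCommutativeRing = record
        { isRing = record
          { +-isAbelianGroup = record
            { isGroup = record
              { isMonoid = record
                { isSemigroup = record
                  { isMagma = record { isEquivalence = ≋-isEquivalence ; ∙-cong = +P-cong }
                  ; assoc = +P-assoc }
                ; identity = (λ _ → ≋-refl) , +P-identityʳ }
              ; inverse = (λ p → ≋-trans (+P-comm (negP p) p) (+P-inverseʳ p)) , +P-inverseʳ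
              ; ⁻¹-cong = negP-cong }
            ; comm = +P-comm }
          ; *-cong = *P-cong
          ; *-assoc = *P-assoc
          ; *-identity = *P-identityˡ , λ p → ≋-trans (*P-comm p (1ℚ ∷ [])) (*P-identityˡ p)
          ; distrib = (λ p q s → ≋-trans (*P-comm p (q +P s)) (≋-trans (*P-distribʳ p q s) (+P-cong (*P-comm q p) (*P-comm s p))))
                    , *P-distribʳ }
        ; *-comm = *P-comm }
      }

    ∷-injective : ∀ {a p} → a ∷ p ≋ [] → a ≡ 0ℚ × p ≋ []
    ∷-injective e = at e zero , ≋-intro λ i → at e (suc i)

    ℚ-cancel : ∀ {a b} → a ≢ 0ℚ → a ℚ.* b ≡ 0ℚ → b ≡ 0ℚ
    ℚ-cancel {a} {b} a≢0 ab≡0 = begin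
      b ≡⟨ ℚ.*-identityˡ b ⟨
      1ℚ ℚ.* b ≡⟨ ≡.cong (ℚ._* b) (ℚ.*-inverseˡ a) ⟨
      ℚ.1/ a ℚ.* a ℚ.* b ≡⟨ ℚ.*-assoc (ℚ.1/ a) a b ⟩
      ℚ.1/ a ℚ.* (a ℚ.* b) ≡⟨ ≡.cong (ℚ.1/ a ℚ.*_) ab≡0 ⟩
      ℚ.1/ a ℚ.* 0ℚ ≡⟨ ℚ.*-zeroʳ (ℚ.1/ a) ⟩
      0ℚ ∎
      where instance _ = ℚ.≢-nonZero a≢0

    -- The lowest nonzero coefficient of a product is the product of those of the factors.
    *P-integral : ∀ p q → p *P q ≋ [] → p ≋ [] ⊎ q ≋ []
    *P-integral [] q e = inj₁ ≋-refl
    *P-integral (a ∷ p) q e with a ℚ.≟ 0ℚ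
    ... | yes ≡.refl = [ (λ z → inj₁ (0∷[] z)) , inj₂ ]′
                         (*P-integral p q (proj₂ (∷-injective (≋-trans (≋-sym (0∷-*P p q)) e))))
    ... | no a≢0 = inj₂ (go q e)
      where
      go : ∀ q → (a ∷ p) *P q ≋ [] → q ≋ []
      go [] e = ≋-refl
      go (b ∷ q) e with ℚ-cancel a≢0 (≡.trans (≡.sym (ℚ.+-identityʳ (a ℚ.* b))) (at e zero))
      ... | ≡.refl = 0∷[] (go q (proj₂ (∷-injective (≋-trans (≋-sym
            (≋-trans (*P-∷ (a ∷ p) 0ℚ q) (+P-cong (scaleP-zero (a ∷ p)) ≋-refl))) e))))

    *P-nonzero : ∀ {p q} → ¬ IsZeroP p → ¬ IsZeroP q → ¬ IsZeroP (p *P q)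
    *P-nonzero {p} {q} p≢0 q≢0 z =
      [ (λ e → p≢0 (≋⇒IsZeroP e)) , (λ e → q≢0 (≋⇒IsZeroP e)) ]′ (*P-integral p q (IsZeroP⇒≋ z))

  module Fractions (D : CommutativeRing 0ℓ 0ℓ) where

    open CommutativeRing D
    open IntegerSolver D
    open import Relation.Binary.Reasoning.Setoid setoid
    open import Algebra.Properties.Group +-group using (x∙y⁻¹≈ε⇒x≈y)

    -- Transitivity is the one law of fraction equality that cancels a factor, the middle
    -- denominator; this is where the absence of zero divisors enters.
    trans-law : ∀ {a a′ b b′ c c′} → (∀ x → b′ * x ≈ 0# → x ≈ 0#) →
                a * b′ ≈ b * a′ → b * c′ ≈ c * b′ → a * c′ ≈ c * a′
    trans-law {a} {a′} {b} {b′} {c} {c′} cancel e f = x∙y⁻¹≈ε⇒x≈y _ _ (cancel _ (begin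
      b′ * (a * c′ - c * a′) ≈⟨ solve 6 (λ a a′ b b′ c c′ → b′ :* (a :* c′ :- c :* a′) := a :* b′ :* c′ :- c :* b′ :* a′) refl a a′ b b′ c c′ ⟩
      a * b′ * c′ - c * b′ * a′ ≈⟨ +-cong (*-cong e refl) (-‿cong (*-cong (sym f) refl)) ⟩
      b * a′ * c′ - b * c′ * a′ ≈⟨ solve 3 (λ b a′ c′ → b :* a′ :* c′ :- b :* c′ :* a′ := :0) refl b a′ c′ ⟩
      0# ∎))

    +-cong-law : ∀ {a a′ b b′ c c′ d d′} → a * b′ ≈ b * a′ → c * d′ ≈ d * c′ →
                 (a * c′ + c * a′) * (b′ * d′) ≈ (b * d′ + d * b′) * (a′ * c′)
    +-cong-law {a} {a′} {b} {b′} {c} {c′} {d} {d′} e f = begin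
      (a * c′ + c * a′) * (b′ * d′) ≈⟨ solve 6 (λ a a′ b′ c c′ d′ → (a :* c′ :+ c :* a′) :* (b′ :* d′) := a :* b′ :* (c′ :* d′) :+ c :* d′ :* (a′ :* b′)) refl a a′ b′ c c′ d′ ⟩
      a * b′ * (c′ * d′) + c * d′ * (a′ * b′) ≈⟨ +-cong (*-cong e refl) (*-cong f refl) ⟩
      b * a′ * (c′ * d′) + d * c′ * (a′ * b′) ≈⟨ solve 6 (λ a′ b b′ c′ d d′ → b :* a′ :* (c′ :* d′) :+ d :* c′ :* (a′ :* b′) := (b :* d′ :+ d :* b′) :* (a′ :* c′)) refl a′ b b′ c′ d d′ ⟩
      (b * d′ + d * b′) * (a′ * c′) ∎

    *-cong-law : ∀ {a a′ b b′ c c′ d d′} → a * b′ ≈ b * a′ → c * d′ ≈ d * c′ →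
                 (a * c) * (b′ * d′) ≈ (b * d) * (a′ * c′)
    *-cong-law {a} {a′} {b} {b′} {c} {c′} {d} {d′} e f = begin
      (a * c) * (b′ * d′) ≈⟨ solve 4 (λ a b′ c d′ → (a :* c) :* (b′ :* d′) := (a :* b′) :* (c :* d′)) refl a b′ c d′ ⟩
      (a * b′) * (c * d′) ≈⟨ *-cong e f ⟩
      (b * a′) * (d * c′) ≈⟨ solve 4 (λ b a′ d c′ → (b :* a′) :* (d :* c′) := (b :* d) :* (a′ :* c′)) refl b a′ d c′ ⟩
      (b * d) * (a′ * c′) ∎

    neg-cong-law : ∀ {a a′ b b′} → a * b′ ≈ b * a′ → (- a) * b′ ≈ (- b) * a′
    neg-cong-law {a} {a′} {b} {b′} e = begin
      (- a) * b′ ≈⟨ solve 2 (λ a b′ → (:- a) :* b′ := :- (a :* b′)) refl a b′ ⟩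
      - (a * b′) ≈⟨ -‿cong e ⟩
      - (b * a′) ≈⟨ solve 2 (λ b a′ → :- (b :* a′) := (:- b) :* a′) refl b a′ ⟩
      (- b) * a′ ∎

  open Fractions ℚ[r]
  open CommutativeRing ℚ[r] using () renaming (refl to ≋-refl; sym to ≋-sym; trans to ≋-trans)

  ÷-elim : ∀ p {q} → ¬ IsZeroP q → num (p ÷ q) ≡ p × den (p ÷ q) ≡ q
  ÷-elim p {q} q≢0 with isZeroP? q
  ... | yes z = contradiction z q≢0
  ... | no _ = ≡.refl , ≡.refl

  infix 4 _↝_/_
  -- `_÷_` branches on a zero test, so numerator and denominator of a composite expression do not
  -- compute. This records the unreduced fraction it stands for, and each field law becomes a single
  -- polynomial identity.
  record _↝_/_ (a : 𝔽) (p q : QP) : Set where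
    constructor represents
    field
      num≡ : num a ≡ p
      den≡ : den a ≡ q

  atom : ∀ a → a ↝ num a / den a
  atom a = represents ≡.refl ≡.refl

  infixl 6 _⊹_
  infixl 7 _⊛_

  _⊹_ : ∀ {a p q b p′ q′} → a ↝ p / q → b ↝ p′ / q′ → (a +F b) ↝ p *P q′ +P p′ *P q / q *P q′
  _⊹_ {a} {b = b} (represents ≡.refl ≡.refl) (represents ≡.refl ≡.refl) =
    represents (proj₁ eqs) (proj₂ eqs)
    where eqs = ÷-elim (num a *P den b +P num b *P den a) (*P-nonzero (den≢0 a) (den≢0 b))

  _⊛_ : ∀ {a p q b p′ q′} → a ↝ p / q → b ↝ p′ / q′ → (a *F b) ↝ p *P p′ / q *P q′
  _⊛_ {a} {b = b} (represents ≡.refl ≡.refl) (represents ≡.refl ≡.refl) =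
    represents (proj₁ eqs) (proj₂ eqs)
    where eqs = ÷-elim (num a *P num b) (*P-nonzero (den≢0 a) (den≢0 b))

  ≈F-intro : ∀ {a p q b p′ q′} → a ↝ p / q → b ↝ p′ / q′ → p *P q′ ≋ p′ *P q → a ≈F b
  ≈F-intro (represents ≡.refl ≡.refl) (represents ≡.refl ≡.refl) e = ≋⇒≈P e

  ≈F-elim : ∀ {a p q b p′ q′} → a ↝ p / q → b ↝ p′ / q′ → a ≈F b → p *P q′ ≋ p′ *P q
  ≈F-elim (represents ≡.refl ≡.refl) (represents ≡.refl ≡.refl) e = ≈P⇒≋ e

  *P-cancel : ∀ {p} → ¬ IsZeroP p → ∀ q → p *P q ≋ [] → q ≋ []
  *P-cancel p≢0 q e = [ (λ z → contradiction (≋⇒IsZeroP z) p≢0) , (λ z → z) ]′ (*P-integral _ q e)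

  module _ where
    open import Algebra.Definitions _≈F_
    open IntegerSolver ℚ[r]

    ≈F-refl : ∀ {a} → a ≈F a
    ≈F-refl {a} = ≈F-intro (atom a) (atom a) (≋-refl)

    ≈F-sym : ∀ {a b} → a ≈F b → b ≈F a
    ≈F-sym {a} {b} e = ≈F-intro (atom b) (atom a) (≋-sym (≈F-elim (atom a) (atom b) e))

    ≈F-trans : ∀ {a b c} → a ≈F b → b ≈F c → a ≈F c
    ≈F-trans {a} {b} {c} e f = ≈F-intro (atom a) (atom c)
      (trans-law {num a} {den a} {num b} {den b} {num c} {den c} (*P-cancel (den≢0 b))
        (≈F-elim (atom a) (atom b) e) (≈F-elim (atom b) (atom c) f))

    +F-cong : Congruent₂ _+F_
    +F-cong {a} {b} {c} {d} e f = ≈F-intro (atom a ⊹ atom c) (atom b ⊹ atom d)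
      (+-cong-law {num a} {den a} {num b} {den b} {num c} {den c} {num d} {den d}
        (≈F-elim (atom a) (atom b) e) (≈F-elim (atom c) (atom d) f))

    *F-cong : Congruent₂ _*F_
    *F-cong {a} {b} {c} {d} e f = ≈F-intro (atom a ⊛ atom c) (atom b ⊛ atom d)
      (*-cong-law {num a} {den a} {num b} {den b} {num c} {den c} {num d} {den d}
        (≈F-elim (atom a) (atom b) e) (≈F-elim (atom c) (atom d) f))

    negF-cong : ∀ {a b} → a ≈F b → negF a ≈F negF b
    negF-cong {a} {b} e = ≈F-intro (atom (negF a)) (atom (negF b))
      (neg-cong-law {num a} {den a} {num b} {den b} (≈F-elim (atom a) (atom b) e))

    +F-assoc : Associative _+F_
    +F-assoc a b c = ≈F-intro (atom a ⊹ atom b ⊹ atom c) (atom a ⊹ (atom b ⊹ atom c))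
      (solve 6 (λ a a′ b b′ c c′ → ((a :* b′ :+ b :* a′) :* c′ :+ c :* (a′ :* b′)) :* (a′ :* (b′ :* c′))
        := (a :* (b′ :* c′) :+ (b :* c′ :+ c :* b′) :* a′) :* ((a′ :* b′) :* c′)) ≋-refl (num a) (den a) (num b) (den b) (num c) (den c))

    +F-comm : Commutative _+F_
    +F-comm a b = ≈F-intro (atom a ⊹ atom b) (atom b ⊹ atom a)
      (solve 4 (λ a a′ b b′ → (a :* b′ :+ b :* a′) :* (b′ :* a′) := (b :* a′ :+ a :* b′) :* (a′ :* b′)) ≋-refl (num a) (den a) (num b) (den b))

    +F-identityˡ : LeftIdentity 0F _+F_
    +F-identityˡ a = ≈F-intro (atom 0F ⊹ atom a) (atom a)
      (solve 2 (λ a a′ → (:0 :* a′ :+ a :* :1) :* a′ := a :* (:1 :* a′)) ≋-refl (num a) (den a))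

    +F-inverseʳ : RightInverse 0F negF _+F_
    +F-inverseʳ a = ≈F-intro (atom a ⊹ atom (negF a)) (atom 0F)
      (solve 2 (λ a a′ → (a :* a′ :+ (:- a) :* a′) :* :1 := :0 :* (a′ :* a′)) ≋-refl (num a) (den a))

    *F-assoc : Associative _*F_
    *F-assoc a b c = ≈F-intro (atom a ⊛ atom b ⊛ atom c) (atom a ⊛ (atom b ⊛ atom c))
      (solve 6 (λ a a′ b b′ c c′ → ((a :* b) :* c) :* (a′ :* (b′ :* c′)) := (a :* (b :* c)) :* ((a′ :* b′) :* c′))
        ≋-refl (num a) (den a) (num b) (den b) (num c) (den c))

    *F-comm : Commutative _*F_
    *F-comm a b = ≈F-intro (atom a ⊛ atom b) (atom b ⊛ atom a)
      (solve 4 (λ a a′ b b′ → (a :* b) :* (b′ :* a′) := (b :* a) :* (a′ :* b′)) ≋-refl (num a) (den a) (num b) (den b))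

    *F-identityˡ : LeftIdentity 1F _*F_
    *F-identityˡ a = ≈F-intro (atom 1F ⊛ atom a) (atom a)
      (solve 2 (λ a a′ → (:1 :* a) :* a′ := a :* (:1 :* a′)) ≋-refl (num a) (den a))

    *F-distribʳ-+F : _*F_ DistributesOverʳ _+F_
    *F-distribʳ-+F a b c = ≈F-intro ((atom b ⊹ atom c) ⊛ atom a) (atom b ⊛ atom a ⊹ atom c ⊛ atom a)
      (solve 6 (λ a a′ b b′ c c′ → ((b :* c′ :+ c :* b′) :* a) :* ((b′ :* a′) :* (c′ :* a′))
        := ((b :* a) :* (c′ :* a′) :+ (c :* a) :* (b′ :* a′)) :* ((b′ :* c′) :* a′)) ≋-refl (num a) (den a) (num b) (den b) (num c) (den c))

  ≈F-setoid : Setoid 0ℓ 0ℓ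
  ≈F-setoid = record
    { Carrier = 𝔽
    ; _≈_ = _≈F_
    ; isEquivalence = record
      { refl = λ {a} → ≈F-refl {a}
      ; sym = λ {a} {b} → ≈F-sym {a} {b}
      ; trans = λ {a} {b} {c} → ≈F-trans {a} {b} {c} }
    }

  ℚ⟨r⟩ : CommutativeRing 0ℓ 0ℓ
  ℚ⟨r⟩ = record
    { Carrier = 𝔽 ; _≈_ = _≈F_ ; _+_ = _+F_ ; _*_ = _*F_ ; -_ = negF ; 0# = 0F ; 1# = 1F
    ; isCommutativeRing = record
      { isRing = record
        { +-isAbelianGroup = record
          { isGroup = record
            { isMonoid = record
              { isSemigroup = record
                { isMagma = record
                  { isEquivalence = Setoid.isEquivalence ≈F-setoid
                  ; ∙-cong = λ {a} {b} {c} {d} → +F-cong {a} {b} {c} {d} }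
                ; assoc = +F-assoc }
              ; identity = comm∧idˡ⇒id {_+F_} +F-comm {0F} +F-identityˡ }
            ; inverse = comm∧invʳ⇒inv {_+F_} {negF} {0F} +F-comm +F-inverseʳ
            ; ⁻¹-cong = λ {a} {b} → negF-cong {a} {b} }
          ; comm = +F-comm }
        ; *-cong = λ {a} {b} {c} {d} → *F-cong {a} {b} {c} {d}
        ; *-assoc = *F-assoc
        ; *-identity = comm∧idˡ⇒id {_*F_} *F-comm {1F} *F-identityˡ
        ; distrib = comm∧distrʳ⇒distr {_*F_} {_+F_} (λ {a} {b} {c} {d} → +F-cong {a} {b} {c} {d}) *F-comm *F-distribʳ-+F }
      ; *-comm = *F-comm }
    }
    where open import Algebra.Consequences.Setoid ≈F-setoid

  inverse : ∀ a → ¬ a ≈F 0F → ∃[ b ] a *F b ≈F 1F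
  inverse a a≉0 = b , ≈F-intro (atom a ⊛ atom b) (atom 1F)
      (solve 2 (λ a a′ → (a :* a′) :* :1 := :1 :* (a′ :* a)) ≋-refl (num a) (den a))
    where
    open IntegerSolver ℚ[r]
    b : 𝔽
    b = frac (den a) (num a) λ z → a≉0 (≈F-intro (atom a) (atom 0F)
          (≋-trans (*P-comm (num a) (1ℚ ∷ [])) (≋-trans (*P-identityˡ (num a)) (IsZeroP⇒≋ z))))

  ℕF-zero : ℕF 0 ≈F 0F
  ℕF-zero = ≈F-intro (atom (ℕF 0)) (atom 0F) (≋-intro λ { zero → ≡.refl ; (suc i) → ≡.refl })

  -- `ℚ./` reduces to lowest terms by a gcd that is stuck on variables; among unnormalised rationals
  -- the claim is an identity of integers.
  /1-homo-+ : ∀ m n → (ℤ.+ (m ℕ.+ n)) ℚ./ 1 ≡ (ℤ.+ m) ℚ./ 1 ℚ.+ (ℤ.+ n) ℚ./ 1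
  /1-homo-+ m n = ℚ.toℚᵘ-injective (begin
    ℚ.toℚᵘ ((ℤ.+ (m ℕ.+ n)) ℚ./ 1) ≈⟨ ℚ.toℚᵘ-fromℚᵘ (ℚᵘ.mkℚᵘ (ℤ.+ (m ℕ.+ n)) 0) ⟩
    ℚᵘ.mkℚᵘ (ℤ.+ (m ℕ.+ n)) 0 ≈⟨ ℚᵘ.*≡* (≡.cong (ℤ._* ℤ.+ 1) (≡.cong₂ ℤ._+_ (≡.sym (ℤ.*-identityʳ (ℤ.+ m))) (≡.sym (ℤ.*-identityʳ (ℤ.+ n))))) ⟩
    ℚᵘ.mkℚᵘ (ℤ.+ m) 0 ℚᵘ.+ ℚᵘ.mkℚᵘ (ℤ.+ n) 0 ≈⟨ ℚᵘ.+-cong (ℚ.toℚᵘ-fromℚᵘ (ℚᵘ.mkℚᵘ (ℤ.+ m) 0)) (ℚ.toℚᵘ-fromℚᵘ (ℚᵘ.mkℚᵘ (ℤ.+ n) 0)) ⟨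
    ℚ.toℚᵘ ((ℤ.+ m) ℚ./ 1) ℚᵘ.+ ℚ.toℚᵘ ((ℤ.+ n) ℚ./ 1) ≈⟨ ℚ.toℚᵘ-homo-+ ((ℤ.+ m) ℚ./ 1) ((ℤ.+ n) ℚ./ 1) ⟨
    ℚ.toℚᵘ ((ℤ.+ m) ℚ./ 1 ℚ.+ (ℤ.+ n) ℚ./ 1) ∎)
    where open ℚᵘ.≃-Reasoning

  /1-injective : ∀ {m n} → (ℤ.+ m) ℚ./ 1 ≡ (ℤ.+ n) ℚ./ 1 → m ≡ n
  /1-injective {m} {n} e = ℤ.+-injective (ℤ.*-cancelʳ-≡ _ _ (ℤ.+ 1) (ℚᵘ.drop-*≡* (begin
    ℚᵘ.mkℚᵘ (ℤ.+ m) 0 ≈⟨ ℚ.toℚᵘ-fromℚᵘ (ℚᵘ.mkℚᵘ (ℤ.+ m) 0) ⟨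
    ℚ.toℚᵘ ((ℤ.+ m) ℚ./ 1) ≡⟨ ≡.cong ℚ.toℚᵘ e ⟩
    ℚ.toℚᵘ ((ℤ.+ n) ℚ./ 1) ≈⟨ ℚ.toℚᵘ-fromℚᵘ (ℚᵘ.mkℚᵘ (ℤ.+ n) 0) ⟩
    ℚᵘ.mkℚᵘ (ℤ.+ n) 0 ∎)))
    where open ℚᵘ.≃-Reasoning

  ℕF-suc : ∀ n → ℕF (suc n) ≈F 1F +F ℕF n
  ℕF-suc n = ≈F-intro (atom (ℕF (suc n))) (atom 1F ⊹ atom (ℕF n))
    (≋-intro λ { zero → ≡.trans (≡.cong (λ x → x ℚ.* 1ℚ ℚ.+ 0ℚ) (/1-homo-+ 1 n)) (lemma ((ℤ.+ n) ℚ./ 1)) ; (suc i) → ≡.refl })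
    where
    lemma : ∀ x → (1ℚ ℚ.+ x) ℚ.* 1ℚ ℚ.+ 0ℚ ≡ (1ℚ ℚ.* 1ℚ ℚ.+ 0ℚ ℚ.+ (x ℚ.* 1ℚ ℚ.+ 0ℚ)) ℚ.* 1ℚ ℚ.+ 0ℚ
    lemma = ℚ-Solver.solve 1 (λ x → (:1 :+ x) :* :1 :+ :0 := (:1 :* :1 :+ :0 :+ (x :* :1 :+ :0)) :* :1 :+ :0) ≡.refl
      where open ℚ-Solver

  linear-num : ℕ → ℕ → QP
  linear-num a b = (ℤ.+ a) ℚ./ 1 ∷ (ℤ.+ b) ℚ./ 1 ∷ []

  ℕF+rℕF : ∀ a b → ℕF a +F rF *F ℕF b ≈F polyF (linear-num a b)
  ℕF+rℕF a b = ≈F-intro (atom (ℕF a) ⊹ atom rF ⊛ atom (ℕF b)) (atom (polyF (linear-num a b)))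
    (≋-trans (solve 3 (λ x r y → (x :* (:1 :* :1) :+ (r :* y) :* :1) :* :1 := (x :+ r :* y) :* (:1 :* (:1 :* :1))) ≋-refl x (0ℚ ∷ 1ℚ ∷ []) y) (*P-cong {x +P (0ℚ ∷ 1ℚ ∷ []) *P y} {linear-num a b} {(1ℚ ∷ []) *P ((1ℚ ∷ []) *P (1ℚ ∷ []))} {(1ℚ ∷ []) *P ((1ℚ ∷ []) *P (1ℚ ∷ []))}
      (≋-intro λ { zero → ≡.trans (≡.cong ((ℤ.+ a) ℚ./ 1 ℚ.+_) (≡.trans (ℚ.+-identityʳ _) (ℚ.*-zeroˡ ((ℤ.+ b) ℚ./ 1)))) (ℚ.+-identityʳ _)
                 ; (suc zero) → ≡.trans (ℚ.+-identityʳ _) (ℚ.*-identityˡ ((ℤ.+ b) ℚ./ 1))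
                 ; (suc (suc i)) → ≡.refl })
      (≋-refl)))
    where
    open IntegerSolver ℚ[r]
    x y : QP
    x = (ℤ.+ a) ℚ./ 1 ∷ []
    y = (ℤ.+ b) ℚ./ 1 ∷ []

  -- As `r` is an indeterminate, the expression is a linear polynomial in `r`, from which `a` and
  -- `b` are read off as coefficients. Hence a coordinate of an interpolation point determines the
  -- entry and its rank.
  ℕF+rℕF-injective : ∀ a b c d → ℕF a +F rF *F ℕF b ≈F ℕF c +F rF *F ℕF d → a ≡ c × b ≡ d
  ℕF+rℕF-injective a b c d e = /1-injective (at eq 0) , /1-injective (at eq 1)
    where
    p q : 𝔽
    p = polyF (linear-num a b)
    q = polyF (linear-num c d)
    p≈q : p ≈F q
    p≈q = ≈F-trans {p} {ℕF a +F rF *F ℕF b} {q} (≈F-sym {ℕF a +F rF *F ℕF b} {p} (ℕF+rℕF a b))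
      (≈F-trans {ℕF a +F rF *F ℕF b} {ℕF c +F rF *F ℕF d} {q} e (ℕF+rℕF c d))
    *P-identityʳ : ∀ p → p *P (1ℚ ∷ []) ≋ p
    *P-identityʳ = CommutativeRing.*-identityʳ ℚ[r]
    eq : linear-num a b ≋ linear-num c d
    eq = ≋-trans (≋-sym (*P-identityʳ _))
      (≋-trans (≈F-elim (atom p) (atom q) p≈q) (*P-identityʳ _))

  αF*rF : αF *F rF ≈F 1F
  αF*rF = ≈F-intro (atom αF ⊛ atom rF) (atom 1F) (≋-intro λ { 0 → ≡.refl ; 1 → ≡.refl ; 2 → ≡.refl ; (suc (suc (suc i))) → ≡.refl })

-- Sizes of compositions and adjacent swaps.

size-∷ʳ : ∀ {N} (β : Vec ℕ N) b → size (β ∷ʳ b) ≡ b ℕ.+ size β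
size-∷ʳ [] b = ≡.refl
size-∷ʳ (a ∷ β) b = ≡.trans (≡.cong (a ℕ.+_) (size-∷ʳ β b))
  (≡.trans (≡.sym (ℕ.+-assoc a b _)) (≡.trans (≡.cong (ℕ._+ size β) (ℕ.+-comm a b)) (ℕ.+-assoc b a _)))

swap : ∀ {A : Set} {n} → Fin n → Vec A (suc n) → Vec A (suc n)
swap zero (x ∷ y ∷ v) = y ∷ x ∷ v
swap (suc i) (x ∷ v) = x ∷ swap i v

τ : ∀ {n} → Fin n → Fin (suc n) → Fin (suc n)
τ zero zero = suc zero
τ zero (suc zero) = zero
τ zero (suc (suc j)) = suc (suc j)
τ (suc i) zero = zero
τ (suc i) (suc j) = suc (τ i j)

lookup-swap : ∀ {A : Set} {n} i (v : Vec A (suc n)) j → lookup (swap i v) j ≡ lookup v (τ i j)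
lookup-swap zero (x ∷ y ∷ v) zero = ≡.refl
lookup-swap zero (x ∷ y ∷ v) (suc zero) = ≡.refl
lookup-swap zero (x ∷ y ∷ v) (suc (suc j)) = ≡.refl
lookup-swap (suc i) (x ∷ v) zero = ≡.refl
lookup-swap (suc i) (x ∷ v) (suc j) = lookup-swap i v j

swap-involutive : ∀ {A : Set} {n} i (v : Vec A (suc n)) → swap i (swap i v) ≡ v
swap-involutive zero (x ∷ y ∷ v) = ≡.refl
swap-involutive (suc i) (x ∷ v) = ≡.cong (x ∷_) (swap-involutive i v)

size-swap : ∀ {n} i (β : Vec ℕ (suc n)) → size (swap i β) ≡ size β
size-swap zero (a ∷ b ∷ β) = ≡.trans (≡.sym (ℕ.+-assoc b a _)) (≡.trans (≡.cong (ℕ._+ size β) (ℕ.+-comm b a)) (ℕ.+-assoc a b _))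
size-swap (suc i) (a ∷ β) = ≡.cong (a ℕ.+_) (size-swap i β)

τ-inject₁ : ∀ {n} (i : Fin n) → τ i (inject₁ i) ≡ suc i
τ-inject₁ zero = ≡.refl
τ-inject₁ (suc i) = ≡.cong suc (τ-inject₁ i)

τ-suc : ∀ {n} (i : Fin n) → τ i (suc i) ≡ inject₁ i
τ-suc zero = ≡.refl
τ-suc (suc i) = ≡.cong suc (τ-suc i)

-- Polynomials as formal combinations of exponents, and operators on them.

module Polynomials (K : CommutativeRing 0ℓ 0ℓ) where

  open CommutativeRing K hiding (zero)
  open IntegerSolver K
  open import Algebra.Properties.Semiring.Exp semiring using (_^_; ^-congˡ)
  open import Relation.Binary.Reasoning.Setoid setoid

  x-y≈0⇒x≈y : ∀ {x y} → x - y ≈ 0# → x ≈ y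
  x-y≈0⇒x≈y {x} {y} e = begin
    x ≈⟨ solve 2 (λ x y → x := (x :- y) :+ y) refl x y ⟩
    x - y + y ≈⟨ +-congʳ e ⟩
    0# + y ≈⟨ +-identityˡ y ⟩
    y ∎

  Comb : Set → Set
  Comb I = List (I × Carrier)

  module _ {I : Set} where

    -- Coefficients, evaluations and the composites of these with an operator are all linear forms
    -- prescribed on monomials, so the lemmas about `lin` serve for each of them.
    lin : (I → Carrier) → Comb I → Carrier
    lin φ = foldr (λ t acc → proj₂ t * φ (proj₁ t) + acc) 0#

    scale : Carrier → Comb I → Comb I
    scale c = List.map (map₂ (c *_))

    lin-++ : ∀ φ p q → lin φ (p ++ q) ≈ lin φ p + lin φ q
    lin-++ φ [] q = sym (+-identityˡ _)
    lin-++ φ ((i , c) ∷ p) q = trans (+-congˡ (lin-++ φ p q)) (sym (+-assoc _ _ _))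

    lin-scale : ∀ φ c p → lin φ (scale c p) ≈ c * lin φ p
    lin-scale φ c [] = sym (zeroʳ c)
    lin-scale φ c ((i , d) ∷ p) = begin
      c * d * φ i + lin φ (scale c p) ≈⟨ +-cong (*-assoc c d (φ i)) (lin-scale φ c p) ⟩
      c * (d * φ i) + c * lin φ p ≈⟨ distribˡ _ _ _ ⟨
      c * (d * φ i + lin φ p) ∎

    lin-cong : ∀ {φ ψ} → (∀ i → φ i ≈ ψ i) → ∀ p → lin φ p ≈ lin ψ p
    lin-cong e [] = refl
    lin-cong e ((i , c) ∷ p) = +-cong (*-congˡ (e i)) (lin-cong e p)

    lin-0 : ∀ p → lin (λ _ → 0#) p ≈ 0#
    lin-0 [] = refl
    lin-0 ((i , c) ∷ p) = trans (+-cong (zeroʳ c) (lin-0 p)) (+-identityˡ 0#)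

    lin-+ : ∀ φ ψ p → lin (λ i → φ i + ψ i) p ≈ lin φ p + lin ψ p
    lin-+ φ ψ [] = sym (+-identityˡ 0#)
    lin-+ φ ψ ((i , c) ∷ p) = trans (+-congˡ (lin-+ φ ψ p))
      (solve 5 (λ c a b x y → c :* (a :+ b) :+ (x :+ y) := (c :* a :+ x) :+ (c :* b :+ y)) refl c (φ i) (ψ i) (lin φ p) (lin ψ p))

    lin-* : ∀ a φ p → lin (λ i → a * φ i) p ≈ a * lin φ p
    lin-* a φ [] = sym (zeroʳ a)
    lin-* a φ ((i , c) ∷ p) = trans (+-congˡ (lin-* a φ p))
      (solve 4 (λ a c x y → c :* (a :* x) :+ a :* y := a :* (c :* x :+ y)) refl a c (φ i) (lin φ p))

    lin-minus : ∀ φ ψ p → lin (λ i → φ i - ψ i) p ≈ lin φ p - lin ψ p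
    lin-minus φ ψ p = begin
      lin (λ i → φ i - ψ i) p ≈⟨ lin-+ φ _ p ⟩
      lin φ p + lin (λ i → - ψ i) p ≈⟨ +-congˡ (lin-cong (λ i → solve 1 (λ x → :- x := (:- :1) :* x) refl (ψ i)) p) ⟩
      lin φ p + lin (λ i → - 1# * ψ i) p ≈⟨ +-congˡ (lin-* (- 1#) ψ p) ⟩
      lin φ p + - 1# * lin ψ p ≈⟨ solve 2 (λ x y → x :+ (:- :1) :* y := x :- y) refl (lin φ p) (lin ψ p) ⟩
      lin φ p - lin ψ p ∎

    infixl 6 _⊖_
    _⊖_ : Comb I → Comb I → Comb I
    p ⊖ q = p ++ scale (- 1#) q

    lin-⊖ : ∀ φ p q → lin φ (p ⊖ q) ≈ lin φ p - lin φ q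
    lin-⊖ φ p q = begin
      lin φ (p ⊖ q) ≈⟨ lin-++ φ p _ ⟩
      lin φ p + lin φ (scale (- 1#) q) ≈⟨ +-congˡ (lin-scale φ (- 1#) q) ⟩
      lin φ p + - 1# * lin φ q ≈⟨ solve 2 (λ x y → x :+ (:- :1) :* y := x :- y) refl (lin φ p) (lin φ q) ⟩
      lin φ p - lin φ q ∎

    single : I → Comb I
    single i = (i , 1#) ∷ []

    lin-single : ∀ φ i → lin φ (single i) ≈ φ i
    lin-single φ i = trans (+-identityʳ _) (*-identityˡ _)

  relabel : ∀ {I J : Set} → (I → J) → Comb I → Comb J
  relabel f = List.map (map₁ f)

  lin-relabel : ∀ {I J : Set} φ (f : I → J) p → lin φ (relabel f p) ≡ lin (φ ∘ f) p
  lin-relabel φ f [] = ≡.refl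
  lin-relabel φ f ((i , c) ∷ p) = ≡.cong (c * φ (f i) +_) (lin-relabel φ f p)

  extend : ∀ {I J : Set} → (I → Comb J) → Comb I → Comb J
  extend A = concatMap (λ t → scale (proj₂ t) (A (proj₁ t)))

  lin-extend : ∀ {I J : Set} φ (A : I → Comb J) p → lin φ (extend A p) ≈ lin (λ i → lin φ (A i)) p
  lin-extend φ A [] = refl
  lin-extend φ A ((i , c) ∷ p) = trans (lin-++ φ (scale c (A i)) (extend A p)) (+-cong (lin-scale φ c (A i)) (lin-extend φ A p))

  MPoly : ℕ → Set
  MPoly N = Comb (Vec ℕ N)

  module _ {N : ℕ} where

    _≟_ = Vec.≡-dec {n = N} ℕ._≟_

    δ : Vec ℕ N → Vec ℕ N → Carrier
    δ β γ = if does (β ≟ γ) then 1# else 0#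

    δ-refl : ∀ β → δ β β ≈ 1#
    δ-refl β with β ≟ β
    ... | yes _ = refl
    ... | no β≢β = contradiction ≡.refl β≢β

    δ-≢ : ∀ β γ → β ≢ γ → δ β γ ≈ 0#
    δ-≢ β γ β≢γ with β ≟ γ
    ... | yes e = contradiction e β≢γ
    ... | no _ = refl

    coeff : Vec ℕ N → MPoly N → Carrier
    coeff β = lin (δ β)

    Null : MPoly N → Set
    Null p = ∀ β → coeff β p ≈ 0#

    DegBelow : ℕ → MPoly N → Set
    DegBelow d p = ∀ β → d ≤ size β → coeff β p ≈ 0#

    private
      drop : Vec ℕ N → MPoly N → MPoly N
      drop β [] = []
      drop β ((γ , c) ∷ p) with β ≟ γ
      ... | yes _ = drop β p
      ... | no _ = (γ , c) ∷ drop β p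

      length-drop : ∀ β p → List.length (drop β p) ≤ List.length p
      length-drop β [] = z≤n
      length-drop β ((γ , c) ∷ p) with β ≟ γ
      ... | yes _ = ℕ.m≤n⇒m≤1+n (length-drop β p)
      ... | no _ = s≤s (length-drop β p)

      lin-drop : ∀ φ β p → lin φ p ≈ coeff β p * φ β + lin φ (drop β p)
      lin-drop φ β [] = solve 1 (λ x → :0 := :0 :* x :+ :0) refl (φ β)
      lin-drop φ β ((γ , c) ∷ p) with β ≟ γ
      ... | yes ≡.refl = trans (+-congˡ (lin-drop φ β p))
        (solve 4 (λ c x y z → c :* x :+ (y :* x :+ z) := (c :* :1 :+ y) :* x :+ z) refl c (φ β) (coeff β p) (lin φ (drop β p)))
      ... | no _ = trans (+-congˡ (lin-drop φ β p))
        (solve 5 (λ c x w y z → c :* w :+ (y :* x :+ z) := (c :* :0 :+ y) :* x :+ (c :* w :+ z)) refl c (φ β) (φ γ) (coeff β p) (lin φ (drop β p)))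

    -- A list may repeat an exponent, and its terms may cancel, so induction term by term is
    -- impossible. All terms sharing the first exponent `γ` are removed together; they contribute
    -- the coefficient of `γ` times `φ γ`.
    lin-support : ∀ φ p → (∀ β → coeff β p * φ β ≈ 0#) → lin φ p ≈ 0#
    lin-support φ p = go (List.length p) p ℕ.≤-refl
      where
      go : ∀ m p → List.length p ≤ m → (∀ β → coeff β p * φ β ≈ 0#) → lin φ p ≈ 0#
      go m [] _ _ = refl
      go (suc m) p′@((γ , c) ∷ p) (s≤s le) e = begin
        lin φ p′ ≈⟨ lin-drop φ γ p′ ⟩
        coeff γ p′ * φ γ + lin φ (drop γ p′) ≈⟨ +-cong (e γ) (go m (drop γ p′) shorter e′) ⟩
        0# + 0# ≈⟨ +-identityˡ 0# ⟩
        0# ∎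
        where
        shorter : List.length (drop γ p′) ≤ m
        shorter with γ ≟ γ
        ... | yes _ = ℕ.≤-trans (length-drop γ p) le
        ... | no γ≢γ = contradiction ≡.refl γ≢γ
        coeff-drop : ∀ β → β ≢ γ → coeff β (drop γ p′) ≈ coeff β p′
        coeff-drop β β≢γ = sym (begin
          coeff β p′ ≈⟨ lin-drop (δ β) γ p′ ⟩
          coeff γ p′ * δ β γ + coeff β (drop γ p′) ≈⟨ +-congʳ (*-congˡ (δ-≢ β γ β≢γ)) ⟩
          coeff γ p′ * 0# + coeff β (drop γ p′) ≈⟨ solve 2 (λ x y → x :* :0 :+ y := y) refl _ _ ⟩
          coeff β (drop γ p′) ∎)
        coeff-drop-self : ∀ q → coeff γ (drop γ q) ≈ 0#
        coeff-drop-self [] = refl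
        coeff-drop-self ((β , d) ∷ q) with γ ≟ β
        ... | yes _ = coeff-drop-self q
        ... | no γ≢β = trans (+-cong (trans (*-congˡ (δ-≢ γ β γ≢β)) (zeroʳ d)) (coeff-drop-self q)) (+-identityˡ 0#)
        e′ : ∀ β → coeff β (drop γ p′) * φ β ≈ 0#
        e′ β with β ≟ γ
        ... | yes ≡.refl = trans (*-congʳ (coeff-drop-self p′)) (zeroˡ _)
        ... | no β≢γ = trans (*-congʳ (coeff-drop β β≢γ)) (e β)

    lin-null : ∀ φ p → Null p → lin φ p ≈ 0#
    lin-null φ p z = lin-support φ p (λ β → trans (*-congʳ (z β)) (zeroˡ _))

    lin-cong-≈ : ∀ φ p q → (∀ β → coeff β p ≈ coeff β q) → lin φ p ≈ lin φ q
    lin-cong-≈ φ p q e = x-y≈0⇒x≈y (trans (sym (lin-⊖ φ p q)) (lin-null φ (p ⊖ q) λ β →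
      trans (lin-⊖ (δ β) p q) (trans (+-congʳ (e β)) (-‿inverseʳ _))))

    lin-cong-deg : ∀ {d} φ ψ p → DegBelow d p → (∀ β → size β < d → φ β ≈ ψ β) → lin φ p ≈ lin ψ p
    lin-cong-deg {d} φ ψ p deg e = x-y≈0⇒x≈y (trans (sym (lin-minus φ ψ p)) (lin-support _ p λ β → case β))
      where
      case : ∀ β → coeff β p * (φ β - ψ β) ≈ 0#
      case β with d ℕ.≤? size β
      ... | yes le = trans (*-congʳ (deg β le)) (zeroˡ _)
      ... | no ≰ = trans (*-congˡ (trans (+-congʳ (e β (ℕ.≰⇒> ≰))) (-‿inverseʳ _))) (zeroʳ _)

    monomial-coeff : ∀ β γ → coeff β (single γ) ≈ δ β γ
    monomial-coeff β γ = lin-single (δ β) γ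

    DegBelow-⊖ : ∀ {d} p q → DegBelow d p → DegBelow d q → DegBelow d (p ⊖ q)
    DegBelow-⊖ p q dp dq β le = trans (lin-⊖ (δ β) p q) (trans (+-cong (dp β le) (-‿cong (dq β le))) (-‿inverseʳ 0#))

    Leading : Vec ℕ N → MPoly N → Set
    Leading ζ p = ∀ β → size ζ ≤ size β → coeff β p ≈ δ β ζ

    Leading⇒DegBelow : ∀ {ζ p} → Leading ζ p → DegBelow (size ζ) (p ⊖ single ζ)
    Leading⇒DegBelow {ζ} {p} l β le = begin
      coeff β (p ⊖ single ζ) ≈⟨ lin-⊖ (δ β) p (single ζ) ⟩
      coeff β p - coeff β (single ζ) ≈⟨ +-cong (l β le) (-‿cong (monomial-coeff β ζ)) ⟩
      δ β ζ - δ β ζ ≈⟨ -‿inverseʳ _ ⟩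
      0# ∎

    Leading⇒DegBelow-suc : ∀ {ζ p} → Leading ζ p → DegBelow (suc (size ζ)) p
    Leading⇒DegBelow-suc {ζ} l β lt = trans (l β (ℕ.<⇒≤ lt)) (δ-≢ β ζ λ { ≡.refl → ℕ.<-irrefl ≡.refl lt })

  -- Expresses that `A β` is the monomial `π β` plus terms of smaller size. Testing against forms
  -- that vanish on smaller sizes lets the property pass through `relabel` and `extend` without
  -- computing coefficients.
  HasLead : ∀ {M N} → (Vec ℕ M → Vec ℕ N) → (Vec ℕ M → MPoly N) → Set
  HasLead π A = ∀ β φ → (∀ γ → size γ < size (π β) → φ γ ≈ 0#) → lin φ (A β) ≈ φ (π β)

  module _ {M N : ℕ} (π : Vec ℕ M → Vec ℕ N) (A : Vec ℕ M → MPoly N) (lead : HasLead π A)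
           (e : ℕ) (size-π : ∀ β → size (π β) ≡ e ℕ.+ size β) where

    coeff-lead : ∀ β γ → e ℕ.+ size β ≤ size γ → coeff γ (A β) ≈ δ γ (π β)
    coeff-lead β γ le = lead β (δ γ) λ γ′ lt → δ-≢ γ γ′ λ { ≡.refl →
      ℕ.<⇒≱ lt (ℕ.≤-trans (ℕ.≤-reflexive (size-π β)) le) }

    -- `π` raises all sizes by the same `e`, so the terms of `q` below `ζ` are sent below `π ζ` and
    -- leave the leading term alone.
    extend-leading : ∀ {ζ q} → Leading ζ q → Leading (π ζ) (extend A q)
    extend-leading {ζ} {q} l γ le = begin
      coeff γ (extend A q) ≈⟨ lin-extend (δ γ) A q ⟩
      lin φ q ≈⟨ solve 2 (λ x y → x := y :+ (x :- y)) refl (lin φ q) (φ ζ) ⟩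
      φ ζ + (lin φ q - φ ζ) ≈⟨ +-congˡ (+-congˡ (-‿cong (sym (lin-single φ ζ)))) ⟩
      φ ζ + (lin φ q - lin φ (single ζ)) ≈⟨ +-congˡ (sym (lin-⊖ φ q (single ζ))) ⟩
      φ ζ + lin φ (q ⊖ single ζ) ≈⟨ +-cong (coeff-lead ζ γ e+ζ≤γ) (trans (lin-cong-deg φ (λ _ → 0#) (q ⊖ single ζ) (Leading⇒DegBelow {p = q} l) small) (lin-0 (q ⊖ single ζ))) ⟩
      δ γ (π ζ) + 0# ≈⟨ +-identityʳ _ ⟩
      δ γ (π ζ) ∎
      where
      φ : Vec ℕ M → Carrier
      φ β = coeff γ (A β)
      e+ζ≤γ : e ℕ.+ size ζ ≤ size γ
      e+ζ≤γ = ℕ.≤-trans (ℕ.≤-reflexive (≡.sym (size-π ζ))) le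
      small : ∀ β → size β < size ζ → φ β ≈ 0#
      small β lt = trans (coeff-lead β γ (ℕ.<⇒≤ lt′)) (δ-≢ γ (π β) λ { ≡.refl → ℕ.<-irrefl ≡.refl (ℕ.≤-<-trans (ℕ.≤-reflexive (size-π β)) lt′) })
        where
        lt′ : e ℕ.+ size β < size γ
        lt′ = ℕ.<-≤-trans (ℕ.+-monoʳ-< e lt) e+ζ≤γ

    -- On the highest degree the operator merely relabels exponents by the injective `π`, so the
    -- coefficients of `f` in that degree vanish; the bound `d` then drops by one.
    extend-injective : (∀ {β β′} → π β ≡ π β′ → β ≡ β′) →
                       ∀ d f → DegBelow d f → Null (extend A f) → Null f
    extend-injective π-inj zero f deg z β = deg β z≤n
    extend-injective π-inj (suc d) f deg z = extend-injective π-inj d f deg′ z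
      where
      δ-π : ∀ β β′ → δ (π β) (π β′) ≈ δ β β′
      δ-π β β′ with β ≟ β′
      ... | yes ≡.refl = δ-refl (π β)
      ... | no β≢β′ = δ-≢ (π β) (π β′) (β≢β′ ∘ π-inj)
      deg′ : DegBelow d f
      deg′ β d≤β with ℕ.m≤n⇒m<n∨m≡n d≤β
      ... | inj₁ d<β = deg β d<β
      ... | inj₂ ≡.refl = begin
        coeff β f ≈⟨ lin-cong-deg (δ β) (λ β′ → coeff (π β) (A β′)) f deg (λ β′ lt → sym (trans
                                                     (coeff-lead β′ (π β) (ℕ.≤-trans (ℕ.+-monoʳ-≤ e (ℕ.≤-pred lt)) (ℕ.≤-reflexive (≡.sym (size-π β)))))
                                                     (δ-π β β′))) ⟩
        lin (λ β′ → coeff (π β) (A β′)) f ≈⟨ lin-extend (δ (π β)) A f ⟨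
        coeff (π β) (extend A f) ≈⟨ z (π β) ⟩
        0# ∎

  Point : ℕ → Set
  Point N = Fin N → Carrier

  power : ∀ {N} → Point N → Vec ℕ N → Carrier
  power v [] = 1#
  power v (b ∷ β) = v zero ^ b * power (v ∘ suc) β

  eval : ∀ {N} → MPoly N → Point N → Carrier
  eval p v = lin (power v) p

  power-cong : ∀ {N} {v w : Point N} → (∀ i → v i ≈ w i) → ∀ β → power v β ≈ power w β
  power-cong e [] = refl
  power-cong e (b ∷ β) = *-cong (^-congˡ b (e zero)) (power-cong (e ∘ suc) β)

  eval-cong : ∀ {N} p {v w : Point N} → (∀ i → v i ≈ w i) → eval p v ≈ eval p w
  eval-cong p e = lin-cong (power-cong e) p

  power-∷ʳ : ∀ {N} (v : Point (suc N)) β b → power v (β ∷ʳ b) ≈ power (v ∘ inject₁) β * v (fromℕ N) ^ b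
  power-∷ʳ v [] b = trans (*-identityʳ _) (sym (*-identityˡ _))
  power-∷ʳ v (a ∷ β) b = trans (*-congˡ (power-∷ʳ (v ∘ suc) β b)) (sym (*-assoc _ _ _))

  power-swap : ∀ {n} (i : Fin n) (v : Point (suc n)) β → power (v ∘ τ i) β ≈ power v (swap i β)
  power-swap zero v (a ∷ b ∷ β) = solve 3 (λ x y z → x :* (y :* z) := y :* (x :* z)) refl _ _ _
  power-swap (suc i) v (a ∷ β) = *-congˡ (power-swap i (v ∘ suc) β)

  -- The expansion of (x + c)^b, one factor at a time; no binomial coefficients are needed.
  binomial : Carrier → ℕ → Comb ℕ
  binomial c zero = single 0
  binomial c (suc b) = relabel suc (binomial c b) ++ scale c (binomial c b)

  binomial-eval : ∀ c b x → lin (x ^_) (binomial c b) ≈ (x + c) ^ b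
  binomial-eval c zero x = lin-single (x ^_) 0
  binomial-eval c (suc b) x = begin
    lin (x ^_) (binomial c (suc b)) ≈⟨ lin-++ (x ^_) (relabel suc (binomial c b)) _ ⟩
    lin (x ^_) (relabel suc (binomial c b)) + lin (x ^_) (scale c (binomial c b))
      ≈⟨ +-cong (trans (reflexive (lin-relabel (x ^_) suc (binomial c b))) (lin-* x (x ^_) (binomial c b))) (lin-scale (x ^_) c (binomial c b)) ⟩
    x * lin (x ^_) (binomial c b) + c * lin (x ^_) (binomial c b) ≈⟨ distribʳ _ _ _ ⟨
    (x + c) * lin (x ^_) (binomial c b) ≈⟨ *-congˡ (binomial-eval c b x) ⟩
    (x + c) * (x + c) ^ b ∎

  binomial-lead : ∀ c b φ → (∀ a → a < b → φ a ≈ 0#) → lin φ (binomial c b) ≈ φ b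
  binomial-lead c zero φ z = lin-single φ 0
  binomial-lead c (suc b) φ z = begin
    lin φ (binomial c (suc b)) ≈⟨ lin-++ φ (relabel suc (binomial c b)) _ ⟩
    lin φ (relabel suc (binomial c b)) + lin φ (scale c (binomial c b))
      ≈⟨ +-cong (trans (reflexive (lin-relabel φ suc (binomial c b))) (binomial-lead c b (φ ∘ suc) (λ a lt → z (suc a) (s≤s lt))))
                (trans (lin-scale φ c (binomial c b)) (*-congˡ (binomial-lead c b φ (λ a lt → z a (ℕ.m≤n⇒m≤1+n lt))))) ⟩
    φ (suc b) + c * φ b ≈⟨ +-congˡ (trans (*-congˡ (z b ℕ.≤-refl)) (zeroʳ c)) ⟩
    φ (suc b) + 0# ≈⟨ +-identityʳ _ ⟩
    φ (suc b) ∎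

  translate : ∀ {N} → Carrier → Vec ℕ N → MPoly N
  translate c [] = single []
  translate c (b ∷ β) = extend (λ a → relabel (a ∷_) (translate c β)) (binomial c b)

  lin-translate-∷ : ∀ {N} c b (β : Vec ℕ N) φ →
    lin φ (translate c (b ∷ β)) ≈ lin (λ a → lin (φ ∘ (a ∷_)) (translate c β)) (binomial c b)
  lin-translate-∷ c b β φ = trans (lin-extend φ _ (binomial c b))
    (lin-cong (λ a → reflexive (lin-relabel φ (a ∷_) (translate c β))) (binomial c b))

  translate-lead : ∀ {N} c → HasLead {N} id (translate c)
  translate-lead c [] φ z = lin-single φ []
  translate-lead c (b ∷ β) φ z = begin
    lin φ (translate c (b ∷ β)) ≈⟨ lin-translate-∷ c b β φ ⟩
    lin (λ a → lin (φ ∘ (a ∷_)) (translate c β)) (binomial c b) ≈⟨ binomial-lead c b _ (λ a lt →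
        trans (translate-lead c β (φ ∘ (a ∷_)) (λ γ lt′ → z (a ∷ γ) (ℕ.+-mono-< lt lt′)))
              (z (a ∷ β) (ℕ.+-monoˡ-< (size β) lt))) ⟩
    lin (φ ∘ (b ∷_)) (translate c β) ≈⟨ translate-lead c β (φ ∘ (b ∷_)) (λ γ lt → z (b ∷ γ) (ℕ.+-monoʳ-< b lt)) ⟩
    φ (b ∷ β) ∎

  power-translate : ∀ {N} c β (v : Point N) → lin (power v) (translate c β) ≈ power (λ i → v i + c) β
  power-translate c [] v = lin-single (power v) []
  power-translate c (b ∷ β) v = begin
    lin (power v) (translate c (b ∷ β)) ≈⟨ lin-translate-∷ c b β (power v) ⟩
    lin (λ a → lin (λ γ → v zero ^ a * power (v ∘ suc) γ) (translate c β)) (binomial c b)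
      ≈⟨ lin-cong (λ a → trans (lin-* (v zero ^ a) (power (v ∘ suc)) (translate c β)) (*-comm _ _)) (binomial c b) ⟩
    lin (λ a → lin (power (v ∘ suc)) (translate c β) * v zero ^ a) (binomial c b)
      ≈⟨ lin-* _ (v zero ^_) (binomial c b) ⟩
    lin (power (v ∘ suc)) (translate c β) * lin (v zero ^_) (binomial c b)
      ≈⟨ *-comm _ _ ⟩
    lin (v zero ^_) (binomial c b) * lin (power (v ∘ suc)) (translate c β)
      ≈⟨ *-cong (binomial-eval c b (v zero)) (power-translate c β (v ∘ suc)) ⟩
    (v zero + c) ^ b * power (λ i → v (suc i) + c) β ∎

  eval-translate : ∀ {N} c p (v : Point N) → eval (extend (translate c) p) v ≈ eval p (λ i → v i + c)
  eval-translate c p v = trans (lin-extend (power v) (translate c) p) (lin-cong (λ β → power-translate c β v) p)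

  -- the terms of (xᵃ yᵇ − xᵇ yᵃ) / (x − y)
  divided : ℕ → ℕ → Comb (ℕ × ℕ)
  divided zero zero = []
  divided (suc a) zero = ((0 , a) , 1#) ∷ relabel (map₁ suc) (divided a zero)
  divided zero (suc b) = ((b , 0) , - 1#) ∷ relabel (map₂ suc) (divided zero b)
  divided (suc a) (suc b) = relabel (λ (p , q) → suc p , suc q) (divided a b)

  divided-eval : ∀ a b x y → (x - y) * lin (λ (p , q) → x ^ p * y ^ q) (divided a b) ≈ x ^ a * y ^ b - x ^ b * y ^ a
  divided-eval zero zero x y = solve 2 (λ x y → (x :- y) :* :0 := :1 :* :1 :- :1 :* :1) refl x y
  divided-eval (suc a) zero x y = begin
    (x - y) * (1# * (1# * y ^ a) + lin g (relabel (map₁ suc) (divided a zero)))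
      ≈⟨ *-congˡ (+-congˡ (trans (reflexive (lin-relabel g (map₁ suc) (divided a zero)))
           (trans (lin-cong (λ _ → *-assoc _ _ _) (divided a zero)) (lin-* x g (divided a zero))))) ⟩
    (x - y) * (1# * (1# * y ^ a) + x * lin g (divided a zero))
      ≈⟨ solve 4 (λ x y A B → (x :- y) :* (:1 :* (:1 :* A) :+ x :* B) := (x :- y) :* A :+ x :* ((x :- y) :* B)) refl x y (y ^ a) (lin g (divided a zero)) ⟩
    (x - y) * y ^ a + x * ((x - y) * lin g (divided a zero))
      ≈⟨ +-congˡ (*-congˡ (divided-eval a zero x y)) ⟩
    (x - y) * y ^ a + x * (x ^ a * 1# - 1# * y ^ a)
      ≈⟨ solve 4 (λ x y A B → (x :- y) :* A :+ x :* (B :* :1 :- :1 :* A) := (x :* B) :* :1 :- :1 :* (y :* A)) refl x y (y ^ a) (x ^ a) ⟩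
    (x * x ^ a) * 1# - 1# * (y * y ^ a) ∎
    where
    g : ℕ × ℕ → Carrier
    g (p , q) = x ^ p * y ^ q
  divided-eval zero (suc b) x y = begin
    (x - y) * (- 1# * (x ^ b * 1#) + lin g (relabel (map₂ suc) (divided zero b)))
      ≈⟨ *-congˡ (+-congˡ (trans (reflexive (lin-relabel g (map₂ suc) (divided zero b)))
           (trans (lin-cong (λ (p , q) → solve 3 (λ y A B → A :* (y :* B) := y :* (A :* B)) refl y (x ^ p) (y ^ q)) (divided zero b)) (lin-* y g (divided zero b))))) ⟩
    (x - y) * (- 1# * (x ^ b * 1#) + y * lin g (divided zero b))
      ≈⟨ solve 4 (λ x y A B → (x :- y) :* ((:- :1) :* (A :* :1) :+ y :* B) := y :* ((x :- y) :* B) :- (x :- y) :* A) refl x y (x ^ b) (lin g (divided zero b)) ⟩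
    y * ((x - y) * lin g (divided zero b)) - (x - y) * x ^ b
      ≈⟨ +-congʳ (*-congˡ (divided-eval zero b x y)) ⟩
    y * (1# * y ^ b - x ^ b * 1#) - (x - y) * x ^ b
      ≈⟨ solve 4 (λ x y A B → y :* (:1 :* A :- B :* :1) :- (x :- y) :* B := :1 :* (y :* A) :- (x :* B) :* :1) refl x y (y ^ b) (x ^ b) ⟩
    1# * (y * y ^ b) - (x * x ^ b) * 1# ∎
    where
    g : ℕ × ℕ → Carrier
    g (p , q) = x ^ p * y ^ q
  divided-eval (suc a) (suc b) x y = begin
    (x - y) * lin g (relabel _ (divided a b))
      ≈⟨ *-congˡ (trans (reflexive (lin-relabel g _ (divided a b)))
           (trans (lin-cong (λ (p , q) → solve 4 (λ x y A B → (x :* A) :* (y :* B) := (x :* y) :* (A :* B)) refl x y (x ^ p) (y ^ q)) (divided a b)) (lin-* (x * y) g (divided a b)))) ⟩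
    (x - y) * ((x * y) * lin g (divided a b))
      ≈⟨ solve 3 (λ x y A → (x :- y) :* ((x :* y) :* A) := (x :* y) :* ((x :- y) :* A)) refl x y (lin g (divided a b)) ⟩
    (x * y) * ((x - y) * lin g (divided a b))
      ≈⟨ *-congˡ (divided-eval a b x y) ⟩
    (x * y) * (x ^ a * y ^ b - x ^ b * y ^ a)
      ≈⟨ solve 6 (λ x y A B C D → (x :* y) :* (A :* B :- C :* D) := (x :* A) :* (y :* B) :- (x :* C) :* (y :* D)) refl x y (x ^ a) (y ^ b) (x ^ b) (y ^ a) ⟩
    (x * x ^ a) * (y * y ^ b) - (x * x ^ b) * (y * y ^ a) ∎
    where
    g : ℕ × ℕ → Carrier
    g (p , q) = x ^ p * y ^ q

  -- Every term of the quotient has degree a + b - 1.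
  divided-vanish : ∀ a b φ → (∀ p q → suc (p ℕ.+ q) ≡ a ℕ.+ b → φ (p , q) ≈ 0#) → lin φ (divided a b) ≈ 0#
  divided-vanish zero zero φ z = refl
  divided-vanish (suc a) zero φ z = trans (+-cong (trans (*-congˡ (z 0 a (≡.sym (≡.cong suc (ℕ.+-identityʳ a))))) (zeroʳ _))
    (trans (reflexive (lin-relabel φ (map₁ suc) (divided a zero))) (divided-vanish a zero _ λ p q e → z (suc p) q (≡.cong suc e)))) (+-identityˡ 0#)
  divided-vanish zero (suc b) φ z = trans (+-cong (trans (*-congˡ (z b 0 (≡.cong suc (ℕ.+-identityʳ b)))) (zeroʳ _))
    (trans (reflexive (lin-relabel φ (map₂ suc) (divided zero b))) (divided-vanish zero b _ λ p q e → z p (suc q) (≡.cong suc (≡.trans (ℕ.+-suc p q) e))))) (+-identityˡ 0#)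
  divided-vanish (suc a) (suc b) φ z = trans (reflexive (lin-relabel φ _ (divided a b)))
    (divided-vanish a b _ λ p q e → z (suc p) (suc q) (≡.cong suc (≡.trans (≡.cong suc (ℕ.+-suc p q)) (≡.trans (≡.cong suc e) (≡.sym (ℕ.+-suc a b))))))

  -- The divided difference (f - s_i f) / (x_i - x_{i+1}), with the quotient listed outright;
  -- `power-∂` justifies it by multiplying back.
  ∂ : ∀ {n} → Fin n → Vec ℕ (suc n) → MPoly (suc n)
  ∂ zero (a ∷ b ∷ β) = relabel (λ (p , q) → p ∷ q ∷ β) (divided a b)
  ∂ (suc i) (a ∷ β) = relabel (a ∷_) (∂ i β)

  power-∂ : ∀ {n} (i : Fin n) β v →
    (v (inject₁ i) - v (suc i)) * lin (power v) (∂ i β) ≈ power v β - power v (swap i β)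
  power-∂ zero (a ∷ b ∷ β) v = begin
    (x - y) * lin (power v) (∂ zero (a ∷ b ∷ β))
      ≈⟨ *-congˡ (trans (reflexive (lin-relabel (power v) _ (divided a b)))
           (trans (lin-cong (λ (p , q) → solve 3 (λ A B C → A :* (B :* C) := C :* (A :* B)) refl (x ^ p) (y ^ q) z) (divided a b))
                  (lin-* z (λ (p , q) → x ^ p * y ^ q) (divided a b)))) ⟩
    (x - y) * (z * lin (λ (p , q) → x ^ p * y ^ q) (divided a b))
      ≈⟨ solve 3 (λ d z A → d :* (z :* A) := z :* (d :* A)) refl (x - y) z _ ⟩
    z * ((x - y) * lin (λ (p , q) → x ^ p * y ^ q) (divided a b))
      ≈⟨ *-congˡ (divided-eval a b x y) ⟩
    z * (x ^ a * y ^ b - x ^ b * y ^ a)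
      ≈⟨ solve 5 (λ z A B C D → z :* (A :* B :- C :* D) := A :* (B :* z) :- C :* (D :* z)) refl z (x ^ a) (y ^ b) (x ^ b) (y ^ a) ⟩
    power v (a ∷ b ∷ β) - power v (b ∷ a ∷ β) ∎
    where
    x y z : Carrier
    x = v zero
    y = v (suc zero)
    z = power (λ i → v (suc (suc i))) β
  power-∂ (suc i) (a ∷ β) v = begin
    d * lin (power v) (relabel (a ∷_) (∂ i β))
      ≈⟨ *-congˡ (trans (reflexive (lin-relabel (power v) (a ∷_) (∂ i β))) (lin-* (v zero ^ a) (power (v ∘ suc)) (∂ i β))) ⟩
    d * (v zero ^ a * lin (power (v ∘ suc)) (∂ i β))
      ≈⟨ solve 3 (λ d z A → d :* (z :* A) := z :* (d :* A)) refl d (v zero ^ a) _ ⟩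
    v zero ^ a * (d * lin (power (v ∘ suc)) (∂ i β))
      ≈⟨ *-congˡ (power-∂ i β (v ∘ suc)) ⟩
    v zero ^ a * (power (v ∘ suc) β - power (v ∘ suc) (swap i β))
      ≈⟨ solve 3 (λ z A B → z :* (A :- B) := z :* A :- z :* B) refl (v zero ^ a) _ _ ⟩
    power v (a ∷ β) - power v (a ∷ swap i β) ∎
    where
    d : Carrier
    d = v (inject₁ (suc i)) - v (suc (suc i))

  ∂-vanish : ∀ {n} (i : Fin n) β φ → (∀ γ → size γ < size β → φ γ ≈ 0#) → lin φ (∂ i β) ≈ 0#
  ∂-vanish zero (a ∷ b ∷ β) φ z = trans (reflexive (lin-relabel φ _ (divided a b)))
    (divided-vanish a b _ λ p q e → z (p ∷ q ∷ β) (ℕ.≤-reflexive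
      (≡.trans (≡.cong suc (≡.sym (ℕ.+-assoc p q _))) (≡.trans (≡.cong (ℕ._+ size β) e) (ℕ.+-assoc a b _)))))
  ∂-vanish (suc i) (a ∷ β) φ z = trans (reflexive (lin-relabel φ (a ∷_) (∂ i β)))
    (∂-vanish i β (φ ∘ (a ∷_)) λ γ lt → z (a ∷ γ) (ℕ.+-monoʳ-< a lt))

-- Ranks of the entries of a composition, under rotation, extension by zero and swaps.

module Ranks where

  open import Defs using (countFin)
  open import Data.Bool.Base using (T)
  open import Data.Nat using (_+_)
  open import Data.Fin.Permutation using (Permutation′; permutation)
  import Data.Vec.Functional as Vector
  open import Relation.Binary.PropositionalEquality
  open import Algebra.Properties.CommutativeMonoid.Sum ℕ.+-0-commutativeMonoid

  indicator : Bool → ℕ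
  indicator b = if b then 1 else 0

  countFin-sum : ∀ {N} (P : Fin N → Bool) → countFin P ≡ sum (indicator ∘ P)
  countFin-sum P = go P id
    where
    go : ∀ {A : Set} {n} (P : A → Bool) (f : Fin n → A) → List.length (List.filterᵇ P (List.tabulate f)) ≡ sum (indicator ∘ P ∘ f)
    go {n = zero} P f = refl
    go {n = suc n} P f with P (f zero)
    ... | true = cong suc (go P (f ∘ suc))
    ... | false = go P (f ∘ suc)

  lookup-∷ʳ-inject₁ : ∀ {A : Set} {n} (v : Vec A n) x j → lookup (v ∷ʳ x) (inject₁ j) ≡ lookup v j
  lookup-∷ʳ-inject₁ (y ∷ v) x zero = refl
  lookup-∷ʳ-inject₁ (y ∷ v) x (suc j) = lookup-∷ʳ-inject₁ v x j

  lookup-∷ʳ-fromℕ : ∀ {A : Set} {n} (v : Vec A n) x → lookup (v ∷ʳ x) (fromℕ n) ≡ x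
  lookup-∷ʳ-fromℕ [] x = refl
  lookup-∷ʳ-fromℕ (y ∷ v) x = lookup-∷ʳ-fromℕ v x

  rotate : ∀ {n} → Vec ℕ (suc n) → Vec ℕ (suc n)
  rotate (a ∷ β) = β ∷ʳ suc a

  -- the coefficient of r in the j-th coordinate of the point of γ
  rank : ∀ {N} → Vec ℕ N → Fin N → ℕ
  rank γ j = countFin (λ k → lookup γ k <ᵇ lookup γ j)
           + countFin (λ k → (toℕ j <ᵇ toℕ k) ∧ (lookup γ k ≡ᵇ lookup γ j))

  -- The contribution of entry `y` in position `k` to the rank of entry `x` in position `j`. A rank
  -- is a sum of such terms, which can be split off at the end or permuted.
  outranks : (j k x y : ℕ) → ℕ
  outranks j k x y = indicator (y <ᵇ x) + indicator ((j <ᵇ k) ∧ (y ≡ᵇ x))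

  rank-sum : ∀ {N} (γ : Vec ℕ N) j → rank γ j ≡ sum (λ k → outranks (toℕ j) (toℕ k) (lookup γ j) (lookup γ k))
  rank-sum γ j = trans (cong₂ _+_ (countFin-sum (λ k → lookup γ k <ᵇ lookup γ j))
                                  (countFin-sum (λ k → (toℕ j <ᵇ toℕ k) ∧ (lookup γ k ≡ᵇ lookup γ j))))
                       (sym (∑-distrib-+ (λ k → indicator (lookup γ k <ᵇ lookup γ j)) _))

  <ᵇ-irrefl : ∀ n → (n <ᵇ n) ≡ false
  <ᵇ-irrefl zero = refl
  <ᵇ-irrefl (suc n) = <ᵇ-irrefl n

  toℕ-<ᵇ : ∀ {n} (j : Fin n) → (toℕ j <ᵇ n) ≡ true
  toℕ-<ᵇ zero = refl
  toℕ-<ᵇ (suc j) = toℕ-<ᵇ j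

  toℕ-≮ᵇ : ∀ {n} (j : Fin n) → (n <ᵇ toℕ j) ≡ false
  toℕ-≮ᵇ zero = refl
  toℕ-≮ᵇ (suc j) = toℕ-≮ᵇ j

  <ᵇ-split : ∀ x y → indicator (suc y <ᵇ x) + indicator (suc y ≡ᵇ x) ≡ indicator (y <ᵇ x)
  <ᵇ-split zero y = refl
  <ᵇ-split (suc zero) zero = refl
  <ᵇ-split (suc (suc x)) zero = refl
  <ᵇ-split (suc x) (suc y) = <ᵇ-split x y

  <ᵇ-suc : ∀ x y → indicator (y <ᵇ suc x) ≡ indicator (y <ᵇ x) + indicator (y ≡ᵇ x)
  <ᵇ-suc zero zero = refl
  <ᵇ-suc zero (suc y) = refl
  <ᵇ-suc (suc x) zero = refl
  <ᵇ-suc (suc x) (suc y) = <ᵇ-suc x y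

  outranks-self : ∀ j x → outranks j j x x ≡ 0
  outranks-self j x rewrite <ᵇ-irrefl j | <ᵇ-irrefl x = refl

  -- In front, `a` counts towards another entry `x` exactly if a < x. As `a + 1` at the end it
  -- counts if a + 1 < x, or if a + 1 = x because it now stands to the right: the same condition.
  rank-rotate-inject₁ : ∀ {n} (γ : Vec ℕ (suc n)) k → rank (rotate γ) (inject₁ k) ≡ rank γ (suc k)
  rank-rotate-inject₁ {n} (a ∷ β) k = begin
    rank (β ∷ʳ suc a) (inject₁ k) ≡⟨ rank-sum (β ∷ʳ suc a) (inject₁ k) ⟩
    sum t ≡⟨ sum-init-last t ⟩
    sum (t ∘ inject₁) + t (fromℕ n) ≡⟨ cong₂ _+_ (sum-cong-≗ inner) boundary ⟩
    sum (s ∘ suc) + s zero ≡⟨ ℕ.+-comm (sum (s ∘ suc)) (s zero) ⟩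
    sum s ≡⟨ rank-sum (a ∷ β) (suc k) ⟨
    rank (a ∷ β) (suc k) ∎
    where
    open ≡-Reasoning
    t s : Fin (suc n) → ℕ
    t i = outranks (toℕ (inject₁ k)) (toℕ i) (lookup (β ∷ʳ suc a) (inject₁ k)) (lookup (β ∷ʳ suc a) i)
    s i = outranks (suc (toℕ k)) (toℕ i) (lookup β k) (lookup (a ∷ β) i)
    inner : ∀ i → t (inject₁ i) ≡ s (suc i)
    inner i rewrite lookup-∷ʳ-inject₁ β (suc a) k | lookup-∷ʳ-inject₁ β (suc a) i | Fin.toℕ-inject₁ k | Fin.toℕ-inject₁ i = refl
    boundary : t (fromℕ n) ≡ s zero
    boundary rewrite lookup-∷ʳ-inject₁ β (suc a) k | lookup-∷ʳ-fromℕ β (suc a) | Fin.toℕ-inject₁ k | Fin.toℕ-fromℕ n | toℕ-<ᵇ k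
      = trans (<ᵇ-split (lookup β k) a) (sym (ℕ.+-identityʳ _))

  -- Entries equal to `a` counted because they stood to its right; seen from `a + 1` at the end they
  -- count because they are smaller.
  rank-rotate-fromℕ : ∀ {n} (γ : Vec ℕ (suc n)) → rank (rotate γ) (fromℕ n) ≡ rank γ zero
  rank-rotate-fromℕ {n} (a ∷ β) = begin
    rank (β ∷ʳ suc a) (fromℕ n) ≡⟨ rank-sum (β ∷ʳ suc a) (fromℕ n) ⟩
    sum t ≡⟨ sum-init-last t ⟩
    sum (t ∘ inject₁) + t (fromℕ n) ≡⟨ cong₂ _+_ (sum-cong-≗ inner) boundary ⟩
    sum (s ∘ suc) + s zero ≡⟨ ℕ.+-comm (sum (s ∘ suc)) (s zero) ⟩
    sum s ≡⟨ rank-sum (a ∷ β) zero ⟨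
    rank (a ∷ β) zero ∎
    where
    open ≡-Reasoning
    t s : Fin (suc n) → ℕ
    t i = outranks (toℕ (fromℕ n)) (toℕ i) (lookup (β ∷ʳ suc a) (fromℕ n)) (lookup (β ∷ʳ suc a) i)
    s i = outranks 0 (toℕ i) a (lookup (a ∷ β) i)
    inner : ∀ i → t (inject₁ i) ≡ s (suc i)
    inner i rewrite lookup-∷ʳ-fromℕ β (suc a) | lookup-∷ʳ-inject₁ β (suc a) i | Fin.toℕ-fromℕ n | Fin.toℕ-inject₁ i | toℕ-≮ᵇ i
      = trans (ℕ.+-identityʳ _) (<ᵇ-suc a (lookup β i))
    boundary : t (fromℕ n) ≡ s zero
    boundary rewrite lookup-∷ʳ-fromℕ β (suc a) = trans (outranks-self (toℕ (fromℕ n)) (suc a)) (sym (outranks-self 0 a))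

  rank-∷ʳ0-fromℕ : ∀ {n} (γ : Vec ℕ n) → rank (γ ∷ʳ 0) (fromℕ n) ≡ 0
  rank-∷ʳ0-fromℕ {n} γ = trans (rank-sum (γ ∷ʳ 0) (fromℕ n)) (trans (sum-cong-≗ {y = λ _ → 0} zeros) (sum-replicate-zero (suc n)))
    where
    ≮n : ∀ k → (toℕ (fromℕ n) <ᵇ toℕ k) ≡ false
    ≮n k rewrite Fin.toℕ-fromℕ n = Bool.¬-not λ e → ℕ.<⇒≱ (ℕ.<ᵇ⇒< n (toℕ k) (subst T (sym e) _)) (ℕ.≤-pred (Fin.toℕ<n k))
    zeros : ∀ k → outranks (toℕ (fromℕ n)) (toℕ k) (lookup (γ ∷ʳ 0) (fromℕ n)) (lookup (γ ∷ʳ 0) k) ≡ 0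
    zeros k rewrite lookup-∷ʳ-fromℕ γ 0 | ≮n k = refl

  -- The trailing zero is either smaller than an entry or tied with it and to its right, so it
  -- counts once for each.
  rank-∷ʳ0-inject₁ : ∀ {n} (γ : Vec ℕ n) j → rank (γ ∷ʳ 0) (inject₁ j) ≡ suc (rank γ j)
  rank-∷ʳ0-inject₁ {n} γ j = begin
    rank (γ ∷ʳ 0) (inject₁ j) ≡⟨ rank-sum (γ ∷ʳ 0) (inject₁ j) ⟩
    sum t ≡⟨ sum-init-last t ⟩
    sum (t ∘ inject₁) + t (fromℕ n) ≡⟨ cong₂ _+_ (sum-cong-≗ inner) boundary ⟩
    sum s + 1 ≡⟨ ℕ.+-comm (sum s) 1 ⟩
    suc (sum s) ≡⟨ cong suc (rank-sum γ j) ⟨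
    suc (rank γ j) ∎
    where
    open ≡-Reasoning
    t : Fin (suc n) → ℕ
    t i = outranks (toℕ (inject₁ j)) (toℕ i) (lookup (γ ∷ʳ 0) (inject₁ j)) (lookup (γ ∷ʳ 0) i)
    s : Fin n → ℕ
    s i = outranks (toℕ j) (toℕ i) (lookup γ j) (lookup γ i)
    inner : ∀ i → t (inject₁ i) ≡ s i
    inner i rewrite lookup-∷ʳ-inject₁ γ 0 j | lookup-∷ʳ-inject₁ γ 0 i | Fin.toℕ-inject₁ j | Fin.toℕ-inject₁ i = refl
    boundary : t (fromℕ n) ≡ 1
    boundary rewrite lookup-∷ʳ-inject₁ γ 0 j | lookup-∷ʳ-fromℕ γ 0 | Fin.toℕ-inject₁ j | Fin.toℕ-fromℕ n | toℕ-<ᵇ j with lookup γ j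
    ... | zero = refl
    ... | suc _ = refl

  τ-involutive : ∀ {n} (i : Fin n) j → τ i (τ i j) ≡ j
  τ-involutive zero zero = refl
  τ-involutive zero (suc zero) = refl
  τ-involutive zero (suc (suc j)) = refl
  τ-involutive (suc i) zero = refl
  τ-involutive (suc i) (suc j) = cong suc (τ-involutive i j)

  τ-permutation : ∀ {n} → Fin n → Permutation′ (suc n)
  τ-permutation i = permutation (τ i) (τ i) (τ-involutive i) (τ-involutive i)

  Adjacent : ∀ {n} → Fin n → Fin (suc n) → Fin (suc n) → Set
  Adjacent i j k = (j ≡ inject₁ i × k ≡ suc i) ⊎ (j ≡ suc i × k ≡ inject₁ i)

  τ-monotone : ∀ {n} (i : Fin n) j k → (toℕ (τ i j) <ᵇ toℕ (τ i k)) ≡ (toℕ j <ᵇ toℕ k) ⊎ Adjacent i j k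
  τ-monotone zero zero zero = inj₁ refl
  τ-monotone zero zero (suc zero) = inj₂ (inj₁ (refl , refl))
  τ-monotone zero zero (suc (suc k)) = inj₁ refl
  τ-monotone zero (suc zero) zero = inj₂ (inj₂ (refl , refl))
  τ-monotone zero (suc zero) (suc zero) = inj₁ refl
  τ-monotone zero (suc zero) (suc (suc k)) = inj₁ refl
  τ-monotone zero (suc (suc j)) zero = inj₁ refl
  τ-monotone zero (suc (suc j)) (suc zero) = inj₁ refl
  τ-monotone zero (suc (suc j)) (suc (suc k)) = inj₁ refl
  τ-monotone (suc i) zero zero = inj₁ refl
  τ-monotone (suc i) zero (suc k) = inj₁ refl
  τ-monotone (suc i) (suc j) zero = inj₁ refl
  τ-monotone (suc i) (suc j) (suc k) with τ-monotone i j k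
  ... | inj₁ e = inj₁ e
  ... | inj₂ (inj₁ (e , f)) = inj₂ (inj₁ (cong suc e , cong suc f))
  ... | inj₂ (inj₂ (e , f)) = inj₂ (inj₂ (cong suc e , cong suc f))

  ≡ᵇ-≢ : ∀ {x y} → x ≢ y → (x ≡ᵇ y) ≡ false
  ≡ᵇ-≢ {x} {y} x≢y = Bool.¬-not λ e → x≢y (ℕ.≡ᵇ⇒≡ x y (subst T (sym e) _))

  ≡ᵇ-refl : ∀ x → (x ≡ᵇ x) ≡ true
  ≡ᵇ-refl zero = refl
  ≡ᵇ-refl (suc x) = ≡ᵇ-refl x

  -- Positions only matter for breaking ties, and the swap reverses the order of no other pair than
  -- the two neighbours, which are unequal.
  rank-swap : ∀ {n} (i : Fin n) (γ : Vec ℕ (suc n)) → lookup γ (inject₁ i) ≢ lookup γ (suc i) →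
              ∀ j → rank (swap i γ) j ≡ rank γ (τ i j)
  rank-swap i γ γᵢ≢ j = begin
    rank (swap i γ) j ≡⟨ rank-sum (swap i γ) j ⟩
    sum t ≡⟨ sum-permute t (τ-permutation i) ⟩
    sum (t ∘ τ i) ≡⟨ sum-cong-≗ same ⟩
    sum s ≡⟨ rank-sum γ (τ i j) ⟨
    rank γ (τ i j) ∎
    where
    open ≡-Reasoning
    t s : Fin _ → ℕ
    t k = outranks (toℕ j) (toℕ k) (lookup (swap i γ) j) (lookup (swap i γ) k)
    s k = outranks (toℕ (τ i j)) (toℕ k) (lookup γ (τ i j)) (lookup γ k)
    same : ∀ k → t (τ i k) ≡ s k
    same k rewrite lookup-swap i γ j | lookup-swap i γ (τ i k) | τ-involutive i k with τ-monotone i (τ i j) k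
    ... | inj₁ e rewrite sym e | τ-involutive i j = refl
    ... | inj₂ (inj₁ (e , refl)) rewrite e | ≡ᵇ-≢ (γᵢ≢ ∘ sym) | Bool.∧-zeroʳ (toℕ j <ᵇ toℕ (τ i (suc i))) | Bool.∧-zeroʳ (toℕ (inject₁ i) <ᵇ toℕ (suc i)) = refl
    ... | inj₂ (inj₂ (e , refl)) rewrite e | ≡ᵇ-≢ γᵢ≢ | Bool.∧-zeroʳ (toℕ j <ᵇ toℕ (τ i (inject₁ i))) | Bool.∧-zeroʳ (toℕ (suc i) <ᵇ toℕ (inject₁ i)) = refl

  <ᵇ-suc-≢ : ∀ {n} (i : Fin n) (k : Fin (suc n)) → k ≢ suc i → (toℕ (inject₁ i) <ᵇ toℕ k) ≡ (suc (toℕ i) <ᵇ toℕ k)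
  <ᵇ-suc-≢ zero zero k≢ = refl
  <ᵇ-suc-≢ zero (suc zero) k≢ = contradiction refl k≢
  <ᵇ-suc-≢ zero (suc (suc k)) k≢ = refl
  <ᵇ-suc-≢ (suc i) zero k≢ = refl
  <ᵇ-suc-≢ (suc i) (suc k) k≢ = <ᵇ-suc-≢ i k (k≢ ∘ cong suc)

  -- Equal neighbours see all other entries alike, and the left one also counts the right one. This
  -- unit becomes the coordinate gap of -r.
  rank-equal : ∀ {n} (i : Fin n) (γ : Vec ℕ (suc n)) → lookup γ (inject₁ i) ≡ lookup γ (suc i) →
               rank γ (inject₁ i) ≡ suc (rank γ (suc i))
  rank-equal i γ γᵢ≡ = begin
    rank γ (inject₁ i) ≡⟨ rank-sum γ (inject₁ i) ⟩
    sum t ≡⟨ sum-remove {i = suc i} t ⟩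
    t (suc i) + sum (Vector.removeAt t (suc i)) ≡⟨ cong₂ _+_ at-suc (sum-cong-≗ λ k → same (Fin.punchIn (suc i) k) (Fin.punchInᵢ≢i (suc i) k)) ⟩
    suc (sum (Vector.removeAt s (suc i))) ≡⟨ cong (λ x → suc (x + sum (Vector.removeAt s (suc i)))) (outranks-self (suc (toℕ i)) (lookup γ (suc i))) ⟨
    suc (s (suc i) + sum (Vector.removeAt s (suc i))) ≡⟨ cong suc (sum-remove {i = suc i} s) ⟨
    suc (sum s) ≡⟨ cong suc (rank-sum γ (suc i)) ⟨
    suc (rank γ (suc i)) ∎
    where
    open ≡-Reasoning
    t s : Fin _ → ℕ
    t k = outranks (toℕ (inject₁ i)) (toℕ k) (lookup γ (inject₁ i)) (lookup γ k)
    s k = outranks (suc (toℕ i)) (toℕ k) (lookup γ (suc i)) (lookup γ k)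
    i<ᵇsuc : ∀ {n} (i : Fin n) → (toℕ (inject₁ i) <ᵇ suc (toℕ i)) ≡ true
    i<ᵇsuc zero = refl
    i<ᵇsuc (suc i) = i<ᵇsuc i
    at-suc : t (suc i) ≡ 1
    at-suc rewrite γᵢ≡ | <ᵇ-irrefl (lookup γ (suc i)) | i<ᵇsuc i | ≡ᵇ-refl (lookup γ (suc i)) = refl
    same : ∀ k → k ≢ suc i → t k ≡ s k
    same k k≢ rewrite γᵢ≡ | <ᵇ-suc-≢ i k k≢ = refl

open Ranks

-- Generating all compositions by swaps and rotations.

size-rotate : ∀ {n} (γ : Vec ℕ (suc n)) → size (rotate γ) ≡ suc (size γ)
size-rotate (a ∷ β) = size-∷ʳ β (suc a)

size-replicate0 : ∀ N → size (replicate N 0) ≡ 0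
size-replicate0 zero = ≡.refl
size-replicate0 (suc N) = size-replicate0 N

size≡0 : ∀ {N} (β : Vec ℕ N) → size β ≡ 0 → β ≡ replicate N 0
size≡0 [] e = ≡.refl
size≡0 (zero ∷ β) e = ≡.cong (0 ∷_) (size≡0 β e)

-- Adjacent swaps carry a nonzero entry to the end, where rotate can be undone.
composition-induction : ∀ {n} (P : Vec ℕ (suc n) → Set) → P (replicate (suc n) 0) →
  (∀ i γ → P γ → P (swap i γ)) → (∀ γ → P γ → P (rotate γ)) → ∀ γ → P γ
composition-induction {n} P base swap-step rotate-step γ = go (size γ) γ ≡.refl
  where
  go : ∀ d γ → size γ ≡ d → P γ
  nonzero : ∀ d γ → size γ ≡ suc d → ∀ m j → toℕ j ℕ.+ m ≡ n → lookup γ j ≢ 0 → P γ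

  go zero γ e = ≡.subst P (≡.sym (size≡0 γ e)) base
  go (suc d) γ e with find γ e
    where
    find : ∀ {N} (γ : Vec ℕ N) → size γ ≡ suc d → ∃[ j ] lookup γ j ≢ 0
    find (zero ∷ γ) e with find γ e
    ... | j , p = suc j , p
    find (suc a ∷ γ) e = zero , λ ()
  ... | j , p = nonzero d γ e (n ℕ.∸ toℕ j) j (ℕ.m+[n∸m]≡n (ℕ.≤-pred (Fin.toℕ<n j))) p

  nonzero d γ e m j j+m≡n γⱼ≢0 with view j
  nonzero d γ e m .(fromℕ n) j+m≡n γⱼ≢0 | ‵fromℕ with initLast γ
  ... | β , b , ≡.refl with b | ≡.subst (_≢ 0) (lookup-∷ʳ-fromℕ β b) γⱼ≢0
  ... | zero | ≢0 = contradiction ≡.refl ≢0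
  ... | suc a | _ = rotate-step (a ∷ β) (go d (a ∷ β) (ℕ.suc-injective (≡.trans (≡.sym (size-∷ʳ β (suc a))) e)))
  nonzero d γ e zero .(inject₁ i) j+m≡n γⱼ≢0 | ‵inject₁ i =
    contradiction (≡.trans (≡.sym (ℕ.+-identityʳ _)) (≡.trans (≡.cong (ℕ._+ 0) (≡.sym (Fin.toℕ-inject₁ i))) j+m≡n)) (ℕ.<⇒≢ (Fin.toℕ<n i))
  nonzero d γ e (suc m) .(inject₁ i) j+m≡n γⱼ≢0 | ‵inject₁ i =
    ≡.subst P (swap-involutive i γ) (swap-step i (swap i γ)
      (nonzero d (swap i γ) (≡.trans (size-swap i γ) e) m (suc i)
        (≡.trans (≡.sym (ℕ.+-suc (toℕ i) m)) (≡.trans (≡.cong (ℕ._+ suc m) (≡.sym (Fin.toℕ-inject₁ i))) j+m≡n))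
        (≡.subst (_≢ 0) (≡.sym (≡.trans (lookup-swap i γ (suc i)) (≡.cong (lookup γ) (τ-suc i)))) γⱼ≢0)))

-- The properties of the coefficient field on which the argument rests.

record ParameterField : Set₁ where
  field
    K : CommutativeRing 0ℓ 0ℓ
  open CommutativeRing K public hiding (zero)
  field
    ι : ℕ → Carrier
    ι-zero : ι 0 ≈ 0#
    ι-suc : ∀ n → ι (suc n) ≈ 1# + ι n
    r : Carrier
    -- Combines characteristic zero with the independence of `r` from the integers. It makes
    -- coordinates distinguishable and keeps the pivots of the interpolation nonzero.
    ι+rι-injective : ∀ a b c d → ι a + r * ι b ≈ ι c + r * ι d → a ≡ c × b ≡ d
    inverse : ∀ x → ¬ x ≈ 0# → ∃[ y ] x * y ≈ 1#

-- Interpolation at the points -γ̄ and the construction of bar monomials.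

module Interpolation (F : ParameterField) where

  open ParameterField F
  open Polynomials K
  open IntegerSolver K
  open import Algebra.Properties.Semiring.Exp semiring using (_^_)
  open import Relation.Binary.Reasoning.Setoid setoid

  cancel : ∀ {x y} → ¬ x ≈ 0# → x * y ≈ 0# → y ≈ 0#
  cancel {x} {y} x≉0 e with inverse x x≉0
  ... | z , xz≈1 = begin
    y ≈⟨ *-identityˡ y ⟨
    1# * y ≈⟨ *-congʳ xz≈1 ⟨
    (x * z) * y ≈⟨ solve 3 (λ x y z → (x :* z) :* y := z :* (x :* y)) refl x y z ⟩
    z * (x * y) ≈⟨ *-congˡ e ⟩
    z * 0# ≈⟨ zeroʳ z ⟩
    0# ∎

  cancel-≈ : ∀ {x y z} → ¬ x ≈ 0# → x * y ≈ x * z → y ≈ z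
  cancel-≈ {x} {y} {z} x≉0 e = x-y≈0⇒x≈y (cancel x≉0 (begin
    x * (y - z) ≈⟨ solve 3 (λ x y z → x :* (y :- z) := x :* y :- x :* z) refl x y z ⟩
    x * y - x * z ≈⟨ +-congʳ e ⟩
    x * z - x * z ≈⟨ -‿inverseʳ _ ⟩
    0# ∎))

  1≉0 : ¬ 1# ≈ 0#
  1≉0 1≈0 = ℕ.1+n≢0 (proj₁ (ι+rι-injective 1 0 0 0 (+-congʳ (trans (ι-suc 0) (trans (+-congʳ 1≈0) (+-identityˡ _))))))

  coordinate : ℕ → ℕ → Carrier
  coordinate a b = - (ι a + r * ι b)

  -- the interpolation point of γ with all signs changed
  pt : ∀ {N} → Vec ℕ N → Point N
  pt γ j = coordinate (lookup γ j) (rank γ j)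

  coordinate-injective : ∀ a b c d → coordinate a b ≈ coordinate c d → a ≡ c × b ≡ d
  coordinate-injective a b c d e = ι+rι-injective a b c d (begin
    ι a + r * ι b ≈⟨ solve 1 (λ x → x := :- :- x) refl _ ⟩
    - coordinate a b ≈⟨ -‿cong e ⟩
    - coordinate c d ≈⟨ solve 1 (λ x → :- :- x := x) refl _ ⟩
    ι c + r * ι d ∎)

  coordinate-0-0 : coordinate 0 0 ≈ 0#
  coordinate-0-0 = trans (-‿cong (+-cong ι-zero (*-congˡ ι-zero))) (solve 1 (λ r → :- (:0 :+ r :* :0) := :0) refl r)

  coordinate-suc₁ : ∀ a b → coordinate (suc a) b ≈ coordinate a b - 1#
  coordinate-suc₁ a b = trans (-‿cong (+-congʳ (ι-suc a))) (solve 2 (λ a b → :- ((:1 :+ a) :+ b) := (:- (a :+ b)) :- :1) refl (ι a) (r * ι b))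

  coordinate-suc₂ : ∀ a b → coordinate a (suc b) ≈ coordinate a b - r
  coordinate-suc₂ a b = trans (-‿cong (+-congˡ (*-congˡ (ι-suc b)))) (solve 3 (λ a b r → :- (a :+ r :* (:1 :+ b)) := (:- (a :+ r :* b)) :- r) refl (ι a) (ι b) r)

  pt-rotate-inject₁ : ∀ {n} (γ : Vec ℕ (suc n)) k → pt (rotate γ) (inject₁ k) ≡ pt γ (suc k)
  pt-rotate-inject₁ γ@(a ∷ β) k = ≡.cong₂ coordinate (lookup-∷ʳ-inject₁ β (suc a) k) (rank-rotate-inject₁ γ k)

  pt-rotate-fromℕ : ∀ {n} (γ : Vec ℕ (suc n)) → pt (rotate γ) (fromℕ n) ≈ pt γ zero - 1#
  pt-rotate-fromℕ γ@(a ∷ β) = trans (reflexive (≡.cong₂ coordinate (lookup-∷ʳ-fromℕ β (suc a)) (rank-rotate-fromℕ γ)))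
    (coordinate-suc₁ a (rank γ zero))

  pt-rotate-fromℕ≉0 : ∀ {n} (γ : Vec ℕ (suc n)) → ¬ pt (rotate γ) (fromℕ n) ≈ 0#
  pt-rotate-fromℕ≉0 {n} γ@(a ∷ β) e = ℕ.1+n≢0 (≡.trans (≡.sym (lookup-∷ʳ-fromℕ β (suc a))) (proj₁
    (coordinate-injective (lookup (rotate γ) (fromℕ n)) (rank (rotate γ) (fromℕ n)) 0 0 (trans e (sym coordinate-0-0)))))

  pt-∷ʳ0-fromℕ : ∀ {n} (γ : Vec ℕ n) → pt (γ ∷ʳ 0) (fromℕ n) ≈ 0#
  pt-∷ʳ0-fromℕ γ = trans (reflexive (≡.cong₂ coordinate (lookup-∷ʳ-fromℕ γ 0) (rank-∷ʳ0-fromℕ γ))) coordinate-0-0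

  pt-∷ʳ0-inject₁ : ∀ {n} (γ : Vec ℕ n) j → pt (γ ∷ʳ 0) (inject₁ j) ≈ pt γ j - r
  pt-∷ʳ0-inject₁ γ j = trans (reflexive (≡.cong₂ coordinate (lookup-∷ʳ-inject₁ γ 0 j) (rank-∷ʳ0-inject₁ γ j)))
    (coordinate-suc₂ _ _)

  pt-swap : ∀ {n} (i : Fin n) (γ : Vec ℕ (suc n)) → lookup γ (inject₁ i) ≢ lookup γ (suc i) →
            ∀ j → pt (swap i γ) j ≡ pt γ (τ i j)
  pt-swap i γ γᵢ≢ j = ≡.cong₂ coordinate (lookup-swap i γ j) (rank-swap i γ γᵢ≢ j)

  gap : ∀ {n} → Fin n → Vec ℕ (suc n) → Carrier
  gap i γ = pt γ (inject₁ i) - pt γ (suc i)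

  gap-equal : ∀ {n} (i : Fin n) (γ : Vec ℕ (suc n)) → lookup γ (inject₁ i) ≡ lookup γ (suc i) → gap i γ ≈ - r
  gap-equal i γ γᵢ≡ = begin
    gap i γ ≈⟨ +-congʳ (reflexive (≡.cong₂ coordinate γᵢ≡ (rank-equal i γ γᵢ≡))) ⟩
    coordinate (lookup γ (suc i)) (suc (rank γ (suc i))) - pt γ (suc i) ≈⟨ +-congʳ (coordinate-suc₂ _ _) ⟩
    pt γ (suc i) - r - pt γ (suc i) ≈⟨ solve 2 (λ x r → x :- r :- x := :- r) refl _ r ⟩
    - r ∎

  -- For equal neighbours `swap i γ` does not have the transposed point of `γ`. Any two values
  -- weighted by `gap i γ + r` may nevertheless be exchanged there, since the weight is zero.
  gap-equal-* : ∀ {n} (i : Fin n) (γ : Vec ℕ (suc n)) → lookup γ (inject₁ i) ≡ lookup γ (suc i) → ∀ x → (gap i γ + r) * x ≈ 0#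
  gap-equal-* i γ γᵢ≡ x = trans (*-congʳ (+-congʳ (gap-equal i γ γᵢ≡))) (solve 2 (λ r x → (:- r :+ r) :* x := :0) refl r x)

  -- Equal coordinates would force equal entries and equal ranks, but equal neighbours have
  -- consecutive ranks.
  gap≉0 : ∀ {n} (i : Fin n) (γ : Vec ℕ (suc n)) → ¬ gap i γ ≈ 0#
  gap≉0 i γ e = ℕ.1+n≢n (≡.trans (≡.sym (rank-equal i γ (proj₁ equal))) (proj₂ equal))
    where
    equal : lookup γ (inject₁ i) ≡ lookup γ (suc i) × rank γ (inject₁ i) ≡ rank γ (suc i)
    equal = coordinate-injective (lookup γ (inject₁ i)) (rank γ (inject₁ i)) (lookup γ (suc i)) (rank γ (suc i))
      (x-y≈0⇒x≈y e)

  Vanishes : ∀ {N} → ℕ → MPoly N → Set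
  Vanishes d f = ∀ γ → size γ < d → eval f (pt γ) ≈ 0#

  infixr 5 _◂_
  _◂_ : ∀ {N} → Carrier → Point N → Point (suc N)
  (x ◂ v) zero = x
  (x ◂ v) (suc i) = v i

  -- f(x′, xₙ) = f₀(x′) + xₙ f₁(xₙ, x′)
  constant-terms : ∀ {n} → Vec ℕ n → ℕ → MPoly n
  constant-terms β zero = single β
  constant-terms β (suc b) = []

  divided-terms : ∀ {n} → Vec ℕ n → ℕ → MPoly (suc n)
  divided-terms β zero = []
  divided-terms β (suc b) = single (b ∷ β)

  module _ {n : ℕ} (f : MPoly (suc n)) where

    f₀ : MPoly n
    f₀ = extend (λ β → constant-terms (init β) (last β)) f

    f₁ : MPoly (suc n)
    f₁ = extend (λ β → divided-terms (init β) (last β)) f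

    private
      lin-init-last : ∀ {M} (A : Vec ℕ n → ℕ → MPoly M) φ ψ → (∀ β b → lin φ (A β b) ≈ ψ (β ∷ʳ b)) →
                      lin φ (extend (λ β → A (init β) (last β)) f) ≈ lin ψ f
      lin-init-last A φ ψ e = trans (lin-extend φ _ f) (lin-cong pointwise f)
        where
        pointwise : ∀ β → lin φ (A (init β) (last β)) ≈ ψ β
        pointwise β with initLast β
        ... | β′ , b , ≡.refl = e β′ b

    coeff-f₀ : ∀ γ → coeff γ f₀ ≈ coeff (γ ∷ʳ 0) f
    coeff-f₀ γ = lin-init-last constant-terms (δ γ) (δ (γ ∷ʳ 0)) pointwise
      where
      pointwise : ∀ β b → lin (δ γ) (constant-terms β b) ≈ δ (γ ∷ʳ 0) (β ∷ʳ b)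
      pointwise β (suc b) = sym (δ-≢ (γ ∷ʳ 0) (β ∷ʳ suc b) λ e → ℕ.0≢1+n (Vec.∷ʳ-injectiveʳ γ β e))
      pointwise β zero with γ ≟ β
      ... | yes ≡.refl = trans (solve 0 (:1 :* :1 :+ :0 := :1) refl) (sym (δ-refl (γ ∷ʳ 0)))
      ... | no γ≢β = trans (solve 0 (:1 :* :0 :+ :0 := :0) refl) (sym (δ-≢ (γ ∷ʳ 0) (β ∷ʳ 0) (γ≢β ∘ Vec.∷ʳ-injectiveˡ γ β)))

    coeff-f₁ : ∀ c γ → coeff (c ∷ γ) f₁ ≈ coeff (γ ∷ʳ suc c) f
    coeff-f₁ c γ = lin-init-last divided-terms (δ (c ∷ γ)) (δ (γ ∷ʳ suc c)) pointwise
      where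
      pointwise : ∀ β b → lin (δ (c ∷ γ)) (divided-terms β b) ≈ δ (γ ∷ʳ suc c) (β ∷ʳ b)
      pointwise β zero = sym (δ-≢ (γ ∷ʳ suc c) (β ∷ʳ 0) λ e → ℕ.1+n≢0 (Vec.∷ʳ-injectiveʳ γ β e))
      pointwise β (suc b) = trans (lin-single (δ (c ∷ γ)) (b ∷ β)) (case ((c ∷ γ) ≟ (b ∷ β)))
        where
        case : Dec (c ∷ γ ≡ b ∷ β) → δ (c ∷ γ) (b ∷ β) ≈ δ (γ ∷ʳ suc c) (β ∷ʳ suc b)
        case (yes ≡.refl) = trans (δ-refl (c ∷ γ)) (sym (δ-refl (γ ∷ʳ suc c)))
        case (no ≢) = trans (δ-≢ (c ∷ γ) (b ∷ β) ≢) (sym (δ-≢ (γ ∷ʳ suc c) (β ∷ʳ suc b) λ e →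
          ≢ (≡.cong₂ _∷_ (ℕ.suc-injective (Vec.∷ʳ-injectiveʳ γ β e)) (Vec.∷ʳ-injectiveˡ γ β e))))

    eval-split : ∀ v → eval f v ≈ eval f₀ (v ∘ inject₁) + v (fromℕ n) * eval f₁ (v (fromℕ n) ◂ v ∘ inject₁)
    eval-split v = sym (begin
      eval f₀ v₀ + x * eval f₁ (x ◂ v₀) ≈⟨ +-congˡ (lin-* x (power (x ◂ v₀)) f₁) ⟨
      eval f₀ v₀ + lin (λ β → x * power (x ◂ v₀) β) f₁
        ≈⟨ +-cong (lin-init-last constant-terms _ (λ β → lin (power v₀) (constant-terms (init β) (last β))) (λ β b → lem₀ β b))
                  (lin-init-last divided-terms _ (λ β → lin (λ β → x * power (x ◂ v₀) β) (divided-terms (init β) (last β))) (λ β b → lem₁ β b)) ⟩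
      lin (λ β → lin (power v₀) (constant-terms (init β) (last β))) f
        + lin (λ β → lin (λ β → x * power (x ◂ v₀) β) (divided-terms (init β) (last β))) f
        ≈⟨ lin-+ _ _ f ⟨
      lin (λ β → lin (power v₀) (constant-terms (init β) (last β)) + lin (λ β → x * power (x ◂ v₀) β) (divided-terms (init β) (last β))) f
        ≈⟨ lin-cong split f ⟩
      eval f v ∎)
      where
      x : Carrier
      x = v (fromℕ n)
      v₀ : Point n
      v₀ = v ∘ inject₁
      lem₀ : ∀ β b → lin (power v₀) (constant-terms β b) ≈ lin (power v₀) (constant-terms (init (β ∷ʳ b)) (last (β ∷ʳ b)))
      lem₀ β b = reflexive (≡.sym (≡.cong₂ (λ β b → lin (power v₀) (constant-terms β b)) (Vec.init-∷ʳ b β) (Vec.last-∷ʳ b β)))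
      lem₁ : ∀ β b → lin (λ β → x * power (x ◂ v₀) β) (divided-terms β b)
                   ≈ lin (λ β → x * power (x ◂ v₀) β) (divided-terms (init (β ∷ʳ b)) (last (β ∷ʳ b)))
      lem₁ β b = reflexive (≡.sym (≡.cong₂ (λ β b → lin (λ β → x * power (x ◂ v₀) β) (divided-terms β b)) (Vec.init-∷ʳ b β) (Vec.last-∷ʳ b β)))
      split : ∀ β → lin (power v₀) (constant-terms (init β) (last β)) + lin (λ β → x * power (x ◂ v₀) β) (divided-terms (init β) (last β)) ≈ power v β
      split β with initLast β
      ... | β′ , zero , ≡.refl = trans (solve 1 (λ p → :1 :* p :+ :0 :+ :0 := p :* :1) refl _) (sym (power-∷ʳ v β′ 0))
      ... | β′ , suc b , ≡.refl = trans (solve 3 (λ x y p → :0 :+ (:1 :* (x :* (y :* p)) :+ :0) := p :* (x :* y)) refl x (x ^ b) (power v₀ β′)) (sym (power-∷ʳ v β′ (suc b)))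

  translate-head : ∀ {n} → Carrier → Vec ℕ (suc n) → MPoly (suc n)
  translate-head c (b ∷ β) = relabel (_∷ β) (binomial c b)

  translate-head-lead : ∀ {n} c → HasLead {suc n} id (translate-head c)
  translate-head-lead c (b ∷ β) φ z = trans (reflexive (lin-relabel φ (_∷ β) (binomial c b)))
    (binomial-lead c b _ λ a lt → z (a ∷ β) (ℕ.+-monoˡ-< (size β) lt))

  eval-translate-head : ∀ {n} c p (v : Point (suc n)) →
    eval (extend (translate-head c) p) v ≈ eval p (v zero + c ◂ v ∘ suc)
  eval-translate-head c p v = trans (lin-extend (power v) (translate-head c) p) (lin-cong pointwise p)
    where
    pointwise : ∀ β → lin (power v) (translate-head c β) ≈ power (v zero + c ◂ v ∘ suc) β
    pointwise (b ∷ β) = begin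
      lin (power v) (relabel (_∷ β) (binomial c b)) ≡⟨ lin-relabel (power v) (_∷ β) (binomial c b) ⟩
      lin (λ a → v zero ^ a * power (v ∘ suc) β) (binomial c b) ≈⟨ lin-cong (λ _ → *-comm _ _) (binomial c b) ⟩
      lin (λ a → power (v ∘ suc) β * v zero ^ a) (binomial c b) ≈⟨ lin-* (power (v ∘ suc) β) (v zero ^_) (binomial c b) ⟩
      power (v ∘ suc) β * lin (v zero ^_) (binomial c b) ≈⟨ *-comm _ _ ⟩
      lin (v zero ^_) (binomial c b) * power (v ∘ suc) β ≈⟨ *-congʳ (binomial-eval c b (v zero)) ⟩
      (v zero + c) ^ b * power (v ∘ suc) β ∎

  -- Points whose last entry is 0 lie on the hyperplane xₙ = 0; the others are
  -- obtained by rotation, off that hyperplane.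
  unisolvent : ∀ N d (f : MPoly N) → DegBelow d f → Vanishes d f → Null f
  unisolvent N zero f deg van β = deg β z≤n
  -- Without variables the value at the only point is the constant coefficient.
  unisolvent zero (suc d) f deg van [] = trans (lin-cong (λ { [] → refl }) f) (van [] (s≤s z≤n))
  unisolvent (suc n) (suc d) f deg van = null
    where
    -- Appending a zero raises all other ranks by one, so f₀ is sampled at the points of n variables
    -- moved by -r. Translating f₀ brings them back to interpolation points.
    f₀-shifted-vanishes : Vanishes (suc d) (extend (translate (- r)) (f₀ f))
    f₀-shifted-vanishes γ lt = begin
      eval (extend (translate (- r)) (f₀ f)) (pt γ) ≈⟨ eval-translate (- r) (f₀ f) (pt γ) ⟩
      eval (f₀ f) (λ i → pt γ i - r) ≈⟨ eval-cong (f₀ f) (pt-∷ʳ0-inject₁ γ) ⟨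
      eval (f₀ f) (w ∘ inject₁) ≈⟨ solve 2 (λ x y → x := x :+ :0 :* y) refl _ _ ⟩
      eval (f₀ f) (w ∘ inject₁) + 0# * eval (f₁ f) (w (fromℕ n) ◂ w ∘ inject₁)
                                                          ≈⟨ +-congˡ (*-congʳ (pt-∷ʳ0-fromℕ γ)) ⟨
      eval (f₀ f) (w ∘ inject₁) + w (fromℕ n) * eval (f₁ f) (w (fromℕ n) ◂ w ∘ inject₁)
                                                          ≈⟨ eval-split f w ⟨
      eval f w ≈⟨ van (γ ∷ʳ 0) (≡.subst (_< suc d) (≡.sym (size-∷ʳ γ 0)) lt) ⟩
      0# ∎
      where
      w : Point (suc n)
      w = pt (γ ∷ʳ 0)
    f₀-deg : DegBelow (suc d) (f₀ f)
    f₀-deg β le = trans (coeff-f₀ f β) (deg (β ∷ʳ 0) (≡.subst (suc d ≤_) (≡.sym (size-∷ʳ β 0)) le))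
    translated-deg : ∀ {N d} (A : Vec ℕ N → MPoly N) → HasLead id A → ∀ p → DegBelow d p → DegBelow d (extend A p)
    translated-deg {N} {d} A lead p deg β le = trans (lin-extend (δ β) A p)
      (trans (lin-cong-deg _ (λ _ → 0#) p deg λ γ lt →
        trans (coeff-lead id A lead 0 (λ _ → ≡.refl) γ β (ℕ.<⇒≤ (ℕ.<-≤-trans lt le)))
              (δ-≢ β γ λ { ≡.refl → ℕ.<⇒≱ lt le }))
        (lin-0 p))
    f₀-null : Null (f₀ f)
    f₀-null = extend-injective id (translate (- r)) (translate-lead (- r)) 0 (λ _ → ≡.refl) id (suc d) (f₀ f) f₀-deg
      (unisolvent n (suc d) (extend (translate (- r)) (f₀ f)) (translated-deg (translate (- r)) (translate-lead (- r)) (f₀ f) f₀-deg) f₀-shifted-vanishes)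
    f₁-deg : DegBelow d (f₁ f)
    f₁-deg (b ∷ β) le = trans (coeff-f₁ f b β) (deg (β ∷ʳ suc b) (≡.subst (suc d ≤_) (≡.sym (size-∷ʳ β (suc b))) (s≤s le)))
    -- With f₀ null, f is x_n times f₁, and x_n is nonzero at rotated points. Its arguments there
    -- are the coordinates of `γ` with the first one lowered by 1. Losing the factor x_n lowers the
    -- degree bound to `d`, just as undoing the rotation lowers the size.
    f₁-shifted-vanishes : Vanishes d (extend (translate-head (- 1#)) (f₁ f))
    f₁-shifted-vanishes γ lt = cancel (pt-rotate-fromℕ≉0 γ) (begin
      w (fromℕ n) * eval (extend (translate-head (- 1#)) (f₁ f)) (pt γ)
        ≈⟨ *-congˡ (trans (eval-translate-head (- 1#) (f₁ f) (pt γ)) (eval-cong (f₁ f)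
             λ { zero → sym (pt-rotate-fromℕ γ) ; (suc i) → sym (reflexive (pt-rotate-inject₁ γ i)) })) ⟩
      w (fromℕ n) * eval (f₁ f) (w (fromℕ n) ◂ w ∘ inject₁)
        ≈⟨ solve 1 (λ x → x := :0 :+ x) refl _ ⟩
      0# + w (fromℕ n) * eval (f₁ f) (w (fromℕ n) ◂ w ∘ inject₁)
        ≈⟨ +-congʳ (lin-null _ (f₀ f) f₀-null) ⟨
      eval (f₀ f) (w ∘ inject₁) + w (fromℕ n) * eval (f₁ f) (w (fromℕ n) ◂ w ∘ inject₁)
        ≈⟨ eval-split f w ⟨
      eval f w
        ≈⟨ van (rotate γ) (≡.subst (_< suc d) (≡.sym (size-rotate γ)) (s≤s lt)) ⟩
      0# ∎)
      where
      w : Point (suc n)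
      w = pt (rotate γ)
    f₁-null : Null (f₁ f)
    f₁-null = extend-injective id (translate-head (- 1#)) (translate-head-lead (- 1#)) 0 (λ _ → ≡.refl) id d (f₁ f) f₁-deg
      (unisolvent (suc n) d (extend (translate-head (- 1#)) (f₁ f)) (translated-deg (translate-head (- 1#)) (translate-head-lead (- 1#)) (f₁ f) f₁-deg) f₁-shifted-vanishes)
    null : Null f
    null β with initLast β
    ... | β′ , zero , ≡.refl = trans (sym (coeff-f₀ f β′)) (f₀-null β′)
    ... | β′ , suc b , ≡.refl = trans (sym (coeff-f₁ f b β′)) (f₁-null (b ∷ β′))

  determined : ∀ {N d} (p q : MPoly N) → DegBelow (suc d) p → DegBelow (suc d) q →
               (∀ γ → size γ ≤ d → eval p (pt γ) ≈ eval q (pt γ)) → ∀ β → coeff β p ≈ coeff β q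
  determined {N} {d} p q dp dq e β = x-y≈0⇒x≈y (trans (sym (lin-⊖ (δ β) p q)) (unisolvent N (suc d) (p ⊖ q) (DegBelow-⊖ p q dp dq)
    (λ γ lt → trans (lin-⊖ (power (pt γ)) p q) (trans (+-congʳ (e γ (ℕ.≤-pred lt))) (-‿inverseʳ _))) β))

  -- By Ξ-monomial below, these properties characterise the bar monomial of ζ.
  record Bar {N : ℕ} (ζ : Vec ℕ N) (q : MPoly N) : Set where
    field
      leading : Leading ζ q
      vanishes : Vanishes (size ζ) q
  open Bar public

  -- The leading terms cancel, so the difference has degree below the size of `ζ` and vanishes at
  -- all points of smaller size.
  Bar-unique : ∀ {N} {ζ : Vec ℕ N} {p q} → Bar ζ p → Bar ζ q → ∀ β → coeff β p ≈ coeff β q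
  Bar-unique {N} {ζ} {p} {q} bp bq β = x-y≈0⇒x≈y (trans (sym (lin-⊖ (δ β) p q))
    (unisolvent N (size ζ) (p ⊖ q)
      (λ γ le → trans (lin-⊖ (δ γ) p q) (trans (+-cong (leading bp γ le) (-‿cong (leading bq γ le))) (-‿inverseʳ _)))
      (λ γ lt → trans (lin-⊖ (power (pt γ)) p q) (trans (+-cong (vanishes bp γ lt) (-‿cong (vanishes bq γ lt))) (-‿inverseʳ 0#)))
      β))

  rotation : ∀ {n} → Vec ℕ (suc n) → MPoly (suc n)
  rotation (a ∷ β) = relabel (λ e → β ∷ʳ suc e) (binomial 1# a)

  rotation-lead : ∀ {n} → HasLead {suc n} rotate rotation
  rotation-lead (a ∷ β) φ z = trans (reflexive (lin-relabel φ _ (binomial 1# a)))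
    (binomial-lead 1# a _ λ e lt → z (β ∷ʳ suc e) (≡.subst₂ _<_ (≡.sym (size-∷ʳ β (suc e))) (≡.sym (size-∷ʳ β (suc a)))
      (s≤s (ℕ.+-monoˡ-< (size β) lt))))

  eval-rotation : ∀ {n} p (v : Point (suc n)) →
    eval (extend rotation p) v ≈ v (fromℕ n) * eval p (v (fromℕ n) + 1# ◂ v ∘ inject₁)
  eval-rotation {n} p v = trans (lin-extend (power v) rotation p) (trans (lin-cong pointwise p) (lin-* x _ p))
    where
    x : Carrier
    x = v (fromℕ n)
    pointwise : ∀ β → lin (power v) (rotation β) ≈ x * power (x + 1# ◂ v ∘ inject₁) β
    pointwise (a ∷ β) = begin
      lin (power v) (rotation (a ∷ β)) ≡⟨ lin-relabel (power v) _ (binomial 1# a) ⟩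
      lin (λ e → power v (β ∷ʳ suc e)) (binomial 1# a) ≈⟨ lin-cong (λ e → trans (power-∷ʳ v β (suc e)) (sym (*-assoc _ _ _))) (binomial 1# a) ⟩
      lin (λ e → power (v ∘ inject₁) β * x * x ^ e) (binomial 1# a) ≈⟨ lin-* _ (x ^_) (binomial 1# a) ⟩
      power (v ∘ inject₁) β * x * lin (x ^_) (binomial 1# a) ≈⟨ *-congˡ (binomial-eval 1# a x) ⟩
      power (v ∘ inject₁) β * x * (x + 1#) ^ a ≈⟨ solve 3 (λ p x y → p :* x :* y := x :* (y :* p)) refl _ x _ ⟩
      x * ((x + 1#) ^ a * power (v ∘ inject₁) β) ∎

  -- The rotated entry grows by one, so its sign-changed coordinate falls by one; the argument x_n +
  -- 1 of the operator undoes this and recovers the point of `γ`.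
  eval-rotation-pt : ∀ {n} p (γ : Vec ℕ (suc n)) →
    eval (extend rotation p) (pt (rotate γ)) ≈ pt (rotate γ) (fromℕ n) * eval p (pt γ)
  eval-rotation-pt {n} p γ = trans (eval-rotation p (pt (rotate γ))) (*-congˡ (eval-cong p λ
    { zero → trans (+-congʳ (pt-rotate-fromℕ γ)) (solve 1 (λ x → x :- :1 :+ :1 := x) refl _)
    ; (suc i) → reflexive (pt-rotate-inject₁ γ i) }))

  eval-rotation-pt0 : ∀ {n} p (γ : Vec ℕ n) → eval (extend rotation p) (pt (γ ∷ʳ 0)) ≈ 0#
  eval-rotation-pt0 p γ = trans (eval-rotation p (pt (γ ∷ʳ 0))) (trans (*-congʳ (pt-∷ʳ0-fromℕ γ)) (zeroˡ _))

  -- If `γ` ends in zero, the factor x_n of the operator vanishes at its point. Otherwise `γ` is a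
  -- rotation of a composition smaller by one, where `q` vanishes.
  Bar-rotate : ∀ {n} {ζ : Vec ℕ (suc n)} {q} → Bar ζ q → Bar (rotate ζ) (extend rotation q)
  Bar-rotate {n} {ζ} {q} b = record
    { leading = extend-leading rotate rotation rotation-lead 1 size-rotate {q = q} (leading b)
    ; vanishes = van }
    where
    van : Vanishes (size (rotate ζ)) (extend rotation q)
    van γ lt with initLast γ
    ... | β , zero , ≡.refl = eval-rotation-pt0 q β
    ... | β , suc a , ≡.refl = trans (eval-rotation-pt q (a ∷ β)) (trans (*-congˡ (vanishes b (a ∷ β)
      (ℕ.≤-pred (≡.subst₂ _<_ (size-∷ʳ β (suc a)) (size-rotate ζ) lt)))) (zeroʳ _))

  -- A degenerate Demazure-Lusztig operator: the divided difference lowers the degree, so the top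
  -- part is the plain swap.
  demazure : ∀ {n} → Fin n → Vec ℕ (suc n) → MPoly (suc n)
  demazure i β = single (swap i β) ++ scale (- r) (∂ i β)

  lin-demazure : ∀ {n} (i : Fin n) β φ → lin φ (demazure i β) ≈ φ (swap i β) - r * lin φ (∂ i β)
  lin-demazure i β φ = trans (lin-++ φ (single (swap i β)) (scale (- r) (∂ i β))) (+-cong (lin-single φ (swap i β))
    (trans (lin-scale φ (- r) (∂ i β)) (solve 2 (λ r x → (:- r) :* x := :- (r :* x)) refl r _)))

  demazure-lead : ∀ {n} (i : Fin n) → HasLead (swap i) (demazure i)
  demazure-lead i β φ z = begin
    lin φ (demazure i β) ≈⟨ lin-demazure i β φ ⟩
    φ (swap i β) - r * lin φ (∂ i β) ≈⟨ +-congˡ (-‿cong (*-congˡ (∂-vanish i β φ λ γ lt → z γ (≡.subst (size γ <_) (≡.sym (size-swap i β)) lt)))) ⟩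
    φ (swap i β) - r * 0# ≈⟨ solve 2 (λ x r → x :- r :* :0 := x) refl _ r ⟩
    φ (swap i β) ∎

  -- Multiplying by the difference of coordinates clears the denominator of ∂, and only the values
  -- at `v` and at its transposition remain.
  eval-demazure : ∀ {n} (i : Fin n) p v →
    (v (inject₁ i) - v (suc i)) * eval (extend (demazure i) p) v
      ≈ (v (inject₁ i) - v (suc i) + r) * eval p (v ∘ τ i) - r * eval p v
  eval-demazure i p v = begin
    d * eval (extend (demazure i) p) v ≈⟨ *-congˡ (lin-extend (power v) (demazure i) p) ⟩
    d * lin (λ β → lin (power v) (demazure i β)) p ≈⟨ lin-* d _ p ⟨
    lin (λ β → d * lin (power v) (demazure i β)) p ≈⟨ lin-cong pointwise p ⟩
    lin (λ β → (d + r) * power (v ∘ τ i) β - r * power v β) p ≈⟨ lin-minus _ _ p ⟩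
    lin (λ β → (d + r) * power (v ∘ τ i) β) p - lin (λ β → r * power v β) p ≈⟨ +-cong (lin-* (d + r) _ p) (-‿cong (lin-* r _ p)) ⟩
    (d + r) * eval p (v ∘ τ i) - r * eval p v ∎
    where
    d : Carrier
    d = v (inject₁ i) - v (suc i)
    pointwise : ∀ β → d * lin (power v) (demazure i β) ≈ (d + r) * power (v ∘ τ i) β - r * power v β
    pointwise β = begin
      d * lin (power v) (demazure i β) ≈⟨ *-congˡ (lin-demazure i β (power v)) ⟩
      d * (power v (swap i β) - r * lin (power v) (∂ i β)) ≈⟨ solve 4 (λ d x r y → d :* (x :- r :* y) := d :* x :- r :* (d :* y)) refl d _ r _ ⟩
      d * power v (swap i β) - r * (d * lin (power v) (∂ i β)) ≈⟨ +-congˡ (-‿cong (*-congˡ (power-∂ i β v))) ⟩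
      d * power v (swap i β) - r * (power v β - power v (swap i β)) ≈⟨ solve 4 (λ d x r y → d :* x :- r :* (y :- x) := (d :+ r) :* x :- r :* y) refl d _ r _ ⟩
      (d + r) * power v (swap i β) - r * power v β ≈⟨ +-congʳ (*-congˡ (power-swap i v β)) ⟨
      (d + r) * power (v ∘ τ i) β - r * power v β ∎

  -- For unequal neighbours the transposed point is the point of `swap i γ`. For equal ones it is
  -- not, but its weight is zero.
  eval-demazure-pt : ∀ {n} (i : Fin n) p (γ : Vec ℕ (suc n)) →
    gap i γ * eval (extend (demazure i) p) (pt γ) ≈ (gap i γ + r) * eval p (pt (swap i γ)) - r * eval p (pt γ)
  eval-demazure-pt i p γ with lookup γ (inject₁ i) ℕ.≟ lookup γ (suc i)
  ... | no γᵢ≢ = trans (eval-demazure i p (pt γ)) (+-congʳ (*-congˡ (eval-cong p λ j → sym (reflexive (pt-swap i γ γᵢ≢ j)))))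
  ... | yes γᵢ≡ = trans (eval-demazure i p (pt γ)) (+-congʳ (trans (gap-equal-* i γ γᵢ≡ _) (sym (gap-equal-* i γ γᵢ≡ _))))

  -- A value at `γ` is a combination of values of `q` at `γ` and `swap i γ`, which have the same
  -- size; the nonzero gap is divided out.
  Bar-swap : ∀ {n} (i : Fin n) {ζ : Vec ℕ (suc n)} {q} → Bar ζ q → Bar (swap i ζ) (extend (demazure i) q)
  Bar-swap i {ζ} {q} b = record
    { leading = extend-leading (swap i) (demazure i) (demazure-lead i) 0 (size-swap i) {q = q} (leading b)
    ; vanishes = λ γ lt → let lt′ = ≡.subst (size γ <_) (size-swap i ζ) lt in cancel (gap≉0 i γ) (trans (eval-demazure-pt i q γ)
        (trans (+-cong (*-congˡ (vanishes b (swap i γ) (≡.subst (_< size ζ) (≡.sym (size-swap i γ)) lt′))) (-‿cong (*-congˡ (vanishes b γ lt′))))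
               (solve 2 (λ d r → (d :+ r) :* :0 :- r :* :0 := :0) refl _ r))) }

  Bar-0 : ∀ {N} → Bar (replicate N 0) (single (replicate N 0))
  Bar-0 {N} = record
    { leading = λ β _ → lin-single (δ β) (replicate N 0)
    ; vanishes = λ γ lt → contradiction (≡.subst (size γ <_) (size-replicate0 N) lt) ℕ.n≮0 }

  abstract
    -- Different chains of moves lead to the same `ζ`; by `Bar-unique` the choice is irrelevant, so
    -- the witness is kept from unfolding.
    Bar-exists : ∀ {n} (ζ : Vec ℕ (suc n)) → Σ (MPoly (suc n)) (Bar ζ)
    Bar-exists = composition-induction _ (_ , Bar-0) (λ i _ (q , b) → _ , Bar-swap i b) (λ _ (q , b) → _ , Bar-rotate b)

-- Updating exponents compared with swaps and rotations.

swap-[]≔ : ∀ {n} (i : Fin n) (ζ : Vec ℕ (suc n)) k x → swap i (ζ [ k ]≔ x) ≡ swap i ζ [ τ i k ]≔ x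
swap-[]≔ zero (a ∷ b ∷ ζ) zero x = ≡.refl
swap-[]≔ zero (a ∷ b ∷ ζ) (suc zero) x = ≡.refl
swap-[]≔ zero (a ∷ b ∷ ζ) (suc (suc k)) x = ≡.refl
swap-[]≔ (suc i) (a ∷ ζ) zero x = ≡.refl
swap-[]≔ (suc i) (a ∷ ζ) (suc k) x = ≡.cong (a ∷_) (swap-[]≔ i ζ k x)

∷ʳ-[]≔-inject₁ : ∀ {n} (ζ : Vec ℕ n) a k x → (ζ [ k ]≔ x) ∷ʳ a ≡ (ζ ∷ʳ a) [ inject₁ k ]≔ x
∷ʳ-[]≔-inject₁ (b ∷ ζ) a zero x = ≡.refl
∷ʳ-[]≔-inject₁ (b ∷ ζ) a (suc k) x = ≡.cong (b ∷_) (∷ʳ-[]≔-inject₁ ζ a k x)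

∷ʳ-[]≔-fromℕ : ∀ {n} (ζ : Vec ℕ n) a x → ζ ∷ʳ x ≡ (ζ ∷ʳ a) [ fromℕ n ]≔ x
∷ʳ-[]≔-fromℕ [] a x = ≡.refl
∷ʳ-[]≔-fromℕ (b ∷ ζ) a x = ≡.cong (b ∷_) (∷ʳ-[]≔-fromℕ ζ a x)

rotate-[]≔-suc : ∀ {n} (ζ : Vec ℕ (suc n)) k x → rotate (ζ [ suc k ]≔ x) ≡ rotate ζ [ inject₁ k ]≔ x
rotate-[]≔-suc (a ∷ ζ) k x = ∷ʳ-[]≔-inject₁ ζ (suc a) k x

rotate-[]≔-zero : ∀ {n} (ζ : Vec ℕ (suc n)) x → rotate (ζ [ zero ]≔ x) ≡ rotate ζ [ fromℕ n ]≔ suc x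
rotate-[]≔-zero (a ∷ ζ) x = ∷ʳ-[]≔-fromℕ ζ (suc a) (suc x)

lookup-rotate-inject₁ : ∀ {n} (ζ : Vec ℕ (suc n)) k → lookup (rotate ζ) (inject₁ k) ≡ lookup ζ (suc k)
lookup-rotate-inject₁ (a ∷ ζ) k = lookup-∷ʳ-inject₁ ζ (suc a) k

lookup-rotate-fromℕ : ∀ {n} (ζ : Vec ℕ (suc n)) → lookup (rotate ζ) (fromℕ n) ≡ suc (lookup ζ zero)
lookup-rotate-fromℕ (a ∷ ζ) = lookup-∷ʳ-fromℕ ζ (suc a)

-- the exponent of x_k times the monomial ζ
bump : ∀ {N} → Fin N → Vec ℕ N → Vec ℕ N
bump k ζ = ζ [ k ]≔ suc (lookup ζ k)

swap-bump : ∀ {n} (i : Fin n) (ζ : Vec ℕ (suc n)) k → bump k (swap i ζ) ≡ swap i (bump (τ i k) ζ)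
swap-bump i ζ k = ≡.sym (≡.trans (swap-[]≔ i ζ (τ i k) _) (≡.cong₂ (λ j a → swap i ζ [ j ]≔ suc a) (τ-involutive i k) (≡.sym (lookup-swap i ζ k))))

rotate-bump-inject₁ : ∀ {n} (ζ : Vec ℕ (suc n)) k → bump (inject₁ k) (rotate ζ) ≡ rotate (bump (suc k) ζ)
rotate-bump-inject₁ ζ k = ≡.sym (≡.trans (rotate-[]≔-suc ζ k _) (≡.cong (λ a → rotate ζ [ inject₁ k ]≔ suc a) (≡.sym (lookup-rotate-inject₁ ζ k))))

rotate-bump-fromℕ : ∀ {n} (ζ : Vec ℕ (suc n)) → bump (fromℕ n) (rotate ζ) ≡ rotate (bump zero ζ)
rotate-bump-fromℕ {n} ζ = ≡.sym (≡.trans (rotate-[]≔-zero ζ _) (≡.cong (λ a → rotate ζ [ fromℕ n ]≔ suc a) (≡.sym (lookup-rotate-fromℕ ζ))))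

put : ∀ {N} → Fin N → Fin N → ℕ → ℕ → Vec ℕ N → Vec ℕ N
put k j p q ζ = (ζ [ k ]≔ p) [ j ]≔ q

swap-put : ∀ {n} (i : Fin n) k j p q (ζ : Vec ℕ (suc n)) → put k (τ i j) p q (swap i ζ) ≡ swap i (put (τ i k) j p q ζ)
swap-put i k j p q ζ = ≡.sym (≡.trans (swap-[]≔ i (ζ [ τ i k ]≔ p) j q) (≡.cong (_[ τ i j ]≔ q)
  (≡.trans (swap-[]≔ i ζ (τ i k) p) (≡.cong (λ k → swap i ζ [ k ]≔ p) (τ-involutive i k)))))

rotate-put-suc-suc : ∀ {n} k j p q (ζ : Vec ℕ (suc n)) → put (inject₁ k) (inject₁ j) p q (rotate ζ) ≡ rotate (put (suc k) (suc j) p q ζ)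
rotate-put-suc-suc k j p q ζ = ≡.sym (≡.trans (rotate-[]≔-suc (ζ [ suc k ]≔ p) j q) (≡.cong (_[ inject₁ j ]≔ q) (rotate-[]≔-suc ζ k p)))

rotate-put-suc-zero : ∀ {n} k p q (ζ : Vec ℕ (suc n)) → put (inject₁ k) (fromℕ n) p (suc q) (rotate ζ) ≡ rotate (put (suc k) zero p q ζ)
rotate-put-suc-zero {n} k p q ζ = ≡.sym (≡.trans (rotate-[]≔-zero (ζ [ suc k ]≔ p) q) (≡.cong (_[ fromℕ n ]≔ suc q) (rotate-[]≔-suc ζ k p)))

rotate-put-zero-suc : ∀ {n} j p q (ζ : Vec ℕ (suc n)) → put (fromℕ n) (inject₁ j) (suc p) q (rotate ζ) ≡ rotate (put zero (suc j) p q ζ)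
rotate-put-zero-suc j p q ζ = ≡.sym (≡.trans (rotate-[]≔-suc (ζ [ zero ]≔ p) j q) (≡.cong (_[ inject₁ j ]≔ q) (rotate-[]≔-zero ζ p)))

put-swap : ∀ {n} (i : Fin n) (ζ : Vec ℕ (suc n)) → put (inject₁ i) (suc i) (lookup ζ (inject₁ i)) (lookup ζ (suc i)) (swap i ζ) ≡ ζ
put-swap zero (a ∷ b ∷ ζ) = ≡.refl
put-swap (suc i) (a ∷ ζ) = ≡.cong (a ∷_) (put-swap i ζ)

put-swap′ : ∀ {n} (i : Fin n) (ζ : Vec ℕ (suc n)) → put (suc i) (inject₁ i) (lookup ζ (suc i)) (lookup ζ (inject₁ i)) (swap i ζ) ≡ ζ
put-swap′ zero (a ∷ b ∷ ζ) = ≡.refl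
put-swap′ (suc i) (a ∷ ζ) = ≡.cong (a ∷_) (put-swap′ i ζ)

-- The Cherednik operators and the relation for multiplication by x_k.

module Cherednik (F : ParameterField) where

  open ParameterField F
  open Polynomials K
  open Interpolation F
  open IntegerSolver K
  open import Algebra.Properties.Semiring.Sum semiring using (sum; sum-cong-≋; sum-permute; ∑-distrib-+; *-distribˡ-sum; sum-init-last; sum-replicate-zero)
  open import Relation.Binary.Reasoning.Setoid setoid

  -- x ∂(f) and ∂(x f) differ by the swapped f
  divided-suc : ∀ a b g → lin g (divided (suc a) b) ≈ g (b , a) + lin (g ∘ map₁ suc) (divided a b)
  divided-suc a zero g = +-cong (*-identityˡ _) (reflexive (lin-relabel g (map₁ suc) (divided a zero)))
  divided-suc zero (suc b) g = begin
    lin g (relabel _ (divided zero b))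
      ≡⟨ lin-relabel g _ (divided zero b) ⟩
    lin (λ (p , q) → g (suc p , suc q)) (divided zero b)
      ≈⟨ solve 2 (λ x y → x := y :+ ((:- :1) :* y :+ x)) refl _ (g (suc b , 0)) ⟩
    g (suc b , 0) + (- 1# * g (suc b , 0) + lin (λ (p , q) → g (suc p , suc q)) (divided zero b))
      ≈⟨ +-congˡ (+-congˡ (reflexive (lin-relabel (g ∘ map₁ suc) (map₂ suc) (divided zero b)))) ⟨
    g (suc b , 0) + lin (g ∘ map₁ suc) (divided zero (suc b)) ∎
  divided-suc (suc a) (suc b) g = begin
    lin g (relabel _ (divided (suc a) b))
      ≡⟨ lin-relabel g _ (divided (suc a) b) ⟩
    lin (λ (p , q) → g (suc p , suc q)) (divided (suc a) b)
      ≈⟨ divided-suc a b _ ⟩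
    g (suc b , suc a) + lin (λ (p , q) → g (suc (suc p) , suc q)) (divided a b)
      ≈⟨ +-congˡ (reflexive (lin-relabel (g ∘ map₁ suc) _ (divided a b))) ⟨
    g (suc b , suc a) + lin (g ∘ map₁ suc) (divided (suc a) (suc b)) ∎

  module _ {N : ℕ} where

    -- The names refer to the position of row j relative to row k. For j before k the term is x_k
    -- ∂_{kj}, whence `suc p` on the quotient; for j after k it is ∂_{kj} x_k, whence `suc` on the
    -- exponent being divided.
    before after : (Vec ℕ N → Carrier) → Fin N → Fin N → Vec ℕ N → Carrier
    before X k j ζ = lin (λ (p , q) → X (put k j (suc p) q ζ)) (divided (lookup ζ k) (lookup ζ j))
    after X k j ζ = lin (λ (p , q) → X (put k j p q ζ)) (divided (suc (lookup ζ k)) (lookup ζ j))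

    -- Taking the two comparisons as Booleans separates the effect on exponents from the question of
    -- how the order of the rows changes.
    branch : Bool → Bool → (Vec ℕ N → Carrier) → Fin N → Fin N → Vec ℕ N → Carrier
    branch true _ = before
    branch false true = after
    branch false false = λ _ _ _ _ → 0#

    pair : (Vec ℕ N → Carrier) → Fin N → Fin N → Vec ℕ N → Carrier
    pair X k j = branch (toℕ j <ᵇ toℕ k) (toℕ k <ᵇ toℕ j) X k j

    -- The Cherednik operator x_k d/dx_k + r Σ_{j<k} x_k ∂_{kj} + r Σ_{j>k} ∂_{kj} x_k
    -- on monomials, composed with the linear form X.
    cherednik : Fin N → (Vec ℕ N → Carrier) → Vec ℕ N → Carrier
    cherednik k X ζ = ι (lookup ζ k) * X ζ + r * sum (λ j → pair X k j ζ)

    branch-cong : ∀ b b′ {X X′} k j ζ → (∀ ζ → X ζ ≈ X′ ζ) → branch b b′ X k j ζ ≈ branch b b′ X′ k j ζ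
    branch-cong true b′ k j ζ e = lin-cong (λ _ → e _) (divided (lookup ζ k) (lookup ζ j))
    branch-cong false true k j ζ e = lin-cong (λ _ → e _) (divided (suc (lookup ζ k)) (lookup ζ j))
    branch-cong false false k j ζ e = refl

    cherednik-cong : ∀ k {X X′} ζ → (∀ ζ → X ζ ≈ X′ ζ) → cherednik k X ζ ≈ cherednik k X′ ζ
    cherednik-cong k ζ e = +-cong (*-congˡ (e ζ)) (*-congˡ (sum-cong-≋ λ j → branch-cong (toℕ j <ᵇ toℕ k) (toℕ k <ᵇ toℕ j) k j ζ e))

    lin-linear : ∀ {I : Set} a b (φ ψ : I → Carrier) p → lin (λ i → a * φ i + b * ψ i) p ≈ a * lin φ p + b * lin ψ p
    lin-linear a b φ ψ p = trans (lin-+ _ _ p) (+-cong (lin-* a φ p) (lin-* b ψ p))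

    branch-linear : ∀ c c′ a b X X′ k j ζ → branch c c′ (λ ζ → a * X ζ + b * X′ ζ) k j ζ ≈ a * branch c c′ X k j ζ + b * branch c c′ X′ k j ζ
    branch-linear true c′ a b X X′ k j ζ = lin-linear a b _ _ (divided (lookup ζ k) (lookup ζ j))
    branch-linear false true a b X X′ k j ζ = lin-linear a b _ _ (divided (suc (lookup ζ k)) (lookup ζ j))
    branch-linear false false a b X X′ k j ζ = solve 2 (λ a b → :0 := a :* :0 :+ b :* :0) refl a b

    -- Linearity in the form is what lets swaps act: `value-swap` combines the forms belonging to
    -- `γ` and to `swap i γ`.
    cherednik-linear : ∀ k a b X X′ ζ → cherednik k (λ ζ → a * X ζ + b * X′ ζ) ζ ≈ a * cherednik k X ζ + b * cherednik k X′ ζ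
    cherednik-linear k a b X X′ ζ = begin
      i * (a * X ζ + b * X′ ζ) + r * sum (λ j → pair (λ ζ → a * X ζ + b * X′ ζ) k j ζ)
        ≈⟨ +-congˡ (*-congˡ (trans (sum-cong-≋ λ j → branch-linear (toℕ j <ᵇ toℕ k) (toℕ k <ᵇ toℕ j) a b X X′ k j ζ)
             (trans (∑-distrib-+ (λ j → a * pair X k j ζ) (λ j → b * pair X′ k j ζ))
                    (sym (+-cong (*-distribˡ-sum a (λ j → pair X k j ζ)) (*-distribˡ-sum b (λ j → pair X′ k j ζ))))))) ⟩
      i * (a * X ζ + b * X′ ζ) + r * (a * sum (λ j → pair X k j ζ) + b * sum (λ j → pair X′ k j ζ))
        ≈⟨ solve 8 (λ i a b r x x′ s s′ → i :* (a :* x :+ b :* x′) :+ r :* (a :* s :+ b :* s′) := a :* (i :* x :+ r :* s) :+ b :* (i :* x′ :+ r :* s′)) refl i a b r (X ζ) (X′ ζ) _ _ ⟩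
      a * cherednik k X ζ + b * cherednik k X′ ζ ∎
      where
      i : Carrier
      i = ι (lookup ζ k)

    cherednik-scale : ∀ k a X ζ → cherednik k (λ ζ → a * X ζ) ζ ≈ a * cherednik k X ζ
    cherednik-scale k a X ζ = begin
      cherednik k (λ ζ → a * X ζ) ζ ≈⟨ cherednik-cong k ζ (λ ζ → solve 2 (λ a x → a :* x := a :* x :+ :0 :* x) refl a (X ζ)) ⟩
      cherednik k (λ ζ → a * X ζ + 0# * X ζ) ζ ≈⟨ cherednik-linear k a 0# X X ζ ⟩
      a * cherednik k X ζ + 0# * cherednik k X ζ ≈⟨ solve 2 (λ a x → a :* x :+ :0 :* x := a :* x) refl a _ ⟩
      a * cherednik k X ζ ∎

  pair-irrefl : ∀ {N} X (k : Fin N) ζ → pair X k k ζ ≡ 0#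
  pair-irrefl X k ζ rewrite <ᵇ-irrefl (toℕ k) = ≡.refl

  -- The difference of coordinates k and `τ i k`, in units of x_i - x_{i+1}. The same number governs
  -- the correction when Y_k is moved past a swap.
  sign : ∀ {n} → Fin n → Fin (suc n) → Carrier
  sign zero zero = 1#
  sign zero (suc zero) = - 1#
  sign zero (suc (suc k)) = 0#
  sign (suc i) zero = 0#
  sign (suc i) (suc k) = sign i k

  sign-difference : ∀ {n} (i : Fin n) k (v : Point (suc n)) → v k - v (τ i k) ≈ sign i k * (v (inject₁ i) - v (suc i))
  sign-difference zero zero v = sym (*-identityˡ _)
  sign-difference zero (suc zero) v = solve 2 (λ x y → y :- x := (:- :1) :* (x :- y)) refl _ _
  sign-difference zero (suc (suc k)) v = trans (-‿inverseʳ _) (sym (zeroˡ _))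
  sign-difference (suc i) zero v = trans (-‿inverseʳ _) (sym (zeroˡ _))
  sign-difference (suc i) (suc k) v = sign-difference i k (v ∘ suc)

  data SwapView {n} (i : Fin n) : Fin (suc n) → Set where
    left : SwapView i (inject₁ i)
    right : SwapView i (suc i)
    fixed : ∀ {k} → τ i k ≡ k → sign i k ≡ 0# → SwapView i k

  swapView : ∀ {n} (i : Fin n) k → SwapView i k
  swapView zero zero = left
  swapView zero (suc zero) = right
  swapView zero (suc (suc k)) = fixed ≡.refl ≡.refl
  swapView (suc i) zero = fixed ≡.refl ≡.refl
  swapView (suc i) (suc k) with swapView i k
  ... | left = left
  ... | right = right
  ... | fixed e f = fixed (≡.cong suc e) f

  sign-left : ∀ {n} (i : Fin n) → sign i (inject₁ i) ≡ 1#
  sign-left zero = ≡.refl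
  sign-left (suc i) = sign-left i

  sign-right : ∀ {n} (i : Fin n) → sign i (suc i) ≡ - 1#
  sign-right zero = ≡.refl
  sign-right (suc i) = sign-right i

  branch-swap : ∀ {n} b b′ (i : Fin n) X k j ζ → branch b b′ X k (τ i j) (swap i ζ) ≈ branch b b′ (X ∘ swap i) (τ i k) j ζ
  branch-swap true b′ i X k j ζ rewrite lookup-swap i ζ k | lookup-swap i ζ (τ i j) | τ-involutive i j =
    lin-cong (λ (p , q) → reflexive (≡.cong X (swap-put i k j (suc p) q ζ))) (divided (lookup ζ (τ i k)) (lookup ζ j))
  branch-swap false true i X k j ζ rewrite lookup-swap i ζ k | lookup-swap i ζ (τ i j) | τ-involutive i j =
    lin-cong (λ (p , q) → reflexive (≡.cong X (swap-put i k j p q ζ))) (divided (suc (lookup ζ (τ i k))) (lookup ζ j))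
  branch-swap false false i X k j ζ = refl

  -- `τ i` reverses the order of its two neighbours only; for the rows j and `τ i k` to be these
  -- would force j = k.
  pair-swap-≢ : ∀ {n} (i : Fin n) X k j ζ → j ≢ k → pair X k (τ i j) (swap i ζ) ≈ pair (X ∘ swap i) (τ i k) j ζ
  pair-swap-≢ i X k j ζ j≢k = trans (branch-swap (toℕ (τ i j) <ᵇ toℕ k) (toℕ k <ᵇ toℕ (τ i j)) i X k j ζ)
    (reflexive (≡.cong₂ (λ b b′ → branch b b′ (X ∘ swap i) (τ i k) j ζ) e e′))
    where
    e : (toℕ (τ i j) <ᵇ toℕ k) ≡ (toℕ j <ᵇ toℕ (τ i k))
    e with τ-monotone i j (τ i k)
    ... | inj₁ e = ≡.trans (≡.cong (λ k → toℕ (τ i j) <ᵇ toℕ k) (≡.sym (τ-involutive i k))) e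
    ... | inj₂ (inj₁ (f , g)) = contradiction (≡.trans f (≡.trans (≡.sym (τ-suc i)) (≡.trans (≡.cong (τ i) (≡.sym g)) (τ-involutive i k)))) j≢k
    ... | inj₂ (inj₂ (f , g)) = contradiction (≡.trans f (≡.trans (≡.sym (τ-inject₁ i)) (≡.trans (≡.cong (τ i) (≡.sym g)) (τ-involutive i k)))) j≢k
    e′ : (toℕ k <ᵇ toℕ (τ i j)) ≡ (toℕ (τ i k) <ᵇ toℕ j)
    e′ with τ-monotone i (τ i k) j
    ... | inj₁ e = ≡.trans (≡.cong (λ k → toℕ k <ᵇ toℕ (τ i j)) (≡.sym (τ-involutive i k))) e
    ... | inj₂ (inj₁ (g , f)) = contradiction (≡.trans f (≡.trans (≡.sym (τ-inject₁ i)) (≡.trans (≡.cong (τ i) (≡.sym g)) (τ-involutive i k)))) j≢k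
    ... | inj₂ (inj₂ (g , f)) = contradiction (≡.trans f (≡.trans (≡.sym (τ-suc i)) (≡.trans (≡.cong (τ i) (≡.sym g)) (τ-involutive i k)))) j≢k

  inject₁<ᵇsuc : ∀ {n} (i : Fin n) → (toℕ (inject₁ i) <ᵇ toℕ (suc i)) ≡ true
  inject₁<ᵇsuc zero = ≡.refl
  inject₁<ᵇsuc (suc i) = inject₁<ᵇsuc i

  suc≮ᵇinject₁ : ∀ {n} (i : Fin n) → (toℕ (suc i) <ᵇ toℕ (inject₁ i)) ≡ false
  suc≮ᵇinject₁ zero = ≡.refl
  suc≮ᵇinject₁ (suc i) = suc≮ᵇinject₁ i

  pair-adjacent-after : ∀ {n} (i : Fin n) X ζ → pair X (inject₁ i) (suc i) ζ ≡ after X (inject₁ i) (suc i) ζ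
  pair-adjacent-after i X ζ rewrite suc≮ᵇinject₁ i | inject₁<ᵇsuc i = ≡.refl

  pair-adjacent-before : ∀ {n} (i : Fin n) X ζ → pair X (suc i) (inject₁ i) ζ ≡ before X (suc i) (inject₁ i) ζ
  pair-adjacent-before i X ζ rewrite inject₁<ᵇsuc i = ≡.refl

  after-before : ∀ {N} (X : Vec ℕ N → Carrier) k j ζ → after X k j ζ ≈ X (put k j (lookup ζ j) (lookup ζ k) ζ) + before X k j ζ
  after-before X k j ζ = divided-suc (lookup ζ k) (lookup ζ j) _

  -- The row exchanged with k changes sides, so an `after` term becomes a `before` term or
  -- conversely. By `after-before` the two differ by the swapped monomial, whose image under the
  -- swap is `ζ`.
  pair-swap-self : ∀ {n} (i : Fin n) X k ζ → pair X k (τ i k) (swap i ζ) ≈ pair (X ∘ swap i) (τ i k) k ζ + sign i k * X ζ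
  pair-swap-self i X k ζ with swapView i k
  ... | left rewrite τ-inject₁ i | sign-left i = begin
    pair X (inject₁ i) (suc i) (swap i ζ) ≡⟨ pair-adjacent-after i X (swap i ζ) ⟩
    after X (inject₁ i) (suc i) (swap i ζ) ≈⟨ after-before X (inject₁ i) (suc i) (swap i ζ) ⟩
    X (put (inject₁ i) (suc i) (lookup (swap i ζ) (suc i)) (lookup (swap i ζ) (inject₁ i)) (swap i ζ)) + before X (inject₁ i) (suc i) (swap i ζ)
      ≈⟨ +-cong (reflexive (≡.cong X (≡.trans (≡.cong₂ (λ a b → put (inject₁ i) (suc i) a b (swap i ζ))
                    (≡.trans (lookup-swap i ζ (suc i)) (≡.cong (lookup ζ) (τ-suc i)))
                    (≡.trans (lookup-swap i ζ (inject₁ i)) (≡.cong (lookup ζ) (τ-inject₁ i)))) (put-swap i ζ))))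
                (trans (reflexive (≡.cong (λ j → before X (inject₁ i) j (swap i ζ)) (≡.sym (τ-inject₁ i))))
                (trans (branch-swap true true i X (inject₁ i) (inject₁ i) ζ)
                       (reflexive (≡.trans (≡.cong (λ k → before (X ∘ swap i) k (inject₁ i) ζ) (τ-inject₁ i)) (≡.sym (pair-adjacent-before i (X ∘ swap i) ζ)))))) ⟩
    X ζ + pair (X ∘ swap i) (suc i) (inject₁ i) ζ ≈⟨ solve 2 (λ x y → x :+ y := y :+ :1 :* x) refl _ _ ⟩
    pair (X ∘ swap i) (suc i) (inject₁ i) ζ + 1# * X ζ ∎
  ... | right rewrite τ-suc i | sign-right i = begin
    pair X (suc i) (inject₁ i) (swap i ζ) ≡⟨ pair-adjacent-before i X (swap i ζ) ⟩
    before X (suc i) (inject₁ i) (swap i ζ) ≈⟨ solve 2 (λ x y → x := (y :+ x) :+ (:- :1) :* y) refl _ (X ζ) ⟩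
    (X ζ + before X (suc i) (inject₁ i) (swap i ζ)) + - 1# * X ζ
      ≈⟨ +-congʳ (+-congʳ (reflexive (≡.cong X (≡.trans (≡.cong₂ (λ a b → put (suc i) (inject₁ i) a b (swap i ζ))
                    (≡.trans (lookup-swap i ζ (inject₁ i)) (≡.cong (lookup ζ) (τ-inject₁ i)))
                    (≡.trans (lookup-swap i ζ (suc i)) (≡.cong (lookup ζ) (τ-suc i)))) (put-swap′ i ζ))))) ⟨
    (X (put (suc i) (inject₁ i) (lookup (swap i ζ) (inject₁ i)) (lookup (swap i ζ) (suc i)) (swap i ζ)) + before X (suc i) (inject₁ i) (swap i ζ)) + - 1# * X ζ
      ≈⟨ +-congʳ (after-before X (suc i) (inject₁ i) (swap i ζ)) ⟨
    after X (suc i) (inject₁ i) (swap i ζ) + - 1# * X ζ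
      ≈⟨ +-congʳ (trans (reflexive (≡.cong (λ j → after X (suc i) j (swap i ζ)) (≡.sym (τ-suc i))))
                (trans (branch-swap false true i X (suc i) (suc i) ζ)
                       (reflexive (≡.trans (≡.cong (λ k → after (X ∘ swap i) k (suc i) ζ) (τ-suc i)) (≡.sym (pair-adjacent-after i (X ∘ swap i) ζ)))))) ⟩
    pair (X ∘ swap i) (inject₁ i) (suc i) ζ + - 1# * X ζ ∎
  ... | fixed e f rewrite e | f = begin
    pair X k k (swap i ζ) ≡⟨ pair-irrefl X k (swap i ζ) ⟩
    0# ≈⟨ solve 1 (λ x → :0 := :0 :+ :0 :* x) refl (X ζ) ⟩
    0# + 0# * X ζ ≡⟨ ≡.cong (_+ 0# * X ζ) (pair-irrefl (X ∘ swap i) k ζ) ⟨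
    pair (X ∘ swap i) k k ζ + 0# * X ζ ∎

  kronecker : ∀ {N} → Fin N → Carrier → Fin N → Carrier
  kronecker zero c zero = c
  kronecker zero c (suc j) = 0#
  kronecker (suc k) c zero = 0#
  kronecker (suc k) c (suc j) = kronecker k c j

  kronecker-refl : ∀ {N} (k : Fin N) c → kronecker k c k ≡ c
  kronecker-refl zero c = ≡.refl
  kronecker-refl (suc k) c = kronecker-refl k c

  kronecker-≢ : ∀ {N} (k j : Fin N) c → j ≢ k → kronecker k c j ≡ 0#
  kronecker-≢ zero zero c j≢k = contradiction ≡.refl j≢k
  kronecker-≢ zero (suc j) c j≢k = ≡.refl
  kronecker-≢ (suc k) zero c j≢k = ≡.refl
  kronecker-≢ (suc k) (suc j) c j≢k = kronecker-≢ k j c (j≢k ∘ ≡.cong suc)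

  sum-kronecker : ∀ {N} (k : Fin N) c → sum (kronecker k c) ≈ c
  sum-kronecker {suc N} zero c = trans (+-congˡ (sum-replicate-zero N)) (+-identityʳ c)
  sum-kronecker (suc k) c = trans (+-identityˡ _) (sum-kronecker k c)

  -- The degenerate affine Hecke relation between Y_k and a transposition; only the row exchanged
  -- with k leaves a correction.
  cherednik-swap : ∀ {n} (i : Fin n) X k ζ → cherednik k X (swap i ζ) ≈ cherednik (τ i k) (X ∘ swap i) ζ + r * (sign i k * X ζ)
  cherednik-swap i X k ζ = begin
    ι (lookup (swap i ζ) k) * X (swap i ζ) + r * sum (λ j → pair X k j (swap i ζ))
      ≈⟨ +-cong (*-congʳ (reflexive (≡.cong ι (lookup-swap i ζ k)))) (*-congˡ (trans (sum-permute (λ j → pair X k j (swap i ζ)) (τ-permutation i)) (trans (sum-cong-≋ termwise)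
           (trans (∑-distrib-+ (λ j → pair (X ∘ swap i) (τ i k) j ζ) (kronecker k (sign i k * X ζ))) (+-congˡ (sum-kronecker k _)))))) ⟩
    ι (lookup ζ (τ i k)) * X (swap i ζ) + r * (sum (λ j → pair (X ∘ swap i) (τ i k) j ζ) + sign i k * X ζ)
      ≈⟨ solve 4 (λ x r s y → x :+ r :* (s :+ y) := (x :+ r :* s) :+ r :* y) refl _ r _ _ ⟩
    cherednik (τ i k) (X ∘ swap i) ζ + r * (sign i k * X ζ) ∎
    where
    termwise : ∀ j → pair X k (τ i j) (swap i ζ) ≈ pair (X ∘ swap i) (τ i k) j ζ + kronecker k (sign i k * X ζ) j
    termwise j with j Fin.≟ k
    ... | yes ≡.refl = trans (pair-swap-self i X j ζ) (+-congˡ (reflexive (≡.sym (kronecker-refl j _))))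
    ... | no j≢k = trans (pair-swap-≢ i X k j ζ j≢k) (trans (sym (+-identityʳ _)) (+-congˡ (reflexive (≡.sym (kronecker-≢ k j _ j≢k)))))

  pair-rotate-inject₁-inject₁ : ∀ {n} X (k j : Fin n) ζ → pair X (inject₁ k) (inject₁ j) (rotate ζ) ≈ pair (X ∘ rotate) (suc k) (suc j) ζ
  pair-rotate-inject₁-inject₁ X k j ζ rewrite Fin.toℕ-inject₁ k | Fin.toℕ-inject₁ j = go (toℕ j <ᵇ toℕ k) (toℕ k <ᵇ toℕ j)
    where
    go : ∀ b b′ → branch b b′ X (inject₁ k) (inject₁ j) (rotate ζ) ≈ branch b b′ (X ∘ rotate) (suc k) (suc j) ζ
    go true b′ rewrite lookup-rotate-inject₁ ζ k | lookup-rotate-inject₁ ζ j =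
      lin-cong (λ (p , q) → reflexive (≡.cong X (rotate-put-suc-suc k j (suc p) q ζ))) (divided (lookup ζ (suc k)) (lookup ζ (suc j)))
    go false true rewrite lookup-rotate-inject₁ ζ k | lookup-rotate-inject₁ ζ j =
      lin-cong (λ (p , q) → reflexive (≡.cong X (rotate-put-suc-suc k j p q ζ))) (divided (suc (lookup ζ (suc k))) (lookup ζ (suc j)))
    go false false = refl

  -- Row zero moves from before row k to after it. `after` raises the exponent of k and rotation
  -- raises that of row zero, so both arguments of `divided` grow by one; the quotient is multiplied
  -- by both variables, which matches x_k outside ∂ and the rotated exponent.
  pair-rotate-inject₁-fromℕ : ∀ {n} X (k : Fin n) ζ → pair X (inject₁ k) (fromℕ n) (rotate ζ) ≈ pair (X ∘ rotate) (suc k) zero ζ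
  pair-rotate-inject₁-fromℕ {n} X k ζ
    rewrite Fin.toℕ-inject₁ k | Fin.toℕ-fromℕ n | toℕ-<ᵇ k | toℕ-≮ᵇ k | lookup-rotate-inject₁ ζ k | lookup-rotate-fromℕ ζ =
    trans (reflexive (lin-relabel (λ (p , q) → X (put (inject₁ k) (fromℕ n) p q (rotate ζ))) _ (divided (lookup ζ (suc k)) (lookup ζ zero))))
          (lin-cong (λ (p , q) → reflexive (≡.cong X (rotate-put-suc-zero k (suc p) q ζ))) (divided (lookup ζ (suc k)) (lookup ζ zero)))

  pair-rotate-fromℕ-inject₁ : ∀ {n} X (j : Fin n) ζ → pair X (fromℕ n) (inject₁ j) (rotate ζ) ≈ pair (X ∘ rotate) zero (suc j) ζ
  pair-rotate-fromℕ-inject₁ {n} X j ζ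
    rewrite Fin.toℕ-inject₁ j | Fin.toℕ-fromℕ n | toℕ-<ᵇ j | lookup-rotate-inject₁ ζ j | lookup-rotate-fromℕ ζ =
    lin-cong (λ (p , q) → reflexive (≡.cong X (rotate-put-zero-suc j p q ζ))) (divided (suc (lookup ζ zero)) (lookup ζ (suc j)))

  cherednik-rotate-inject₁ : ∀ {n} X (k : Fin n) ζ → cherednik (inject₁ k) X (rotate ζ) ≈ cherednik (suc k) (X ∘ rotate) ζ
  cherednik-rotate-inject₁ {n} X k ζ = +-cong (*-congʳ (reflexive (≡.cong ι (lookup-rotate-inject₁ ζ k)))) (*-congˡ (begin
    sum t ≈⟨ sum-init-last t ⟩
    sum (t ∘ inject₁) + t (fromℕ n) ≈⟨ +-cong (sum-cong-≋ λ j → pair-rotate-inject₁-inject₁ X k j ζ) (pair-rotate-inject₁-fromℕ X k ζ) ⟩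
    sum (s ∘ suc) + s zero ≈⟨ +-comm _ _ ⟩
    sum s ∎))
    where
    t s : Fin (suc n) → Carrier
    t j = pair X (inject₁ k) j (rotate ζ)
    s j = pair (X ∘ rotate) (suc k) j ζ

  -- The extra term comes from x_k d/dx_k, as the rotated exponent is larger by one. In the relation
  -- it makes up for the shift of the coordinate.
  cherednik-rotate-fromℕ : ∀ {n} X ζ → cherednik (fromℕ n) X (rotate ζ) ≈ cherednik zero (X ∘ rotate) ζ + X (rotate ζ)
  cherednik-rotate-fromℕ {n} X ζ = begin
    ι (lookup (rotate ζ) (fromℕ n)) * X (rotate ζ) + r * sum t
      ≈⟨ +-cong (*-congʳ (trans (reflexive (≡.cong ι (lookup-rotate-fromℕ ζ))) (ι-suc _))) (*-congˡ (begin
           sum t ≈⟨ sum-init-last t ⟩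
           sum (t ∘ inject₁) + t (fromℕ n) ≈⟨ +-cong (sum-cong-≋ λ j → pair-rotate-fromℕ-inject₁ X j ζ) (reflexive (pair-irrefl X (fromℕ n) (rotate ζ))) ⟩
           sum (s ∘ suc) + s zero ≈⟨ +-comm _ _ ⟩
           sum s ∎)) ⟩
    (1# + ι (lookup ζ zero)) * X (rotate ζ) + r * sum s
      ≈⟨ solve 3 (λ i x y → (:1 :+ i) :* x :+ y := (i :* x :+ y) :+ x) refl _ _ _ ⟩
    cherednik zero (X ∘ rotate) ζ + X (rotate ζ) ∎
    where
    t s : Fin (suc n) → Carrier
    t j = pair X (fromℕ n) j (rotate ζ)
    s j = pair (X ∘ rotate) zero j ζ

  module _ {n : ℕ} where

    bar : Vec ℕ (suc n) → MPoly (suc n)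
    bar ζ = proj₁ (Bar-exists ζ)

    bar-Bar : ∀ ζ → Bar ζ (bar ζ)
    bar-Bar ζ = proj₂ (Bar-exists ζ)

    -- For fixed `γ` this is a linear form on monomials, to which `cherednik` applies; the relation
    -- is propagated entirely among such forms.
    value-at : Vec ℕ (suc n) → Vec ℕ (suc n) → Carrier
    value-at γ ζ = eval (bar ζ) (pt γ)

    value-unique : ∀ {ζ q} → Bar ζ q → ∀ γ → value-at γ ζ ≈ eval q (pt γ)
    value-unique {ζ} {q} b γ = lin-cong-≈ (power (pt γ)) (bar ζ) q (Bar-unique (bar-Bar ζ) b)

    value-0 : ∀ γ → value-at γ (replicate (suc n) 0) ≈ 1#
    value-0 γ = trans (value-unique Bar-0 γ) (trans (lin-single (power (pt γ)) (replicate (suc n) 0)) (power-0 (pt γ)))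
      where
      power-0 : ∀ {N} (v : Point N) → power v (replicate N 0) ≈ 1#
      power-0 {zero} v = refl
      power-0 {suc N} v = trans (*-identityˡ _) (power-0 (v ∘ suc))

    value-swap : ∀ i γ ζ → gap i γ * value-at γ (swap i ζ) ≈ (gap i γ + r) * value-at (swap i γ) ζ + - r * value-at γ ζ
    value-swap i γ ζ = begin
      gap i γ * value-at γ (swap i ζ) ≈⟨ *-congˡ (value-unique (Bar-swap i (bar-Bar ζ)) γ) ⟩
      gap i γ * eval (extend (demazure i) (bar ζ)) (pt γ) ≈⟨ eval-demazure-pt i (bar ζ) γ ⟩
      (gap i γ + r) * value-at (swap i γ) ζ - r * value-at γ ζ ≈⟨ solve 3 (λ x r y → x :- r :* y := x :+ (:- r) :* y) refl _ r _ ⟩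
      (gap i γ + r) * value-at (swap i γ) ζ + - r * value-at γ ζ ∎

    value-rotate : ∀ γ ζ → value-at (rotate γ) (rotate ζ) ≈ pt (rotate γ) (fromℕ n) * value-at γ ζ
    value-rotate γ ζ = trans (value-unique (Bar-rotate (bar-Bar ζ)) (rotate γ)) (eval-rotation-pt (bar ζ) γ)

    value-rotate-0 : ∀ γ ζ → value-at (γ ∷ʳ 0) (rotate ζ) ≈ 0#
    value-rotate-0 γ ζ = trans (value-unique (Bar-rotate (bar-Bar ζ)) (γ ∷ʳ 0)) (eval-rotation-pt0 (bar ζ) γ)

    Recursion : Vec ℕ (suc n) → Fin (suc n) → Set
    Recursion ζ k = ∀ γ → value-at γ (bump k ζ) ≈ pt γ k * value-at γ ζ + cherednik k (value-at γ) ζ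

    gap-pt-swap : ∀ (i : Fin n) (γ : Vec ℕ (suc n)) k → (gap i γ + r) * pt (swap i γ) (τ i k) ≈ (gap i γ + r) * pt γ k
    gap-pt-swap i γ k with lookup γ (inject₁ i) ℕ.≟ lookup γ (suc i)
    ... | no γᵢ≢ = *-congˡ (reflexive (≡.trans (pt-swap i γ γᵢ≢ (τ i k)) (≡.cong (pt γ) (τ-involutive i k))))
    ... | yes γᵢ≡ = trans (gap-equal-* i γ γᵢ≡ _) (sym (gap-equal-* i γ γᵢ≡ _))

    -- After multiplication by the gap, `value-swap` reduces everything to `ζ`, with the hypothesis
    -- used at both `γ` and `swap i γ`. Coordinates k and `τ i k` differ by `sign i k` times the
    -- gap, which is exactly the correction in `cherednik-swap`.
    recursion-swap : ∀ i ζ k → Recursion ζ (τ i k) → Recursion (swap i ζ) k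
    recursion-swap i ζ k rec γ = cancel-≈ (gap≉0 i γ) (begin
      g * X (bump k (swap i ζ))
        ≈⟨ *-congˡ (reflexive (≡.cong X (swap-bump i ζ k))) ⟩
      g * X (swap i (bump k′ ζ))
        ≈⟨ value-swap i γ (bump k′ ζ) ⟩
      (g + r) * X′ (bump k′ ζ) + - r * X (bump k′ ζ)
        ≈⟨ +-cong (*-congˡ (rec (swap i γ))) (*-congˡ (rec γ)) ⟩
      (g + r) * (pt (swap i γ) k′ * X′ ζ + Y X′) + - r * (pt γ k′ * X ζ + Y X)
        ≈⟨ solve 8 (λ h r p x′ y′ q x y → h :* (p :* x′ :+ y′) :+ (:- r) :* (q :* x :+ y) := (h :* p) :* x′ :+ (:- r) :* (q :* x) :+ (h :* y′ :+ (:- r) :* y)) refl (g + r) r (pt (swap i γ) k′) (X′ ζ) (Y X′) (pt γ k′) (X ζ) (Y X) ⟩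
      ((g + r) * pt (swap i γ) k′) * X′ ζ + - r * (pt γ k′ * X ζ) + ((g + r) * Y X′ + - r * Y X)
        ≈⟨ +-cong (+-congʳ (*-congʳ (gap-pt-swap i γ k))) (sym (cherednik-linear k′ (g + r) (- r) X′ X ζ)) ⟩
      ((g + r) * pt γ k) * X′ ζ + - r * (pt γ k′ * X ζ) + Y (λ ζ → (g + r) * X′ ζ + - r * X ζ)
        ≈⟨ +-cong regroup (trans (cherednik-cong k′ ζ (λ ζ → sym (value-swap i γ ζ))) (cherednik-scale k′ g (X ∘ swap i) ζ)) ⟩
      (pt γ k * ((g + r) * X′ ζ + - r * X ζ) + r * ((s * g) * X ζ)) + g * Y (X ∘ swap i)
        ≈⟨ +-congʳ (+-congʳ (*-congˡ (value-swap i γ ζ))) ⟨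
      (pt γ k * (g * X (swap i ζ)) + r * ((s * g) * X ζ)) + g * Y (X ∘ swap i)
        ≈⟨ solve 7 (λ p g x r s y z → (p :* (g :* x) :+ r :* ((s :* g) :* y)) :+ g :* z := g :* (p :* x :+ (z :+ r :* (s :* y)))) refl (pt γ k) g (X (swap i ζ)) r s (X ζ) (Y (X ∘ swap i)) ⟩
      g * (pt γ k * X (swap i ζ) + (Y (X ∘ swap i) + r * (s * X ζ)))
        ≈⟨ *-congˡ (+-congˡ (cherednik-swap i X k ζ)) ⟨
      g * (pt γ k * X (swap i ζ) + cherednik k X (swap i ζ)) ∎)
      where
      g s : Carrier
      g = gap i γ
      s = sign i k
      k′ : Fin (suc n)
      k′ = τ i k
      X X′ : Vec ℕ (suc n) → Carrier
      X = value-at γ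
      X′ = value-at (swap i γ)
      Y : (Vec ℕ (suc n) → Carrier) → Carrier
      Y X = cherednik k′ X ζ
      regroup : ((g + r) * pt γ k) * X′ ζ + - r * (pt γ k′ * X ζ) ≈ pt γ k * ((g + r) * X′ ζ + - r * X ζ) + r * ((s * g) * X ζ)
      regroup = begin
        ((g + r) * pt γ k) * X′ ζ + - r * (pt γ k′ * X ζ)
          ≈⟨ solve 6 (λ h p x′ r q x → (h :* p) :* x′ :+ (:- r) :* (q :* x) := p :* (h :* x′ :+ (:- r) :* x) :+ r :* ((p :- q) :* x)) refl (g + r) (pt γ k) (X′ ζ) r (pt γ k′) (X ζ) ⟩
        pt γ k * ((g + r) * X′ ζ + - r * X ζ) + r * ((pt γ k - pt γ k′) * X ζ)
          ≈⟨ +-congˡ (*-congˡ (*-congʳ (sign-difference i k (pt γ)))) ⟩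
        pt γ k * ((g + r) * X′ ζ + - r * X ζ) + r * ((s * g) * X ζ) ∎

    -- The operators Y_k respect rotation, so all monomials that occur are rotated ones. If `γ` ends
    -- in zero they all take the value zero; otherwise each value is the common factor x_n times a
    -- value at the unrotated composition.
    recursion-rotate : ∀ ζ → (∀ k → Recursion ζ k) → ∀ k → Recursion (rotate ζ) k
    recursion-rotate ζ rec k γ with initLast γ
    ... | β , zero , ≡.refl = begin
      value-at γ (bump k (rotate ζ)) ≈⟨ vanish-bump k ⟩
      0# ≈⟨ solve 1 (λ p → :0 := p :* :0 :+ :0) refl (pt γ k) ⟩
      pt γ k * 0# + 0# ≈⟨ +-cong (*-congˡ (value-rotate-0 β ζ)) (vanish-cherednik k) ⟨
      pt γ k * value-at γ (rotate ζ) + cherednik k (value-at γ) (rotate ζ) ∎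
      where
      vanish-bump : ∀ k → value-at γ (bump k (rotate ζ)) ≈ 0#
      vanish-bump k with view k
      ... | ‵fromℕ = trans (reflexive (≡.cong (value-at γ) (rotate-bump-fromℕ ζ))) (value-rotate-0 β (bump zero ζ))
      ... | ‵inject₁ j = trans (reflexive (≡.cong (value-at γ) (rotate-bump-inject₁ ζ j))) (value-rotate-0 β (bump (suc j) ζ))
      -- The zero form is written as zero times a form, so that linearity yields the claim.
      vanish : ∀ k → cherednik k (value-at γ ∘ rotate) ζ ≈ 0#
      vanish k = trans (cherednik-cong k ζ λ ζ → trans (value-rotate-0 β ζ) (sym (zeroˡ 0#)))
                       (trans (cherednik-scale k 0# (λ _ → 0#) ζ) (zeroˡ _))
      vanish-cherednik : ∀ k → cherednik k (value-at γ) (rotate ζ) ≈ 0#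
      vanish-cherednik k with view k
      ... | ‵fromℕ = trans (cherednik-rotate-fromℕ (value-at γ) ζ) (trans (+-cong (vanish zero) (value-rotate-0 β ζ)) (+-identityˡ 0#))
      ... | ‵inject₁ j = trans (cherednik-rotate-inject₁ (value-at γ) j ζ) (vanish (suc j))
    ... | β , suc a , ≡.refl with view k
    ... | ‵fromℕ = begin
      X (bump (fromℕ n) (rotate ζ)) ≡⟨ ≡.cong X (rotate-bump-fromℕ ζ) ⟩
      X (rotate (bump zero ζ)) ≈⟨ value-rotate (a ∷ β) (bump zero ζ) ⟩
      c * X₀ (bump zero ζ) ≈⟨ *-congˡ (rec zero (a ∷ β)) ⟩
      -- `c` is one less than the coordinate of the unrotated entry; this unit supplies the extra
      -- term of `cherednik-rotate-fromℕ`.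
      c * (pt (a ∷ β) zero * X₀ ζ + cherednik zero X₀ ζ) ≈⟨ *-congˡ (+-congʳ (*-congʳ c+1)) ⟨
      c * ((c + 1#) * X₀ ζ + cherednik zero X₀ ζ) ≈⟨ solve 3 (λ c x y → c :* ((c :+ :1) :* x :+ y) := c :* (c :* x) :+ (c :* y :+ c :* x)) refl c (X₀ ζ) _ ⟩
      c * (c * X₀ ζ) + (c * cherednik zero X₀ ζ + c * X₀ ζ) ≈⟨ +-cong (*-congˡ (value-rotate (a ∷ β) ζ)) (+-cong (intertwine zero) (value-rotate (a ∷ β) ζ)) ⟨
      c * X (rotate ζ) + (cherednik zero (X ∘ rotate) ζ + X (rotate ζ)) ≈⟨ +-congˡ (cherednik-rotate-fromℕ X ζ) ⟨
      c * X (rotate ζ) + cherednik (fromℕ n) X (rotate ζ) ∎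
      where
      X X₀ : Vec ℕ (suc n) → Carrier
      X = value-at (rotate (a ∷ β))
      X₀ = value-at (a ∷ β)
      c : Carrier
      c = pt (rotate (a ∷ β)) (fromℕ n)
      c+1 : c + 1# ≈ pt (a ∷ β) zero
      c+1 = trans (+-congʳ (pt-rotate-fromℕ (a ∷ β))) (solve 1 (λ x → x :- :1 :+ :1 := x) refl _)
      intertwine : ∀ k → cherednik k (X ∘ rotate) ζ ≈ c * cherednik k X₀ ζ
      intertwine k = trans (cherednik-cong k ζ (value-rotate (a ∷ β))) (cherednik-scale k c X₀ ζ)
    ... | ‵inject₁ j = begin
      X (bump (inject₁ j) (rotate ζ)) ≡⟨ ≡.cong X (rotate-bump-inject₁ ζ j) ⟩
      X (rotate (bump (suc j) ζ)) ≈⟨ value-rotate (a ∷ β) (bump (suc j) ζ) ⟩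
      c * X₀ (bump (suc j) ζ) ≈⟨ *-congˡ (rec (suc j) (a ∷ β)) ⟩
      c * (pt (a ∷ β) (suc j) * X₀ ζ + cherednik (suc j) X₀ ζ) ≡⟨ ≡.cong (λ p → c * (p * X₀ ζ + cherednik (suc j) X₀ ζ)) (pt-rotate-inject₁ (a ∷ β) j) ⟨
      c * (p * X₀ ζ + cherednik (suc j) X₀ ζ) ≈⟨ solve 4 (λ c p x y → c :* (p :* x :+ y) := p :* (c :* x) :+ c :* y) refl c p (X₀ ζ) _ ⟩
      p * (c * X₀ ζ) + c * cherednik (suc j) X₀ ζ ≈⟨ +-cong (*-congˡ (value-rotate (a ∷ β) ζ)) (intertwine (suc j)) ⟨
      p * X (rotate ζ) + cherednik (suc j) (X ∘ rotate) ζ ≈⟨ +-congˡ (cherednik-rotate-inject₁ X j ζ) ⟨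
      p * X (rotate ζ) + cherednik (inject₁ j) X (rotate ζ) ∎
      where
      X X₀ : Vec ℕ (suc n) → Carrier
      X = value-at (rotate (a ∷ β))
      X₀ = value-at (a ∷ β)
      c p : Carrier
      c = pt (rotate (a ∷ β)) (fromℕ n)
      p = pt (rotate (a ∷ β)) (inject₁ j)
      intertwine : ∀ k → cherednik k (X ∘ rotate) ζ ≈ c * cherednik k X₀ ζ
      intertwine k = trans (cherednik-cong k ζ (value-rotate (a ∷ β))) (cherednik-scale k c X₀ ζ)

    -- Rotating the zero vector gives the unit vector of the last row, which settles that row. Swaps
    -- fix the zero vector and carry the relation from each row to the one before it.
    recursion-0 : ∀ k → Recursion (replicate (suc n) 0) k
    recursion-0 = >-weakInduction (Recursion 𝟎) last-case λ i rec →
      ≡.subst (λ ζ → Recursion ζ (inject₁ i)) (swap-0 i) (recursion-swap i 𝟎 (inject₁ i) (≡.subst (Recursion 𝟎) (≡.sym (τ-inject₁ i)) rec))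
      where
      𝟎 : Vec ℕ (suc n)
      𝟎 = replicate (suc n) 0
      swap-0 : ∀ {n} (i : Fin n) → swap i (replicate (suc n) 0) ≡ replicate (suc n) 0
      swap-0 zero = ≡.refl
      swap-0 (suc i) = ≡.cong (0 ∷_) (swap-0 i)
      rotate-0 : ∀ n → replicate n 0 ∷ʳ 1 ≡ bump (fromℕ n) (replicate (suc n) 0)
      rotate-0 zero = ≡.refl
      rotate-0 (suc n) = ≡.cong (0 ∷_) (rotate-0 n)
      -- All other rows lie before the last one, so every term divides the constant monomial and is
      -- zero. For any other row, ∂ would be applied to x_k and would contribute.
      cherednik-last : ∀ X → cherednik (fromℕ n) X 𝟎 ≈ 0#
      cherednik-last X = trans (+-cong (trans (*-congʳ (trans (reflexive (≡.cong ι (Vec.lookup-replicate (fromℕ n) 0))) ι-zero)) (zeroˡ _))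
        (trans (*-congˡ (trans (sum-cong-≋ pairs) (sum-replicate-zero (suc n)))) (zeroʳ r))) (+-identityˡ 0#)
        where
        pairs : ∀ j → pair X (fromℕ n) j 𝟎 ≈ 0#
        pairs j with view j
        ... | ‵fromℕ = reflexive (pair-irrefl X (fromℕ n) 𝟎)
        ... | ‵inject₁ i rewrite Fin.toℕ-inject₁ i | Fin.toℕ-fromℕ n | toℕ-<ᵇ i | Vec.lookup-replicate (inject₁ i) 0 | Vec.lookup-replicate (fromℕ n) 0 = refl
      last-case : Recursion 𝟎 (fromℕ n)
      last-case γ = begin
        value-at γ (bump (fromℕ n) 𝟎) ≡⟨ ≡.cong (value-at γ) (rotate-0 n) ⟨
        value-at γ (rotate 𝟎) ≈⟨ at-rotated γ ⟩
        pt γ (fromℕ n) ≈⟨ solve 1 (λ p → p := p :* :1 :+ :0) refl _ ⟩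
        pt γ (fromℕ n) * 1# + 0# ≈⟨ +-cong (*-congˡ (value-0 γ)) (cherednik-last (value-at γ)) ⟨
        pt γ (fromℕ n) * value-at γ 𝟎 + cherednik (fromℕ n) (value-at γ) 𝟎 ∎
        where
        at-rotated : ∀ γ → value-at γ (rotate 𝟎) ≈ pt γ (fromℕ n)
        at-rotated γ with initLast γ
        ... | β , zero , ≡.refl = trans (value-rotate-0 β 𝟎) (sym (pt-∷ʳ0-fromℕ β))
        ... | β , suc a , ≡.refl = trans (value-rotate (a ∷ β) 𝟎) (trans (*-congˡ (value-0 (a ∷ β))) (*-identityʳ _))

    recursion : ∀ ζ k → Recursion ζ k
    recursion = composition-induction (λ ζ → ∀ k → Recursion ζ k) recursion-0
      (λ i ζ rec k → recursion-swap i ζ k (rec (τ i k))) recursion-rotate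

-- Glissades and bar games: sizes, the critical leg and a complete enumeration.

module GameEnumeration where

  open Ranks using (indicator; countFin-sum; <ᵇ-irrefl; ≡ᵇ-refl; ≡ᵇ-≢)
  open import Data.Bool.Base using (T)
  open import Data.Nat using (_+_)
  import Data.Vec.Functional as Vector
  open import Data.List.Relation.Binary.Disjoint.Propositional using (Disjoint)
  import Data.List.Relation.Unary.AllPairs as AllPairs
  import Data.List.Relation.Unary.AllPairs.Properties as AllPairs
  import Data.List.Relation.Unary.Unique.Propositional.Properties as Unique
  open import Relation.Binary.Definitions using (tri<; tri≈; tri>)
  open import Relation.Binary.PropositionalEquality
  open import Algebra.Properties.CommutativeMonoid.Sum ℕ.+-0-commutativeMonoid

  ≡ᵇ-true⇒≡ : ∀ {a b} → (a ≡ᵇ b) ≡ true → a ≡ b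
  ≡ᵇ-true⇒≡ {a} {b} e = ℕ.≡ᵇ⇒≡ a b (subst T (sym e) _)

  maximum : ∀ {N} → Vec ℕ N → ℕ
  maximum = Vec.foldr _ _⊔_ 0

  lookup≤maximum : ∀ {N} (v : Vec ℕ N) j → lookup v j ≤ maximum v
  lookup≤maximum (a ∷ v) zero = ℕ.m≤m⊔n a _
  lookup≤maximum (a ∷ v) (suc j) = ℕ.≤-trans (lookup≤maximum v j) (ℕ.m≤n⊔m a _)

  maximum-attained : ∀ {k} (v : Vec ℕ (suc k)) → ∃[ j ] lookup v j ≡ maximum v
  maximum-attained (a ∷ []) = zero , sym (ℕ.⊔-identityʳ a)
  maximum-attained (a ∷ v@(_ ∷ _)) with ℕ.⊔-sel a (maximum v) | maximum-attained v
  ... | inj₁ e | _ = zero , sym e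
  ... | inj₂ e | j , f = suc j , trans f (sym e)

  firstIdx-true : ∀ {n k : ℕ} (P : ℕ → Bool) (v : Vec ℕ (suc k)) (j : Fin (suc k)) → P (lookup v j) ≡ true → P (lookup v (firstIdx {n} P v)) ≡ true
  firstIdx-true P (x ∷ []) zero e = e
  firstIdx-true {n} P (x ∷ y ∷ v) j e with P x in eq
  ... | true = eq
  firstIdx-true {n} P (x ∷ y ∷ v) zero e | false = contradiction (trans (sym eq) e) λ ()
  firstIdx-true {n} P (x ∷ y ∷ v) (suc j) e | false = firstIdx-true {n} P (y ∷ v) j e

  firstIdx-false : ∀ {n k : ℕ} (P : ℕ → Bool) (v : Vec ℕ (suc k)) (j : Fin (suc k)) → toℕ j < toℕ (firstIdx {n} P v) → P (lookup v j) ≡ false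
  firstIdx-false P (x ∷ []) zero ()
  firstIdx-false {n} P (x ∷ y ∷ v) j lt with P x in eq
  firstIdx-false {n} P (x ∷ y ∷ v) zero lt | false = eq
  firstIdx-false {n} P (x ∷ y ∷ v) (suc j) lt | false = firstIdx-false {n} P (y ∷ v) j (ℕ.≤-pred lt)

  size-[]≔ : ∀ {N} (v : Vec ℕ N) k x → size (v [ k ]≔ x) + lookup v k ≡ size v + x
  size-[]≔ (a ∷ v) zero x = trans (cong (_+ a) (ℕ.+-comm x (size v))) (trans (ℕ.+-assoc (size v) x a)
    (trans (cong (size v +_) (ℕ.+-comm x a)) (trans (sym (ℕ.+-assoc (size v) a x)) (cong (_+ x) (ℕ.+-comm (size v) a)))))
  size-[]≔ (a ∷ v) (suc k) x = trans (ℕ.+-assoc a _ _) (trans (cong (a +_) (size-[]≔ v k x)) (sym (ℕ.+-assoc a _ _)))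

  module _ {n : ℕ} (η : Vec ℕ (suc n)) where

    lookup-crit : lookup η (crit η) ≡ mx η
    lookup-crit with maximum-attained η
    ... | j , e = ≡ᵇ-true⇒≡ (firstIdx-true {n} (_≡ᵇ mx η) η j (trans (cong (_≡ᵇ mx η) e) (≡ᵇ-refl (mx η))))

    before-crit : ∀ j → j Fin.< crit η → lookup η j < mx η
    before-crit j lt = ℕ.≤∧≢⇒< (lookup≤maximum η j) λ e →
      contradiction (trans (sym (trans (cong (_≡ᵇ mx η) e) (≡ᵇ-refl (mx η)))) (firstIdx-false {n} (_≡ᵇ mx η) η j lt)) λ ()

    -- So x^η is x_k times x^{η*}, the shape in which the relation for x_k applies.
    bump-starOf : 0 < mx η → bump (crit η) (starOf η) ≡ η
    bump-starOf 0<m = trans (Vec.[]≔-idempotent η (crit η)) (trans (cong (η [ crit η ]≔_)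
      (trans (cong suc (Vec.lookup∘update (crit η) η (mx η ∸ 1))) (trans (ℕ.m+[n∸m]≡n 0<m) (sym lookup-crit)))) (Vec.[]≔-lookup η (crit η)))

    size-starOf : 0 < mx η → suc (size (starOf η)) ≡ size η
    size-starOf 0<m = ℕ.+-cancelʳ-≡ (mx η ∸ 1) _ _ (trans (sym (ℕ.+-suc _ (mx η ∸ 1)))
      (trans (cong (size (starOf η) +_) (trans (ℕ.m+[n∸m]≡n 0<m) (sym lookup-crit))) (size-[]≔ η (crit η) (mx η ∸ 1))))

    size-moveOf : ∀ j l → j ≢ crit η → l ≤ mx η ∸ 1 → 0 < mx η → suc (size (moveOf η j l)) ≡ size η
    size-moveOf j l j≢k l≤a 0<m = ℕ.+-cancelʳ-≡ (a ∸ l) _ _ (begin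
      suc s′ + (a ∸ l) ≡⟨ cong (λ x → suc x + (a ∸ l)) s′≡ ⟩
      suc (s₁ + l) + (a ∸ l) ≡⟨ cong suc (ℕ.+-assoc s₁ l (a ∸ l)) ⟩
      suc (s₁ + (l + (a ∸ l))) ≡⟨ cong (λ x → suc (s₁ + x)) (ℕ.m+[n∸m]≡n l≤a) ⟩
      suc (s₁ + a) ≡⟨ ℕ.+-suc s₁ a ⟨
      s₁ + suc a ≡⟨ cong (s₁ +_) (trans (ℕ.m+[n∸m]≡n 0<m) (sym lookup-crit)) ⟩
      s₁ + lookup η (crit η) ≡⟨ size-[]≔ η (crit η) (a ∸ l) ⟩
      size η + (a ∸ l) ∎)
      where
      open ≡-Reasoning
      a s₁ s′ : ℕ
      a = mx η ∸ 1
      s₁ = size (η [ crit η ]≔ (a ∸ l))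
      s′ = size (moveOf η j l)
      s′≡ : s′ ≡ s₁ + l
      s′≡ = ℕ.+-cancelʳ-≡ (lookup η j) _ _ (trans (cong (s′ +_) (sym (Vec.lookup∘update′ j≢k η (a ∸ l))))
        (trans (size-[]≔ (η [ crit η ]≔ (a ∸ l)) j (lookup η j + l))
          (trans (cong (s₁ +_) (ℕ.+-comm (lookup η j) l)) (sym (ℕ.+-assoc s₁ l (lookup η j))))))

    0<l⇒0<mx : ∀ {l} → 0 < l → l ≤ mx η ∸ 1 → 0 < mx η
    0<l⇒0<mx 0<l l≤ = ℕ.<-≤-trans 0<l (ℕ.≤-trans l≤ (ℕ.m∸n≤m (mx η) 1))

    size-glissade : ∀ {γ} → Glissade η γ → suc (size γ) ≡ size η
    size-glissade (star 0<m) = size-starOf 0<m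
    size-glissade (up j l 0<l j<k lt) = size-moveOf j l (Fin.<⇒≢ j<k) l≤ (0<l⇒0<mx 0<l l≤)
      where l≤ = ℕ.≤-trans (ℕ.m≤n+m l (lookup η j)) (ℕ.<⇒≤ lt)
    size-glissade (down j l 0<l k<j le) = size-moveOf j l (Fin.<⇒≢ k<j ∘ sym) l≤ (0<l⇒0<mx 0<l l≤)
      where l≤ = ℕ.≤-trans (ℕ.m≤n+m l (lookup η j)) le

    size>0⇒0<mx : 0 < size η → 0 < mx η
    size>0⇒0<mx 0<s with mx η in eq
    ... | suc _ = z<s
    ... | zero = contradiction (zeros η (ℕ.≤-reflexive eq)) (ℕ.<⇒≢ 0<s ∘ sym)
      where
      zeros : ∀ {N} (v : Vec ℕ N) → maximum v ≤ 0 → size v ≡ 0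
      zeros [] _ = refl
      zeros (a ∷ v) le = cong₂ _+_ (ℕ.n≤0⇒n≡0 (ℕ.≤-trans (ℕ.m≤m⊔n a _) le)) (zeros v (ℕ.≤-trans (ℕ.m≤n⊔m a _) le))

    -- A row j ≠ k counts towards n ∸ critLeg η exactly when its length leaves room below
    -- the box removed from the critical row.
    diagonal : Fin (suc n) → ℕ
    diagonal j = indicator ((toℕ j <ᵇ toℕ (crit η)) ∧ (lookup η j <ᵇ mx η ∸ 1))
               + indicator ((toℕ (crit η) <ᵇ toℕ j) ∧ (lookup η j <ᵇ mx η))

    legs : Fin (suc n) → ℕ
    legs j = indicator ((toℕ (crit η) <ᵇ toℕ j) ∧ (lookup η j ≡ᵇ mx η))
           + indicator ((toℕ j <ᵇ toℕ (crit η)) ∧ (lookup η j ≡ᵇ mx η ∸ 1))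

    critLeg-sum : critLeg η ≡ sum legs
    critLeg-sum = trans (cong₂ _+_ (countFin-sum (λ j → (toℕ (crit η) <ᵇ toℕ j) ∧ (lookup η j ≡ᵇ mx η)))
                                   (countFin-sum (λ j → (toℕ j <ᵇ toℕ (crit η)) ∧ (lookup η j ≡ᵇ mx η ∸ 1))))
                        (sym (∑-distrib-+ (λ j → indicator ((toℕ (crit η) <ᵇ toℕ j) ∧ (lookup η j ≡ᵇ mx η)))
                             (λ j → indicator ((toℕ j <ᵇ toℕ (crit η)) ∧ (lookup η j ≡ᵇ mx η ∸ 1)))))

    <ᵇ-true : ∀ {a b} → a < b → (a <ᵇ b) ≡ true
    <ᵇ-true {a} {b} lt with a <ᵇ b in eq
    ... | true = refl
    ... | false = contradiction (subst T eq (ℕ.<⇒<ᵇ lt)) λ ()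

    <ᵇ-false : ∀ {a b} → ¬ a < b → (a <ᵇ b) ≡ false
    <ᵇ-false {a} {b} ≮ = Bool.¬-not λ e → ≮ (ℕ.<ᵇ⇒< a b (subst T (sym e) _))

    <-or-≡ : ∀ {a b} → a ≤ b → indicator (a ≡ᵇ b) + indicator (a <ᵇ b) ≡ 1
    <-or-≡ {a} {b} le with ℕ.m≤n⇒m<n∨m≡n le
    ... | inj₁ lt rewrite <ᵇ-true lt | ≡ᵇ-≢ (ℕ.<⇒≢ lt) = refl
    ... | inj₂ refl rewrite ≡ᵇ-refl a | <ᵇ-irrefl a = refl

    -- Rows before the critical one have length at most m - 1, rows after it at most m. Those
    -- attaining the bound form the leg, the shorter ones are counted by `diagonal`.
    legs+diagonal : ∀ j → j ≢ crit η → legs j + diagonal j ≡ 1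
    legs+diagonal j j≢k with ℕ.<-cmp (toℕ j) (toℕ (crit η))
    ... | tri< j<k _ k≮j rewrite <ᵇ-true j<k | <ᵇ-false k≮j =
          trans (cong (indicator (lookup η j ≡ᵇ mx η ∸ 1) +_) (ℕ.+-identityʳ _)) (<-or-≡ (ℕ.<⇒≤pred (before-crit j j<k)))
    ... | tri≈ _ e _ = contradiction (Fin.toℕ-injective e) j≢k
    ... | tri> j≮k _ k<j rewrite <ᵇ-true k<j | <ᵇ-false j≮k =
          trans (cong (_+ indicator (lookup η j <ᵇ mx η)) (ℕ.+-identityʳ _)) (<-or-≡ (lookup≤maximum η j))

    -- The rows other than k split into the leg and the diagonal ones. In particular the leg is at
    -- most `n`, so the truncated subtraction is exact.
    n∸critLeg : n ∸ critLeg η ≡ sum diagonal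
    n∸critLeg = begin
      n ∸ critLeg η ≡⟨ cong₂ _∸_ total critLeg-sum ⟩
      (sum legs + sum diagonal) ∸ sum legs ≡⟨ ℕ.m+n∸m≡n (sum legs) (sum diagonal) ⟩
      sum diagonal ∎
      where
      open ≡-Reasoning
      t : Fin (suc n) → ℕ
      t j = legs j + diagonal j
      ones : ∀ m → sum {m} (λ _ → 1) ≡ m
      ones zero = refl
      ones (suc m) = cong suc (ones m)
      at-crit : t (crit η) ≡ 0
      at-crit rewrite <ᵇ-irrefl (toℕ (crit η)) = refl
      total : n ≡ sum legs + sum diagonal
      total = begin
        n ≡⟨ ones n ⟨
        sum {n} (λ _ → 1) ≡⟨ sum-cong-≗ (λ i → legs+diagonal (Fin.punchIn (crit η) i) (Fin.punchInᵢ≢i (crit η) i)) ⟨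
        sum (Vector.removeAt t (crit η)) ≡⟨ cong (_+ sum (Vector.removeAt t (crit η))) at-crit ⟨
        t (crit η) + sum (Vector.removeAt t (crit η)) ≡⟨ sum-remove {i = crit η} t ⟨
        sum t ≡⟨ ∑-distrib-+ legs diagonal ⟩
        sum legs + sum diagonal ∎

    -- Index `i` stands for moving i + 1 boxes. The strict condition ε > 0 admits one move fewer
    -- than the weak one in `down-bound`, hence the further `∸ 1`.
    up-bound : ∀ b (i : Fin (mx η ∸ 1 ∸ b ∸ 1)) → b + suc (toℕ i) < mx η ∸ 1
    up-bound b i = go (mx η ∸ 1) b i
      where
      go : ∀ a b (i : Fin (a ∸ b ∸ 1)) → b + suc (toℕ i) < a
      go zero zero ()
      go zero (suc b) ()
      go (suc a) zero i = s≤s (Fin.toℕ<n i)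
      go (suc a) (suc b) i = s≤s (go a b i)

    down-bound : ∀ b (i : Fin (mx η ∸ 1 ∸ b)) → b + suc (toℕ i) ≤ mx η ∸ 1
    down-bound b i = go (mx η ∸ 1) b i
      where
      go : ∀ a b (i : Fin (a ∸ b)) → b + suc (toℕ i) ≤ a
      go zero zero ()
      go zero (suc b) ()
      go (suc a) zero i = Fin.toℕ<n i
      go (suc a) (suc b) i = s≤s (go a b i)

    stars : List (∃ (Glissade η))
    stars with 0 ℕ.<? mx η
    ... | yes 0<m = (_ , star 0<m) ∷ []
    ... | no _ = []

    upward : ∀ j → j Fin.< crit η → Fin (mx η ∸ 1 ∸ lookup η j ∸ 1) → ∃ (Glissade η)
    upward j j<k i = _ , up j (suc (toℕ i)) z<s j<k (up-bound (lookup η j) i)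

    downward : ∀ j → crit η Fin.< j → Fin (mx η ∸ 1 ∸ lookup η j) → ∃ (Glissade η)
    downward j k<j i = _ , down j (suc (toℕ i)) z<s k<j (down-bound (lookup η j) i)

    ups : Fin (suc n) → List (∃ (Glissade η))
    ups j with j Fin.<? crit η
    ... | yes j<k = map (upward j j<k) (allFin (mx η ∸ 1 ∸ lookup η j ∸ 1))
    ... | no _ = []

    downs : Fin (suc n) → List (∃ (Glissade η))
    downs j with crit η Fin.<? j
    ... | yes k<j = map (downward j k<j) (allFin (mx η ∸ 1 ∸ lookup η j))
    ... | no _ = []

    glissades : List (∃ (Glissade η))
    glissades = stars ++ concatMap (λ j → ups j ++ downs j) (allFin (suc n))

    -- A glissade carries proofs of its inequalities; since these are unique, the one rebuilt from
    -- the enumerating index is the given one.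
    ∈-glissades : ∀ γ (g : Glissade η γ) → (γ , g) ∈ glissades
    ∈-glissades _ (star 0<m) = ∈-++⁺ˡ go
      where
      go : (starOf η , star 0<m) ∈ stars
      go with 0 ℕ.<? mx η
      ... | yes p = here (cong (λ p → _ , star p) (ℕ.≤-irrelevant 0<m p))
      ... | no ¬p = contradiction 0<m ¬p
    ∈-glissades _ (up j (suc l) (s≤s z≤n) j<k lt) = ∈-++⁺ʳ stars (∈-concatMap⁺ _ (lose (∈-allFin j) (∈-++⁺ˡ go)))
      where
      i<′ : ∀ a b → b + suc l < a → l < a ∸ b ∸ 1
      i<′ (suc a) zero (s≤s lt) = lt
      i<′ (suc a) (suc b) (s≤s lt) = i<′ a b lt
      i : Fin (mx η ∸ 1 ∸ lookup η j ∸ 1)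
      i = fromℕ< (i<′ (mx η ∸ 1) (lookup η j) lt)
      go : (moveOf η j (suc l) , up j (suc l) z<s j<k lt) ∈ ups j
      go with j Fin.<? crit η
      ... | no ¬p = contradiction j<k ¬p
      ... | yes p = subst (_∈ map (upward j p) (allFin _)) (same (toℕ i) (Fin.toℕ-fromℕ< _) p (up-bound (lookup η j) i)) (∈-map⁺ (upward j p) (∈-allFin i))
        where
        same : ∀ l′ (e : l′ ≡ l) (p : j Fin.< crit η) q → _≡_ {A = ∃ (Glissade η)} (_ , up j (suc l′) z<s p q) (_ , up j (suc l) z<s j<k lt)
        same l′ refl p q rewrite ℕ.≤-irrelevant p j<k | ℕ.≤-irrelevant q lt = refl
    ∈-glissades _ (down j (suc l) (s≤s z≤n) k<j le) = ∈-++⁺ʳ stars (∈-concatMap⁺ _ (lose (∈-allFin j) (∈-++⁺ʳ (ups j) go)))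
      where
      i<′ : ∀ a b → b + suc l ≤ a → l < a ∸ b
      i<′ a zero lt = lt
      i<′ (suc a) (suc b) (s≤s lt) = i<′ a b lt
      i : Fin (mx η ∸ 1 ∸ lookup η j)
      i = fromℕ< (i<′ (mx η ∸ 1) (lookup η j) le)
      go : (moveOf η j (suc l) , down j (suc l) z<s k<j le) ∈ downs j
      go with crit η Fin.<? j
      ... | no ¬p = contradiction k<j ¬p
      ... | yes p = subst (_∈ map (downward j p) (allFin _)) (same (toℕ i) (Fin.toℕ-fromℕ< _) p (down-bound (lookup η j) i)) (∈-map⁺ (downward j p) (∈-allFin i))
        where
        same : ∀ l′ (e : l′ ≡ l) (p : crit η Fin.< j) q → _≡_ {A = ∃ (Glissade η)} (_ , down j (suc l′) z<s p q) (_ , down j (suc l) z<s k<j le)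
        same l′ refl p q rewrite ℕ.≤-irrelevant p k<j | ℕ.≤-irrelevant q le = refl

    -- the kind of a glissade, its target row and the number of moved boxes
    code : ∃ (Glissade η) → ℕ × ℕ × ℕ
    code (_ , star _) = 0 , 0 , 0
    code (_ , up j l _ _ _) = 1 , toℕ j , l
    code (_ , down j l _ _ _) = 2 , toℕ j , l

    code-stars : ∀ {g} → g ∈ stars → proj₁ (code g) ≡ 0
    code-stars with 0 ℕ.<? mx η
    ... | yes _ = λ { (here refl) → refl }
    ... | no _ = λ ()

    code-ups : ∀ j {g} → g ∈ ups j → proj₁ (code g) ≡ 1 × proj₁ (proj₂ (code g)) ≡ toℕ j
    code-ups j with j Fin.<? crit η
    ... | yes _ = λ g∈ → let (_ , _ , e) = ∈-map⁻ _ g∈ in subst (λ g → proj₁ (code g) ≡ 1 × proj₁ (proj₂ (code g)) ≡ toℕ j) (sym e) (refl , refl)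
    ... | no _ = λ ()

    code-downs : ∀ j {g} → g ∈ downs j → proj₁ (code g) ≡ 2 × proj₁ (proj₂ (code g)) ≡ toℕ j
    code-downs j with crit η Fin.<? j
    ... | yes _ = λ g∈ → let (_ , _ , e) = ∈-map⁻ _ g∈ in subst (λ g → proj₁ (code g) ≡ 2 × proj₁ (proj₂ (code g)) ≡ toℕ j) (sym e) (refl , refl)
    ... | no _ = λ ()

    stars-unique : Unique stars
    stars-unique with 0 ℕ.<? mx η
    ... | yes _ = [] ∷ []
    ... | no _ = []

    ups-unique : ∀ j → Unique (ups j)
    ups-unique j with j Fin.<? crit η
    ... | yes _ = Unique.map⁺ (λ e → Fin.toℕ-injective (ℕ.suc-injective (cong (proj₂ ∘ proj₂ ∘ code) e))) (Unique.allFin⁺ _)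
    ... | no _ = []

    downs-unique : ∀ j → Unique (downs j)
    downs-unique j with crit η Fin.<? j
    ... | yes _ = Unique.map⁺ (λ e → Fin.toℕ-injective (ℕ.suc-injective (cong (proj₂ ∘ proj₂ ∘ code) e))) (Unique.allFin⁺ _)
    ... | no _ = []

  concatMap-unique : ∀ {A B : Set} (f : A → List B) {xs} → Unique xs → (∀ x → Unique (f x)) →
                     (∀ {x x′ y} → y ∈ f x → y ∈ f x′ → x ≡ x′) → Unique (concatMap f xs)
  concatMap-unique f {xs} uniq f-uniq disjoint = Unique.concat⁺ (All.map⁺ (All.universal f-uniq xs))
    (AllPairs.map⁺ (AllPairs.map f-disjoint uniq))
    where
    f-disjoint : ∀ {x x′} → x ≢ x′ → Disjoint (f x) (f x′)
    f-disjoint x≢x′ (y∈ , y∈′) = x≢x′ (disjoint y∈ y∈′)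

  module _ {n : ℕ} where

    -- Codes separate the glissades, so the resulting compositions need not be compared.
    glissades-unique : (η : Vec ℕ (suc n)) → Unique (glissades η)
    glissades-unique η = Unique.++⁺ (stars-unique η)
      (concatMap-unique _ (Unique.allFin⁺ (suc n)) rows-unique (λ g∈ g∈′ → Fin.toℕ-injective (trans (sym (row g∈)) (row g∈′))))
      (λ (g∈ , g∈′) → let (j , g∈″) = satisfied (∈-concatMap⁻ (λ j → ups η j ++ downs η j) {xs = allFin (suc n)} g∈′) in kind {j} g∈″ (code-stars η g∈))
      where
      row : ∀ {j g} → g ∈ ups η j ++ downs η j → proj₁ (proj₂ (code η g)) ≡ toℕ j
      row {j} g∈ with ∈-++⁻ (ups η j) g∈
      ... | inj₁ g∈ = proj₂ (code-ups η j g∈)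
      ... | inj₂ g∈ = proj₂ (code-downs η j g∈)
      kind : ∀ {j g} → g ∈ ups η j ++ downs η j → proj₁ (code η g) ≢ 0
      kind {j} g∈ e with ∈-++⁻ (ups η j) g∈
      ... | inj₁ g∈ = contradiction (trans (sym e) (proj₁ (code-ups η j g∈))) λ ()
      ... | inj₂ g∈ = contradiction (trans (sym e) (proj₁ (code-downs η j g∈))) λ ()
      rows-unique : ∀ j → Unique (ups η j ++ downs η j)
      rows-unique j = Unique.++⁺ (ups-unique η j) (downs-unique η j) λ (g∈ , g∈′) →
        contradiction (trans (sym (proj₁ (code-ups η j g∈))) (proj₁ (code-downs η j g∈′))) λ ()

    size-pred : ∀ {d} {η γ : Vec ℕ (suc n)} → size η ≡ suc d → Glissade η γ → size γ ≡ d
    size-pred {η = η} e g = ℕ.suc-injective (trans (size-glissade η g) e)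

    allGames : ∀ d (η : Vec ℕ (suc n)) → size η ≡ d → List (Game η)
    allGames zero η e = subst Game (sym (size≡0 η e)) done ∷ []
    allGames (suc d) η e = concatMap (λ (γ , g) → map (step g) (allGames d γ (size-pred e g))) (glissades η)

    ∈-allGames : ∀ d η e (G : Game η) → G ∈ allGames d η e
    ∈-allGames zero η e done = here (unique-done (sym (size≡0 η e)))
      where
      unique-done : (e : replicate (suc n) 0 ≡ replicate (suc n) 0) → done ≡ subst Game e done
      unique-done refl = refl
    ∈-allGames zero η e (step g G) = contradiction (trans (size-glissade η g) e) ℕ.1+n≢0
    ∈-allGames (suc d) η e done = contradiction (trans (sym e) (size-replicate0 (suc n))) ℕ.1+n≢0
    ∈-allGames (suc d) η e (step {γ = γ} g G) = ∈-concatMap⁺ _ (lose (∈-glissades η γ g) (∈-map⁺ (step g) (∈-allGames d γ (size-pred e g) G)))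

    step-injective₁ : ∀ {η γ γ′ : Vec ℕ (suc n)} {g : Glissade η γ} {g′ : Glissade η γ′} {G G′} →
                      step g G ≡ step g′ G′ → _≡_ {A = ∃ (Glissade η)} (γ , g) (γ′ , g′)
    step-injective₁ refl = refl

    step-injective₂ : ∀ {η γ : Vec ℕ (suc n)} {g : Glissade η γ} {G G′} → step g G ≡ step g G′ → G ≡ G′
    step-injective₂ refl = refl

    allGames-unique : ∀ d η e → Unique (allGames d η e)
    allGames-unique zero η e = [] ∷ []
    allGames-unique (suc d) η e = concatMap-unique _ (glissades-unique η)
      (λ (γ , g) → Unique.map⁺ step-injective₂ (allGames-unique d γ (size-pred e g)))
      λ { {γ , g} {γ′ , g′} G∈ G∈′ → let (_ , _ , p) = ∈-map⁻ (step g) G∈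
                                         (_ , _ , p′) = ∈-map⁻ (step g′) G∈′
                                     in step-injective₁ (trans (sym p) p′) }

open GameEnumeration
open import Relation.Binary.Definitions using (tri<; tri≈; tri>)

-- Sums over glissades and games, evaluated at the points -γ̄.

module GameSums (F : ParameterField) where

  open ParameterField F
  open Polynomials K
  open Interpolation F
  open Cherednik F
  open IntegerSolver K
  open import Algebra.Properties.Semiring.Sum semiring using (sum; sum-cong-≋; ∑-distrib-+; *-distribˡ-sum; *-distribʳ-sum; sum-init-last)
  open import Algebra.Properties.CommutativeMonoid.Sum ℕ.+-0-commutativeMonoid using () renaming (sum to sumℕ)
  open import Relation.Binary.Reasoning.Setoid setoid

  module _ {A : Set} where

    total : (A → Carrier) → List A → Carrier
    total f = foldr (λ x acc → f x + acc) 0#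

    total-++ : ∀ f xs ys → total f (xs ++ ys) ≈ total f xs + total f ys
    total-++ f [] ys = sym (+-identityˡ _)
    total-++ f (x ∷ xs) ys = trans (+-congˡ (total-++ f xs ys)) (sym (+-assoc _ _ _))

    total-cong : ∀ {f g} → (∀ x → f x ≈ g x) → ∀ xs → total f xs ≈ total g xs
    total-cong e [] = refl
    total-cong e (x ∷ xs) = +-cong (e x) (total-cong e xs)

    total-* : ∀ c f xs → total (λ x → c * f x) xs ≈ c * total f xs
    total-* c f [] = sym (zeroʳ c)
    total-* c f (x ∷ xs) = trans (+-congˡ (total-* c f xs)) (sym (distribˡ _ _ _))

    total-↭ : ∀ f {xs ys} → xs ↭ ys → total f xs ≈ total f ys
    total-↭ f ↭.refl = refl
    total-↭ f (↭.prep x p) = +-congˡ (total-↭ f p)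
    total-↭ f (↭.swap x y p) = trans (+-congˡ (+-congˡ (total-↭ f p))) (solve 3 (λ a b c → a :+ (b :+ c) := b :+ (a :+ c)) refl _ _ _)
    total-↭ f (↭.trans p q) = trans (total-↭ f p) (total-↭ f q)

  total-map : ∀ {A B : Set} f (h : A → B) xs → total f (map h xs) ≡ total (f ∘ h) xs
  total-map f h [] = ≡.refl
  total-map f h (x ∷ xs) = ≡.cong (f (h x) +_) (total-map f h xs)

  total-concatMap : ∀ {A B : Set} f (h : A → List B) xs → total f (concatMap h xs) ≈ total (λ x → total f (h x)) xs
  total-concatMap f h [] = refl
  total-concatMap f h (x ∷ xs) = trans (total-++ f (h x) (concatMap h xs)) (+-congˡ (total-concatMap f h xs))

  total-allFin : ∀ {m} (f : Fin m → Carrier) → total f (allFin m) ≈ sum f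
  total-allFin {m} f = go m f id
    where
    go : ∀ {A : Set} m (f : A → Carrier) (h : Fin m → A) → total f (List.tabulate h) ≈ sum (f ∘ h)
    go zero f h = refl
    go (suc m) f h = +-congˡ (go m f (h ∘ suc))

  -- For b ≤ a the quotient is a geometric sum with all coefficients +1. It applies because the
  -- critical row is longest, and it is why all moving glissades have the same weight r.
  divided-≥ : ∀ a b g → b ≤ a → lin g (divided a b) ≈ sum {a ∸ b} (λ i → g (a ∸ suc (toℕ i) , b ℕ.+ toℕ i))
  divided-≥ zero zero g z≤n = refl
  divided-≥ (suc a) zero g z≤n = begin
    1# * g (0 , a) + lin g (relabel _ (divided a zero))
      ≈⟨ +-cong (*-identityˡ _) (reflexive (lin-relabel g _ (divided a zero))) ⟩
    g (0 , a) + lin _ (divided a zero)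
      ≈⟨ +-congˡ (divided-≥ a zero _ z≤n) ⟩
    g (0 , a) + sum {a} (λ i → g (suc (a ∸ suc (toℕ i)) , toℕ i))
      ≈⟨ +-comm _ _ ⟩
    sum {a} (λ i → g (suc (a ∸ suc (toℕ i)) , toℕ i)) + g (0 , a)
      ≈⟨ +-cong (sum-cong-≋ inner) (reflexive (≡.cong₂ (λ p q → g (p , q)) (≡.trans (≡.sym (ℕ.n∸n≡0 a)) (≡.cong (a ∸_) (≡.sym (Fin.toℕ-fromℕ a)))) (≡.sym (Fin.toℕ-fromℕ a)))) ⟩
    sum (t ∘ inject₁) + t (fromℕ a)
      ≈⟨ sum-init-last t ⟨
    sum t ∎
    where
    t : Fin (suc a) → Carrier
    t i = g (a ∸ toℕ i , toℕ i)
    inner : ∀ i → g (suc (a ∸ suc (toℕ i)) , toℕ i) ≈ t (inject₁ i)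
    inner i = reflexive (≡.cong₂ (λ p q → g (p , q))
      (≡.trans (≡.sym (ℕ.+-∸-assoc 1 (Fin.toℕ<n i))) (≡.cong (a ∸_) (≡.sym (Fin.toℕ-inject₁ i))))
      (≡.sym (Fin.toℕ-inject₁ i)))
  divided-≥ (suc a) (suc b) g (s≤s b≤a) = begin
    lin g (relabel _ (divided a b)) ≡⟨ lin-relabel g _ (divided a b) ⟩
    lin (λ (p , q) → g (suc p , suc q)) (divided a b) ≈⟨ divided-≥ a b _ b≤a ⟩
    sum {a ∸ b} (λ i → g (suc (a ∸ suc (toℕ i)) , suc (b ℕ.+ toℕ i))) ≈⟨ sum-cong-≋ (λ i → reflexive (≡.cong (λ p → g (p , suc (b ℕ.+ toℕ i)))
                                                                                   (≡.sym (ℕ.+-∸-assoc 1 (ℕ.<-≤-trans (Fin.toℕ<n i) (ℕ.m∸n≤m a b)))))) ⟩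
    sum {a ∸ b} (λ i → g (suc a ∸ suc (toℕ i) , suc (b ℕ.+ toℕ i))) ∎

  ι-+ : ∀ a b → ι (a ℕ.+ b) ≈ ι a + ι b
  ι-+ zero b = sym (trans (+-congʳ ι-zero) (+-identityˡ _))
  ι-+ (suc a) b = trans (ι-suc _) (trans (+-congˡ (ι-+ a b)) (trans (sym (+-assoc _ _ _)) (+-congʳ (sym (ι-suc a)))))

  ι-sum : ∀ {m} (f : Fin m → ℕ) → ι (sumℕ f) ≈ sum (ι ∘ f)
  ι-sum {zero} f = ι-zero
  ι-sum {suc m} f = trans (ι-+ (f zero) _) (+-congˡ (ι-sum (f ∘ suc)))

  ι-indicator-false : ∀ {x} y → x ≡ false → ι (indicator x) * y ≈ 0#
  ι-indicator-false y ≡.refl = trans (*-congʳ ι-zero) (zeroˡ y)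

  ι-indicator-true : ∀ {x} y → x ≡ true → ι (indicator x) * y ≈ y
  ι-indicator-true y ≡.refl = trans (*-congʳ (trans (ι-suc 0) (trans (+-congˡ ι-zero) (+-identityʳ 1#)))) (*-identityˡ y)

  module _ {n : ℕ} (η : Vec ℕ (suc n)) (0<m : 0 < mx η) (X : Vec ℕ (suc n) → Carrier) where

    private
      k : Fin (suc n)
      k = crit η
      a : ℕ
      a = mx η ∸ 1
      ζ : Vec ℕ (suc n)
      ζ = starOf η
      target : ∃ (Glissade η) → Carrier
      target (γ , _) = X γ
      lookup-k : lookup ζ k ≡ a
      lookup-k = Vec.lookup∘update k η a
      lookup-j : ∀ {j} → j ≢ k → lookup ζ j ≡ lookup η j
      lookup-j j≢k = Vec.lookup∘update′ j≢k η a
      put-ζ : ∀ j p q → put k j p q ζ ≡ (η [ k ]≔ p) [ j ]≔ q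
      put-ζ j p q = ≡.cong (_[ j ]≔ q) (Vec.[]≔-idempotent η k)
      put-same : ∀ {j} → j ≢ k → put k j a (lookup η j) ζ ≡ ζ
      put-same {j} j≢k = ≡.trans (put-ζ j a (lookup η j)) (≡.trans (≡.cong (ζ [ j ]≔_) (≡.sym (lookup-j j≢k))) (Vec.[]≔-lookup ζ j))

    -- The summand i = 0 of the geometric sum moves nothing and returns η*; it is present exactly if
    -- the sum is nonempty. The summand i > 0 moves i boxes, and the length of the sum amounts to ε
    -- > 0.
    up-total : ∀ j → j Fin.< k → before X k j ζ ≈ ι (indicator (lookup η j <ᵇ a)) * X ζ + total target (ups η j)
    up-total j j<k with j Fin.<? k
    ... | no ≮ = contradiction j<k ≮
    ... | yes p = begin
      before X k j ζ
        ≡⟨ ≡.cong₂ (λ a b → lin g (divided a b)) lookup-k (lookup-j j≢k) ⟩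
      lin g (divided a b)
        ≈⟨ divided-≥ a b g b≤a ⟩
      sum {a ∸ b} (λ i → g (a ∸ suc (toℕ i) , b ℕ.+ toℕ i))
        ≈⟨ go (a ∸ b) ≡.refl ⟩
      ι (indicator (b <ᵇ a)) * X ζ + sum {a ∸ b ∸ 1} (λ i → X (moveOf η j (suc (toℕ i))))
        ≈⟨ +-congˡ (total-allFin {a ∸ b ∸ 1} (λ i → X (moveOf η j (suc (toℕ i))))) ⟨
      ι (indicator (b <ᵇ a)) * X ζ + total (λ i → X (moveOf η j (suc (toℕ i)))) (allFin (a ∸ b ∸ 1))
        ≡⟨ ≡.cong (ι (indicator (b <ᵇ a)) * X ζ +_) (total-map target (upward η j p) (allFin (a ∸ b ∸ 1))) ⟨
      ι (indicator (b <ᵇ a)) * X ζ + total target (map (upward η j p) (allFin (a ∸ b ∸ 1))) ∎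
      where
      b : ℕ
      b = lookup η j
      j≢k : j ≢ k
      j≢k = Fin.<⇒≢ j<k
      b≤a : b ≤ a
      b≤a = ℕ.<⇒≤pred (before-crit η j j<k)
      g : ℕ × ℕ → Carrier
      g (p , q) = X (put k j (suc p) q ζ)
      -- The number of summands is generalised so that the first one, if any, can be split off.
      go : ∀ m → a ∸ b ≡ m → sum {m} (λ i → g (a ∸ suc (toℕ i) , b ℕ.+ toℕ i))
         ≈ ι (indicator (b <ᵇ a)) * X ζ + sum {m ∸ 1} (λ i → X (moveOf η j (suc (toℕ i))))
      go zero e = sym (trans (+-identityʳ _) (ι-indicator-false (X ζ) (<ᵇ-false η (ℕ.≤⇒≯ (ℕ.m∸n≡0⇒m≤n {a} {b} e)))))
      go (suc m) e = +-cong
        (trans (reflexive (≡.cong X (≡.trans (≡.cong₂ (λ p q → put k j p q ζ) (≡.trans (≡.sym (ℕ.+-∸-assoc 1 {a} {1} 0<a)) ≡.refl) (ℕ.+-identityʳ b)) (put-same j≢k))))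
                 (sym (ι-indicator-true (X ζ) (<ᵇ-true η (ℕ.m∸n≢0⇒n<m {a} {b} (λ e′ → ℕ.1+n≢0 (≡.trans (≡.sym e) e′)))))))
        (sum-cong-≋ {m} λ i → reflexive (≡.cong X (≡.trans (≡.cong (λ p → put k j p (b ℕ.+ suc (toℕ i)) ζ)
          (≡.sym (ℕ.+-∸-assoc 1 (ℕ.≤-trans (s≤s (Fin.toℕ<n i)) (≡.subst (_≤ a) e (ℕ.m∸n≤m a b)))))) (put-ζ j (a ∸ suc (toℕ i)) (b ℕ.+ suc (toℕ i))))))
        where
        0<a : 0 < a
        0<a = ℕ.<-≤-trans z<s (≡.subst (_≤ a) e (ℕ.m∸n≤m a b))

    -- Multiplying by x_k before dividing raises the larger exponent from m - 1 to m. The sum is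
    -- longer by one, which is the weak condition ε ≥ 0.
    down-total : ∀ j → k Fin.< j → after X k j ζ ≈ ι (indicator (lookup η j <ᵇ mx η)) * X ζ + total target (downs η j)
    down-total j k<j with k Fin.<? j
    ... | no ≮ = contradiction k<j ≮
    ... | yes p = begin
      after X k j ζ
        ≡⟨ ≡.cong₂ (λ a b → lin g (divided (suc a) b)) lookup-k (lookup-j j≢k) ⟩
      lin g (divided (suc a) b)
        ≈⟨ divided-≥ (suc a) b g b≤1+a ⟩
      sum {suc a ∸ b} (λ i → g (suc a ∸ suc (toℕ i) , b ℕ.+ toℕ i))
        ≈⟨ go (suc a ∸ b) ≡.refl ⟩
      ι (indicator (b <ᵇ suc a)) * X ζ + sum {suc a ∸ b ∸ 1} (λ i → X (moveOf η j (suc (toℕ i))))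
        ≡⟨ ≡.cong₂ (λ m d → ι (indicator (b <ᵇ m)) * X ζ + sum {d} (λ i → X (moveOf η j (suc (toℕ i))))) 1+a (shift b) ⟩
      ι (indicator (b <ᵇ mx η)) * X ζ + sum {a ∸ b} (λ i → X (moveOf η j (suc (toℕ i))))
        ≈⟨ +-congˡ (total-allFin {a ∸ b} (λ i → X (moveOf η j (suc (toℕ i))))) ⟨
      ι (indicator (b <ᵇ mx η)) * X ζ + total (λ i → X (moveOf η j (suc (toℕ i)))) (allFin (a ∸ b))
        ≡⟨ ≡.cong (ι (indicator (b <ᵇ mx η)) * X ζ +_) (total-map target (downward η j p) (allFin (a ∸ b))) ⟨
      ι (indicator (b <ᵇ mx η)) * X ζ + total target (map (downward η j p) (allFin (a ∸ b))) ∎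
      where
      b : ℕ
      b = lookup η j
      j≢k : j ≢ k
      j≢k = Fin.<⇒≢ k<j ∘ ≡.sym
      1+a : suc a ≡ mx η
      1+a = ℕ.m+[n∸m]≡n 0<m
      b≤1+a : b ≤ suc a
      b≤1+a = ℕ.≤-trans (lookup≤maximum η j) (ℕ.≤-reflexive (≡.sym 1+a))
      shift : ∀ b → suc a ∸ b ∸ 1 ≡ a ∸ b
      shift b = ≡.trans (ℕ.∸-+-assoc (suc a) b 1) (≡.cong (suc a ∸_) (ℕ.+-comm b 1))
      g : ℕ × ℕ → Carrier
      g (p , q) = X (put k j p q ζ)
      go : ∀ m → suc a ∸ b ≡ m → sum {m} (λ i → g (a ∸ toℕ i , b ℕ.+ toℕ i))
         ≈ ι (indicator (b <ᵇ suc a)) * X ζ + sum {m ∸ 1} (λ i → X (moveOf η j (suc (toℕ i))))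
      go zero e = sym (trans (+-identityʳ _) (ι-indicator-false (X ζ) (<ᵇ-false η (ℕ.≤⇒≯ (ℕ.m∸n≡0⇒m≤n {suc a} {b} e)))))
      go (suc m) e = +-cong
        (trans (reflexive (≡.cong X (≡.trans (≡.cong (λ q → put k j a q ζ) (ℕ.+-identityʳ b)) (put-same j≢k))))
                 (sym (ι-indicator-true (X ζ) (<ᵇ-true η (ℕ.m∸n≢0⇒n<m {suc a} {b} (λ e′ → ℕ.1+n≢0 (≡.trans (≡.sym e) e′)))))))
        (sum-cong-≋ {m} λ i → reflexive (≡.cong X (put-ζ j (a ∸ suc (toℕ i)) (b ℕ.+ suc (toℕ i)))))

    diagonal-at : ∀ j {b b′} → (toℕ j <ᵇ toℕ k) ≡ b → (toℕ k <ᵇ toℕ j) ≡ b′ →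
                  diagonal η j ≡ indicator (b ∧ (lookup η j <ᵇ mx η ∸ 1)) ℕ.+ indicator (b′ ∧ (lookup η j <ᵇ mx η))
    diagonal-at j e e′ = ≡.cong₂ (λ b b′ → indicator (b ∧ (lookup η j <ᵇ mx η ∸ 1)) ℕ.+ indicator (b′ ∧ (lookup η j <ᵇ mx η))) e e′

    ups-empty : ∀ j → ¬ j Fin.< k → ups η j ≡ []
    ups-empty j ≮ with j Fin.<? k
    ... | yes p = contradiction p ≮
    ... | no _ = ≡.refl

    downs-empty : ∀ j → ¬ k Fin.< j → downs η j ≡ []
    downs-empty j ≮ with k Fin.<? j
    ... | yes p = contradiction p ≮
    ... | no _ = ≡.refl

    pair-total : ∀ j → pair X k j ζ ≈ ι (diagonal η j) * X ζ + total target (ups η j ++ downs η j)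
    pair-total j with ℕ.<-cmp (toℕ j) (toℕ k)
    ... | tri< j<k _ k≮j = begin
      pair X k j ζ ≡⟨ ≡.cong₂ (λ b b′ → branch b b′ X k j ζ) (<ᵇ-true η j<k) (<ᵇ-false η k≮j) ⟩
      before X k j ζ ≈⟨ up-total j j<k ⟩
      ι (indicator (lookup η j <ᵇ a)) * X ζ + total target (ups η j) ≈⟨ +-cong (*-congʳ (reflexive (≡.cong ι (≡.sym
        (≡.trans (diagonal-at j (<ᵇ-true η j<k) (<ᵇ-false η k≮j)) (ℕ.+-identityʳ _)))))) (sym (trans (total-++ target (ups η j) (downs η j))
        (trans (+-congˡ (reflexive (≡.cong (total target) (downs-empty j k≮j)))) (+-identityʳ _)))) ⟩
      ι (diagonal η j) * X ζ + total target (ups η j ++ downs η j) ∎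
    ... | tri≈ ≮ _ ≯ = begin
      pair X k j ζ ≡⟨ ≡.cong₂ (λ b b′ → branch b b′ X k j ζ) (<ᵇ-false η ≮) (<ᵇ-false η ≯) ⟩
      0# ≈⟨ trans (+-cong (trans (*-congʳ ι-zero) (zeroˡ _)) refl) (+-identityˡ 0#) ⟨
      ι 0 * X ζ + total target [] ≡⟨ ≡.cong₂ (λ d gs → ι d * X ζ + total target gs)
                                                                                       (diagonal-at j (<ᵇ-false η ≮) (<ᵇ-false η ≯)) (≡.cong₂ _++_ (ups-empty j ≮) (downs-empty j ≯)) ⟨
      ι (diagonal η j) * X ζ + total target (ups η j ++ downs η j) ∎
    ... | tri> j≮k _ k<j = begin
      pair X k j ζ ≡⟨ ≡.cong₂ (λ b b′ → branch b b′ X k j ζ) (<ᵇ-false η j≮k) (<ᵇ-true η k<j) ⟩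
      after X k j ζ ≈⟨ down-total j k<j ⟩
      ι (indicator (lookup η j <ᵇ mx η)) * X ζ + total target (downs η j) ≡⟨ ≡.cong₂ (λ d gs → ι d * X ζ + total target (gs ++ downs η j))
                                                                                       (diagonal-at j (<ᵇ-false η j≮k) (<ᵇ-true η k<j)) (ups-empty j j≮k) ⟨
      ι (diagonal η j) * X ζ + total target (ups η j ++ downs η j) ∎

  glissade-weight : ∀ {n} {η : Vec ℕ (suc n)} → Point (suc n) → ∃ (Glissade η) → Carrier
  glissade-weight {n} {η} v (_ , star _) = v (crit η) + (ι (mx η ∸ 1) + r * ι (n ∸ critLeg η))
  glissade-weight v (_ , up _ _ _ _ _) = r
  glissade-weight v (_ , down _ _ _ _ _) = r

  module _ {n : ℕ} (η : Vec ℕ (suc n)) (0<m : 0 < mx η) (X : Vec ℕ (suc n) → Carrier) (v : Point (suc n)) where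

    private
      k : Fin (suc n)
      k = crit η
      ζ : Vec ℕ (suc n)
      ζ = starOf η
      target weighted : ∃ (Glissade η) → Carrier
      target (γ , _) = X γ
      weighted g = glissade-weight v g * target g

    map-weighted : ∀ {m} (h : Fin m → ∃ (Glissade η)) → (∀ i → glissade-weight v (h i) ≡ r) → ∀ is →
                   total weighted (map h is) ≈ r * total target (map h is)
    map-weighted h e [] = sym (zeroʳ r)
    map-weighted h e (i ∷ is) = trans (+-cong (*-congʳ (reflexive (e i))) (map-weighted h e is)) (sym (distribˡ _ _ _))

    ups-weighted : ∀ j → total weighted (ups η j) ≈ r * total target (ups η j)
    ups-weighted j with j Fin.<? k
    ... | yes p = map-weighted (upward η j p) (λ _ → ≡.refl) (allFin _)
    ... | no _ = sym (zeroʳ r)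

    downs-weighted : ∀ j → total weighted (downs η j) ≈ r * total target (downs η j)
    downs-weighted j with k Fin.<? j
    ... | yes p = map-weighted (downward η j p) (λ _ → ≡.refl) (allFin _)
    ... | no _ = sym (zeroʳ r)

    stars-weighted : total weighted (stars η) ≈ (v k + (ι (mx η ∸ 1) + r * ι (n ∸ critLeg η))) * X ζ
    stars-weighted with 0 ℕ.<? mx η
    ... | yes _ = +-identityʳ _
    ... | no ≮ = contradiction 0<m ≮

    -- In Y_k x^{η*} the derivative gives m - 1 and the diagonal terms give r(n - 1 - l[η]); with
    -- x_k they form the weight of the step to η*. What remains are the moves, each with weight r.
    glissade-total : total weighted (glissades η) ≈ v k * X ζ + cherednik k X ζ
    glissade-total = begin
      total weighted (stars η ++ concatMap rows (allFin (suc n)))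
        ≈⟨ total-++ weighted (stars η) (concatMap rows (allFin (suc n))) ⟩
      total weighted (stars η) + total weighted (concatMap rows (allFin (suc n)))
        ≈⟨ +-cong stars-weighted (trans (total-concatMap weighted rows (allFin (suc n))) (trans (total-allFin (λ j → total weighted (rows j))) (sum-cong-≋ λ j →
             trans (total-++ weighted (ups η j) (downs η j)) (trans (+-cong (ups-weighted j) (downs-weighted j))
             (trans (sym (distribˡ _ _ _)) (*-congˡ (sym (total-++ target (ups η j) (downs η j))))))))) ⟩
      (v k + (ι (mx η ∸ 1) + r * ι (n ∸ critLeg η))) * X ζ + sum (λ j → r * total target (rows j))
        ≈⟨ +-cong (*-congʳ (+-congˡ (+-congˡ (*-congˡ (trans (reflexive (≡.cong ι (n∸critLeg η))) (ι-sum (diagonal η)))))))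
                  (sym (*-distribˡ-sum r (λ j → total target (rows j)))) ⟩
      (v k + (ι (mx η ∸ 1) + r * sum (λ j → ι (diagonal η j)))) * X ζ + r * sum (λ j → total target (rows j))
        ≈⟨ solve 6 (λ v i r d x s → (v :+ (i :+ r :* d)) :* x :+ r :* s := v :* x :+ (i :* x :+ r :* (d :* x :+ s))) refl _ _ r _ (X ζ) _ ⟩
      v k * X ζ + (ι (mx η ∸ 1) * X ζ + r * (sum (λ j → ι (diagonal η j)) * X ζ + sum (λ j → total target (rows j))))
        ≈⟨ +-congˡ (+-cong (*-congʳ (reflexive (≡.cong ι (≡.sym (Vec.lookup∘update k η (mx η ∸ 1))))))
             (*-congˡ (trans (+-congʳ (*-distribʳ-sum (X ζ) (λ j → ι (diagonal η j)))) (trans (sym (∑-distrib-+ (λ j → ι (diagonal η j) * X ζ) (λ j → total target (rows j))))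
               (sum-cong-≋ λ j → sym (pair-total η 0<m X j)))))) ⟩
      v k * X ζ + cherednik k X ζ ∎
      where
      rows : Fin (suc n) → List (∃ (Glissade η))
      rows j = ups η j ++ downs η j

  game-weight : ∀ {n} {η : Vec ℕ (suc n)} → Point (suc n) → Game η → Carrier
  game-weight v done = 1#
  game-weight v (step g G) = glissade-weight v (_ , g) * game-weight v G

  -- For `recursion` at η* and the critical row, one side is the value for η by `bump-starOf`, and
  -- the other is the sum over the first glissade by `glissade-total`. At η = 0 both sides are 1.
  game-total : ∀ {n} d (η : Vec ℕ (suc n)) e γ → total (game-weight (pt γ)) (allGames d η e) ≈ value-at γ η
  game-total {n} zero η e γ = trans (+-identityʳ _) (trans (done-weight (≡.sym (size≡0 η e)))
    (trans (sym (value-0 γ)) (reflexive (≡.cong (value-at γ) (≡.sym (size≡0 η e))))))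
    where
    done-weight : ∀ {η} (e : replicate (suc n) 0 ≡ η) → game-weight (pt γ) (≡.subst Game e done) ≈ 1#
    done-weight ≡.refl = refl
  game-total (suc d) η e γ = begin
    total (game-weight v) (concatMap continue (glissades η))
      ≈⟨ total-concatMap (game-weight v) continue (glissades η) ⟩
    total (λ g → total (game-weight v) (continue g)) (glissades η)
      ≈⟨ total-cong (λ (γ′ , g) → trans (reflexive (total-map (game-weight v) (step g) (allGames d γ′ (size-pred e g))))
           (trans (total-* (glissade-weight v (γ′ , g)) (game-weight v) (allGames d γ′ (size-pred e g)))
                    (*-congˡ (game-total d γ′ (size-pred e g) γ)))) (glissades η) ⟩
    total (λ g → glissade-weight v g * value-at γ (proj₁ g)) (glissades η)
      ≈⟨ glissade-total η 0<m (value-at γ) v ⟩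
    v (crit η) * value-at γ (starOf η) + cherednik (crit η) (value-at γ) (starOf η)
      ≈⟨ recursion (starOf η) (crit η) γ ⟨
    value-at γ (bump (crit η) (starOf η))
      ≡⟨ ≡.cong (value-at γ) (bump-starOf η 0<m) ⟩
    value-at γ η ∎
    where
    v : Point _
    v = pt γ
    0<m : 0 < mx η
    0<m = size>0⇒0<mx η (≡.subst (0 <_) (≡.sym e) z<s)
    continue : ∃ (Glissade η) → List (Game η)
    continue (γ′ , g) = map (step g) (allGames d γ′ (size-pred e g))

-- Finite lists of compositions, and degrees and values of products.

vectors≤ : ∀ N → ℕ → List (Vec ℕ N)
vectors≤ zero d = [] ∷ []
vectors≤ (suc N) d = concatMap (λ a → List.map (a ∷_) (vectors≤ N d)) (upTo (suc d))

-- Only this inclusion is claimed: the list bounds each entry separately, and `interpolate` skips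
-- members of the wrong size.
∈-vectors≤ : ∀ {N d} (γ : Vec ℕ N) → size γ ≤ d → γ ∈ vectors≤ N d
∈-vectors≤ [] le = here ≡.refl
∈-vectors≤ (a ∷ γ) le = ∈-concatMap⁺ _ (lose (∈-upTo⁺ (s≤s (ℕ.≤-trans (ℕ.m≤m+n a _) le)))
  (∈-map⁺ (a ∷_) (∈-vectors≤ γ (ℕ.≤-trans (ℕ.m≤n+m _ a) le))))

size-zipWith : ∀ {N} (β γ : Vec ℕ N) → size (zipWith ℕ._+_ β γ) ≡ size β ℕ.+ size γ
size-zipWith [] [] = ≡.refl
size-zipWith (a ∷ β) (b ∷ γ) = ≡.trans (≡.cong (a ℕ.+ b ℕ.+_) (size-zipWith β γ)) (interchange a b (size β) (size γ))
  where open import Algebra.Properties.CommutativeSemigroup ℕ.+-commutativeSemigroup using (interchange)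

module Products (F : ParameterField) where

  open ParameterField F
  open Polynomials K
  open IntegerSolver K
  open import Algebra.Properties.Semiring.Exp semiring using (^-homo-*)
  open import Relation.Binary.Reasoning.Setoid setoid

  infixl 7 _⊗_
  _⊗_ : ∀ {N} → MPoly N → MPoly N → MPoly N
  p ⊗ q = concatMap (λ t → List.map (λ s → zipWith ℕ._+_ (proj₁ t) (proj₁ s) , proj₂ t * proj₂ s) q) p

  power-zipWith : ∀ {N} (v : Point N) β γ → power v (zipWith ℕ._+_ β γ) ≈ power v β * power v γ
  power-zipWith v [] [] = sym (*-identityˡ 1#)
  power-zipWith v (a ∷ β) (b ∷ γ) = trans (*-cong (^-homo-* (v _) a b) (power-zipWith (v ∘ _) β γ))
    (solve 4 (λ x y z w → (x :* y) :* (z :* w) := (x :* z) :* (y :* w)) refl _ _ _ _)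

  eval-⊗ : ∀ {N} p q (v : Point N) → eval (p ⊗ q) v ≈ eval p v * eval q v
  eval-⊗ [] q v = sym (zeroˡ _)
  eval-⊗ ((β , c) ∷ p) q v = begin
    eval (List.map times q ++ p ⊗ q) v ≈⟨ lin-++ (power v) (List.map times q) (p ⊗ q) ⟩
    eval (List.map times q) v + eval (p ⊗ q) v ≈⟨ +-cong (row q) (eval-⊗ p q v) ⟩
    c * power v β * eval q v + eval p v * eval q v ≈⟨ distribʳ _ _ _ ⟨
    (c * power v β + eval p v) * eval q v ∎
    where
    times : Vec ℕ _ × Carrier → Vec ℕ _ × Carrier
    times s = zipWith ℕ._+_ β (proj₁ s) , c * proj₂ s
    row : ∀ q → eval (List.map times q) v ≈ c * power v β * eval q v
    row [] = sym (zeroʳ _)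
    row ((γ , d) ∷ q) = trans (+-cong (*-congˡ (power-zipWith v β γ)) (row q))
      (solve 5 (λ c d x y z → (c :* d) :* (x :* y) :+ (c :* x) :* z := (c :* x) :* (d :* y :+ z)) refl c d (power v β) (power v γ) (eval q v))

  -- A bound on every listed term, including those that cancel; unlike a bound on coefficients it
  -- passes to products term by term.
  Size≤ : ∀ {N} → ℕ → MPoly N → Set
  Size≤ d = All (λ t → size (proj₁ t) ≤ d)

  Size≤-⊗ : ∀ {N d e} {p q : MPoly N} → Size≤ d p → Size≤ e q → Size≤ (d ℕ.+ e) (p ⊗ q)
  Size≤-⊗ {d = d} {e} {q = q} ps qs = All.concat⁺ (All.map⁺ (All.map (λ {(β , c)} β≤d → All.map⁺ (All.map (λ {(γ , c′)} γ≤e →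
    ℕ.≤-trans (ℕ.≤-reflexive (size-zipWith β γ)) (ℕ.+-mono-≤ β≤d γ≤e)) qs)) ps))

  Size≤⇒DegBelow : ∀ {N d} {p : MPoly N} → Size≤ d p → DegBelow (suc d) p
  Size≤⇒DegBelow [] β lt = refl
  Size≤⇒DegBelow {p = (γ , c) ∷ p} (γ≤d ∷ ps) β lt = trans (+-cong (trans (*-congˡ (δ-≢ β γ λ { ≡.refl → ℕ.<⇒≱ lt γ≤d })) (zeroʳ c)) (Size≤⇒DegBelow ps β lt)) (+-identityˡ 0#)

-- The image of a monomial under Ξ.

module Dehomogenization (F : ParameterField) where

  open ParameterField F
  open Polynomials K
  open Interpolation F
  open IntegerSolver K
  open import Relation.Binary.Reasoning.Setoid setoid

  signum : ℕ → Carrier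
  signum zero = 1#
  signum (suc k) = - signum k

  signum-+ : ∀ a b → signum (a ℕ.+ b) ≈ signum a * signum b
  signum-+ zero b = sym (*-identityˡ _)
  signum-+ (suc a) b = trans (-‿cong (signum-+ a b)) (solve 2 (λ x y → :- (x :* y) := (:- x) :* y) refl _ _)

  signum-square : ∀ a → signum a * signum a ≈ 1#
  signum-square zero = *-identityˡ 1#
  signum-square (suc a) = trans (solve 1 (λ x → (:- x) :* (:- x) := x :* x) refl _) (signum-square a)

  module _ {N : ℕ} where

    infix 4 _≐_
    _≐_ : MPoly N → MPoly N → Set
    p ≐ q = ∀ β → coeff β p ≈ coeff β q

    topComp : ℕ → MPoly N → MPoly N
    topComp d = filter (λ t → size (proj₁ t) ℕ.≟ d)

    accept : ∀ d β c p → size β ≡ d → topComp d ((β , c) ∷ p) ≡ (β , c) ∷ topComp d p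
    accept d β c p e = List.filter-accept (λ t → size (proj₁ t) ℕ.≟ d) {x = β , c} {xs = p} e

    reject : ∀ d β c p → size β ≢ d → topComp d ((β , c) ∷ p) ≡ topComp d p
    reject d β c p ≢d = List.filter-reject (λ t → size (proj₁ t) ℕ.≟ d) {x = β , c} {xs = p} ≢d

    -- (−1)^d p(−x)
    twist : ℕ → MPoly N → MPoly N
    twist d = List.map (λ t → proj₁ t , signum (d ℕ.+ size (proj₁ t)) * proj₂ t)

    lin-twist : ∀ d φ p → lin φ (twist d p) ≈ lin (λ β → signum (d ℕ.+ size β) * φ β) p
    lin-twist d φ [] = refl
    lin-twist d φ ((β , c) ∷ p) = +-cong (solve 3 (λ s c x → (s :* c) :* x := c :* (s :* x)) refl _ c (φ β)) (lin-twist d φ p)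

    lin-topComp-0 : ∀ d φ p → (∀ β → size β ≡ d → φ β ≈ 0#) → lin φ (topComp d p) ≈ 0#
    lin-topComp-0 d φ [] z = refl
    lin-topComp-0 d φ ((β , c) ∷ p) z with size β ℕ.≟ d
    ... | yes e = trans (reflexive (≡.cong (lin φ) (accept d β c p e))) (trans (+-cong (trans (*-congˡ (z β e)) (zeroʳ c)) (lin-topComp-0 d φ p z)) (+-identityˡ 0#))
    ... | no ≢d = trans (reflexive (≡.cong (lin φ) (reject d β c p ≢d))) (lin-topComp-0 d φ p z)

    lin-topComp : ∀ d φ p → (∀ β → size β ≢ d → φ β ≈ 0#) → lin φ (topComp d p) ≈ lin φ p
    lin-topComp d φ [] z = refl
    lin-topComp d φ ((β , c) ∷ p) z with size β ℕ.≟ d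
    ... | yes e = trans (reflexive (≡.cong (lin φ) (accept d β c p e))) (+-congˡ (lin-topComp d φ p z))
    ... | no ≢d = trans (reflexive (≡.cong (lin φ) (reject d β c p ≢d))) (trans (lin-topComp d φ p z) (trans (sym (+-identityˡ _)) (+-congʳ (sym (trans (*-congˡ (z β ≢d)) (zeroʳ c))))))

    coeff-topComp : ∀ d p β → size β ≡ d → coeff β (topComp d p) ≈ coeff β p
    coeff-topComp d p β e = lin-topComp d (δ β) p λ γ ≢d → δ-≢ β γ λ { ≡.refl → ≢d e }

    coeff-topComp-≢ : ∀ d p β → size β ≢ d → coeff β (topComp d p) ≈ 0#
    coeff-topComp-≢ d p β ≢d = lin-topComp-0 d (δ β) p λ γ e → δ-≢ β γ λ { ≡.refl → ≢d e }

    topComp-cong : ∀ d {p q} → (∀ β → size β ≡ d → coeff β p ≈ coeff β q) → topComp d p ≐ topComp d q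
    topComp-cong d {p} {q} e β with size β ℕ.≟ d
    ... | yes eq = trans (coeff-topComp d p β eq) (trans (e β eq) (sym (coeff-topComp d q β eq)))
    ... | no ≢d = trans (coeff-topComp-≢ d p β ≢d) (sym (coeff-topComp-≢ d q β ≢d))

    coeff-twist : ∀ d β p → coeff β (twist d p) ≈ signum (d ℕ.+ size β) * coeff β p
    coeff-twist d β p = begin
      coeff β (twist d p) ≈⟨ lin-twist d (δ β) p ⟩
      lin (λ γ → signum (d ℕ.+ size γ) * δ β γ) p ≈⟨ lin-cong pointwise p ⟩
      lin (λ γ → signum (d ℕ.+ size β) * δ β γ) p ≈⟨ lin-* _ (δ β) p ⟩
      signum (d ℕ.+ size β) * coeff β p ∎
      where
      pointwise : ∀ γ → signum (d ℕ.+ size γ) * δ β γ ≈ signum (d ℕ.+ size β) * δ β γ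
      pointwise γ with β ≟ γ
      ... | yes ≡.refl = refl
      ... | no _ = trans (zeroʳ _) (sym (zeroʳ _))

    power-neg : ∀ {N} (v : Point N) β → power (λ i → - v i) β ≈ signum (size β) * power v β
    power-neg v [] = sym (*-identityˡ 1#)
    power-neg v (b ∷ β) = trans (*-cong (neg-^ b) (power-neg (v ∘ Fin.suc) β))
      (trans (solve 4 (λ s t x y → (s :* x) :* (t :* y) := (s :* t) :* (x :* y)) refl (signum b) (signum (size β)) _ _) (*-congʳ (sym (signum-+ b (size β)))))
      where
      open import Algebra.Properties.Semiring.Exp semiring using (_^_)
      import Data.Fin as Fin
      neg-^ : ∀ b → (- v Fin.zero) ^ b ≈ signum b * v Fin.zero ^ b
      neg-^ zero = sym (*-identityˡ 1#)
      neg-^ (suc b) = trans (*-congˡ (neg-^ b)) (solve 3 (λ x s y → (:- x) :* (s :* y) := (:- s) :* (x :* y)) refl _ _ _)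

    eval-twist : ∀ d p v → eval (twist d p) v ≈ signum d * eval p (λ i → - v i)
    eval-twist d p v = begin
      eval (twist d p) v ≈⟨ lin-twist d (power v) p ⟩
      lin (λ β → signum (d ℕ.+ size β) * power v β) p ≈⟨ lin-cong (λ β → trans (*-congʳ (signum-+ d (size β))) (trans (*-assoc _ _ _) (*-congˡ (sym (power-neg v β))))) p ⟩
      lin (λ β → signum d * power (λ i → - v i) β) p ≈⟨ lin-* (signum d) _ p ⟩
      signum d * eval p (λ i → - v i) ∎

  module _ {n : ℕ}
    (E : Vec ℕ (suc n) → MPoly (suc n))
    (E-deg : ∀ η → DegBelow (suc (size η)) (E η))
    (E-lead : ∀ η → coeff η (E η) ≈ 1#)
    (E-vanish : ∀ η γ → γ ≢ η → size γ ≤ size η → eval (E η) (λ i → - pt γ i) ≈ 0#)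
    (D : Vec ℕ (suc n) → Carrier) (D≉0 : ∀ η → ¬ D η ≈ 0#)
    (Ξ : MPoly (suc n) → MPoly (suc n))
    (Ξ-cong : ∀ p q → p ≐ q → Ξ p ≐ Ξ q)
    (Ξ-++ : ∀ p q → Ξ (p ++ q) ≐ Ξ p ++ Ξ q)
    (Ξ-scale : ∀ c p → Ξ (scale c p) ≐ scale c (Ξ p))
    (Ξ-E : ∀ η → Ξ (scale (D η) (topComp (size η) (E η))) ≐ scale (D η) (twist (size η) (E η)))
    where

    -- This is F_η^{rδ} without the factor d_η. In degree |η| the two signs cancel, so its top
    -- component is still E_η^(α).
    Ẽ : Vec ℕ (suc n) → MPoly (suc n)
    Ẽ η = twist (size η) (E η)

    Ẽ-deg : ∀ η → DegBelow (suc (size η)) (Ẽ η)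
    Ẽ-deg η β lt = trans (coeff-twist (size η) β (E η)) (trans (*-congˡ (E-deg η β lt)) (zeroʳ _))

    coeff-Ẽ : ∀ η β → size β ≡ size η → coeff β (Ẽ η) ≈ coeff β (E η)
    coeff-Ẽ η β e = trans (coeff-twist (size η) β (E η)) (trans (*-congʳ (trans (reflexive (≡.cong (λ d → signum (size η ℕ.+ d)) e))
      (trans (signum-+ (size η) (size η)) (signum-square (size η))))) (*-identityˡ _))

    Ẽ-vanish : ∀ η γ → γ ≢ η → size γ ≤ size η → eval (Ẽ η) (pt γ) ≈ 0#
    Ẽ-vanish η γ γ≢η le = trans (eval-twist (size η) (E η) (pt γ)) (trans (*-congˡ (E-vanish η γ γ≢η le)) (zeroʳ _))

    -- Otherwise the polynomial would vanish at all points of size at most |η| and be zero, contrary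
    -- to its coefficient 1 on x^η.
    Ẽ-self : ∀ η → ¬ eval (Ẽ η) (pt η) ≈ 0#
    Ẽ-self η z = 1≉0 (begin
      1# ≈⟨ E-lead η ⟨
      coeff η (E η) ≈⟨ coeff-Ẽ η η ≡.refl ⟨
      coeff η (Ẽ η) ≈⟨ unisolvent (suc n) (suc (size η)) (Ẽ η) (Ẽ-deg η) van η ⟩
      0# ∎)
      where
      van : Vanishes (suc (size η)) (Ẽ η)
      van γ lt with γ ≟ η
      ... | yes ≡.refl = z
      ... | no γ≢η = Ẽ-vanish η γ γ≢η (ℕ.≤-pred lt)

    -- The defining property of Ξ divided by the invertible `D η`, using that `Ẽ η` and `E η` have
    -- the same top component.
    Ξ-Ẽ : ∀ η → Ξ (topComp (size η) (Ẽ η)) ≐ Ẽ η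
    Ξ-Ẽ η β with inverse (D η) (D≉0 η)
    ... | u , Du≈1 = begin
      coeff β (Ξ (topComp d (Ẽ η))) ≈⟨ Ξ-cong _ (scale u (scale (D η) T)) (λ γ →
                                                                    trans (topComp-cong d {Ẽ η} {E η} (coeff-Ẽ η) γ) (sym (unscale (δ γ) T))) β ⟩
      coeff β (Ξ (scale u (scale (D η) T))) ≈⟨ Ξ-scale u _ β ⟩
      coeff β (scale u (Ξ (scale (D η) T))) ≈⟨ lin-scale (δ β) u (Ξ (scale (D η) T)) ⟩
      u * coeff β (Ξ (scale (D η) T)) ≈⟨ *-congˡ (Ξ-E η β) ⟩
      u * coeff β (scale (D η) (Ẽ η)) ≈⟨ lin-scale (δ β) u (scale (D η) (Ẽ η)) ⟨
      coeff β (scale u (scale (D η) (Ẽ η))) ≈⟨ unscale (δ β) (Ẽ η) ⟩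
      coeff β (Ẽ η) ∎
      where
      d : ℕ
      d = size η
      T : MPoly (suc n)
      T = topComp d (E η)
      unscale : ∀ φ p → lin φ (scale u (scale (D η) p)) ≈ lin φ p
      unscale φ p = trans (lin-scale φ u (scale (D η) p)) (trans (*-congˡ (lin-scale φ (D η) p))
        (trans (solve 3 (λ u d x → u :* (d :* x) := (d :* u) :* x) refl u (D η) (lin φ p)) (trans (*-congʳ Du≈1) (*-identityˡ _))))

    -- the span of the Ẽ η with |η| = d, as far as it is needed
    record Spanned (d : ℕ) (S : MPoly (suc n)) : Set where
      field
        degree : DegBelow (suc d) S
        lower : Vanishes d S
        image : Ξ (topComp d S) ≐ S
    open Spanned

    Spanned-[] : ∀ d → Spanned d []
    Spanned-[] d = record
      { degree = λ _ _ → refl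
      ; lower = λ _ _ → refl
      ; image = λ β → trans (Ξ-scale 0# [] β) (trans (lin-scale (δ β) 0# (Ξ [])) (zeroˡ _)) }

    Spanned-Ẽ : ∀ η → Spanned (size η) (Ẽ η)
    Spanned-Ẽ η = record
      { degree = Ẽ-deg η
      ; lower = λ γ lt → Ẽ-vanish η γ (λ { ≡.refl → ℕ.<-irrefl ≡.refl lt }) (ℕ.<⇒≤ lt)
      ; image = Ξ-Ẽ η }

    lin-axpy : ∀ φ (S : MPoly (suc n)) c T → lin φ (S ++ scale c T) ≈ lin φ S + c * lin φ T
    lin-axpy φ S c T = trans (lin-++ φ S (scale c T)) (+-congˡ (lin-scale φ c T))

    Spanned-axpy : ∀ {d S T} c → Spanned d S → Spanned d T → Spanned d (S ++ scale c T)
    Spanned-axpy {d} {S} {T} c s t = record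
      { degree = λ β lt → trans (lin-axpy (δ β) S c T) (combine (degree s β lt) (degree t β lt))
      ; lower = λ γ lt → trans (lin-axpy (power (pt γ)) S c T) (combine (lower s γ lt) (lower t γ lt))
      ; image = λ β → begin
          coeff β (Ξ (topComp d (S ++ scale c T))) ≈⟨ Ξ-cong _ _ split β ⟩
          coeff β (Ξ (topComp d S ++ scale c (topComp d T))) ≈⟨ Ξ-++ (topComp d S) _ β ⟩
          coeff β (Ξ (topComp d S) ++ Ξ (scale c (topComp d T))) ≈⟨ lin-++ (δ β) (Ξ (topComp d S)) _ ⟩
          coeff β (Ξ (topComp d S)) + coeff β (Ξ (scale c (topComp d T))) ≈⟨ +-cong (image s β) (trans (Ξ-scale c (topComp d T) β) (trans (lin-scale (δ β) c (Ξ (topComp d T))) (*-congˡ (image t β)))) ⟩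
          coeff β S + c * coeff β T ≈⟨ lin-axpy (δ β) S c T ⟨
          coeff β (S ++ scale c T) ∎ }
      where
      combine : ∀ {x y} → x ≈ 0# → y ≈ 0# → x + c * y ≈ 0#
      combine x≈0 y≈0 = trans (+-cong x≈0 (trans (*-congˡ y≈0) (zeroʳ c))) (+-identityˡ 0#)
      split : topComp d (S ++ scale c T) ≐ topComp d S ++ scale c (topComp d T)
      split β with size β ℕ.≟ d
      ... | yes e = trans (coeff-topComp d (S ++ scale c T) β e) (trans (lin-axpy (δ β) S c T) (trans
              (+-cong (sym (coeff-topComp d S β e)) (*-congˡ (sym (coeff-topComp d T β e)))) (sym (lin-axpy (δ β) (topComp d S) c (topComp d T)))))
      ... | no ≢d = trans (coeff-topComp-≢ d (S ++ scale c T) β ≢d) (sym (trans (lin-axpy (δ β) (topComp d S) c (topComp d T))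
              (combine (coeff-topComp-≢ d S β ≢d) (coeff-topComp-≢ d T β ≢d))))

    -- Lagrange interpolation on the points of size d: `Ẽ η` vanishes at all of them but its own,
    -- where it is nonzero. Points of smaller size are covered by `Spanned`.
    interpolate : ∀ d (q : MPoly (suc n)) L → Σ (MPoly (suc n)) λ S → Spanned d S × (∀ γ → γ ∈ L → size γ ≡ d → eval q (pt γ) ≈ eval S (pt γ))
    interpolate d q [] = [] , Spanned-[] d , λ _ ()
    interpolate d q (η ∷ L) with interpolate d q L | size η ℕ.≟ d
    ... | S , s , e | no ≢d = S , s , λ { γ (here ≡.refl) eq → contradiction eq ≢d ; γ (there γ∈) eq → e γ γ∈ eq }
    ... | S , s , e | yes ≡.refl with inverse (eval (Ẽ η) (pt η)) (Ẽ-self η)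
    ... | u , Eu≈1 = S ++ scale c (Ẽ η) , Spanned-axpy c s (Spanned-Ẽ η) , agree
      where
      c : Carrier
      -- Corrects the value at `η`: adding `c` times `Ẽ η` changes it from that of `S` to that of
      -- `q`, and leaves the other points of this size alone.
      c = u * (eval q (pt η) - eval S (pt η))
      agree : ∀ γ → γ ∈ η ∷ L → size γ ≡ size η → eval q (pt γ) ≈ eval (S ++ scale c (Ẽ η)) (pt γ)
      agree γ γ∈ eq with γ ≟ η
      ... | yes ≡.refl = sym (begin
        eval (S ++ scale c (Ẽ η)) (pt η) ≈⟨ lin-axpy (power (pt η)) S c (Ẽ η) ⟩
        x + u * (y - x) * z ≈⟨ solve 4 (λ x u y z → x :+ u :* (y :- x) :* z := x :+ (z :* u) :* (y :- x)) refl x u y z ⟩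
        x + (z * u) * (y - x) ≈⟨ +-congˡ (*-congʳ Eu≈1) ⟩
        x + 1# * (y - x) ≈⟨ solve 2 (λ x y → x :+ :1 :* (y :- x) := y) refl x y ⟩
        y ∎)
        where
        x y z : Carrier
        x = eval S (pt η)
        y = eval q (pt η)
        z = eval (Ẽ η) (pt η)
      agree γ (here e) eq | no γ≢η = contradiction e γ≢η
      agree γ (there γ∈) eq | no γ≢η = sym (trans (lin-axpy (power (pt γ)) S c (Ẽ η)) (trans (+-congˡ (trans (*-congˡ (Ẽ-vanish η γ γ≢η (ℕ.≤-reflexive eq))) (zeroʳ c)))
        (trans (+-identityʳ _) (sym (e γ γ∈ eq)))))

    -- The interpolant S of `q` agrees with it at all points of size at most |ζ|, hence equals it.
    -- Its top component is then x^ζ, and Ξ sends the top component of S to S.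
    Ξ-monomial : ∀ {ζ q} → Bar ζ q → Ξ (single ζ) ≐ q
    Ξ-monomial {ζ} {q} b β with interpolate (size ζ) q (vectors≤ (suc n) (size ζ))
    ... | S , s , agree = begin
      coeff β (Ξ (single ζ)) ≈⟨ Ξ-cong (single ζ) (topComp d S) (λ γ → top γ) β ⟩
      coeff β (Ξ (topComp d S)) ≈⟨ image s β ⟩
      coeff β S ≈⟨ q≐S β ⟨
      coeff β q ∎
      where
      d : ℕ
      d = size ζ
      q≐S : q ≐ S
      q≐S = determined q S (Leading⇒DegBelow-suc {p = q} (leading b)) (degree s) equal
        where
        equal : ∀ γ → size γ ≤ d → eval q (pt γ) ≈ eval S (pt γ)
        equal γ le with size γ ℕ.≟ d
        ... | yes e = agree γ (∈-vectors≤ γ le) e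
        ... | no ≢d = trans (vanishes b γ (ℕ.≤∧≢⇒< le ≢d)) (sym (lower s γ (ℕ.≤∧≢⇒< le ≢d)))
      top : single ζ ≐ topComp d S
      top γ with size γ ℕ.≟ d
      ... | yes e = trans (monomial-coeff γ ζ) (trans (sym (leading b γ (ℕ.≤-reflexive (≡.sym e)))) (trans (q≐S γ) (sym (coeff-topComp d S γ e))))
      ... | no ≢d = trans (monomial-coeff γ ζ) (trans (δ-≢ γ ζ λ { ≡.refl → ≢d ≡.refl }) (sym (coeff-topComp-≢ d S γ ≢d)))

-- Nonvanishing of the factor d_η.

module NonzeroHooks (F : ParameterField) where

  open ParameterField F
  open Interpolation F using (cancel; 1≉0)
  open IntegerSolver K
  open import Relation.Binary.Reasoning.Setoid setoid

  -- Multiplication by `r` turns the factor into a + 1 + r b, which is nonzero since its constant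
  -- part is positive.
  hook≉0 : ∀ {α} → α * r ≈ 1# → ∀ a b → ¬ α * ι (a ℕ.+ 1) + ι b ≈ 0#
  hook≉0 {α} αr≈1 a b e = ℕ.1+n≢0 (≡.trans (ℕ.+-comm 1 a) (proj₁ (ι+rι-injective (a ℕ.+ 1) b 0 0 (begin
    ι (a ℕ.+ 1) + r * ι b ≈⟨ +-congʳ (trans (sym (*-identityˡ _)) (*-congʳ (sym αr≈1))) ⟩
    α * r * ι (a ℕ.+ 1) + r * ι b ≈⟨ solve 4 (λ α r x y → α :* r :* x :+ r :* y := r :* (α :* x :+ y)) refl α r _ _ ⟩
    r * (α * ι (a ℕ.+ 1) + ι b) ≈⟨ *-congˡ e ⟩
    r * 0# ≈⟨ solve 1 (λ r → r :* :0 := :0 :+ r :* :0) refl r ⟩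
    0# + r * 0# ≈⟨ +-cong ι-zero (*-congˡ ι-zero) ⟨
    ι 0 + r * ι 0 ∎))))

  product≉0 : ∀ {xs} → All (λ x → ¬ x ≈ 0#) xs → ¬ List.foldr _*_ 1# xs ≈ 0#
  product≉0 [] e = 1≉0 e
  product≉0 (x≉0 ∷ ps) e = product≉0 ps (cancel x≉0 e)

-- Values of constants and weights.

module Evaluations (F : ParameterField) where

  open ParameterField F
  open Polynomials K
  open Dehomogenization F using (twist; signum)
  open IntegerSolver K

  -- The same polynomial as `scale a (twist d p)`, with the coefficients multiplied in the order
  -- used by `Frδ`.
  twisted : ∀ {N} → ℕ → Carrier → MPoly N → MPoly N
  twisted d a = List.map (λ t → proj₁ t , signum (d ℕ.+ size (proj₁ t)) * a * proj₂ t)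

  lin-twisted : ∀ {N} d a φ (p : MPoly N) → lin φ (twisted d a p) ≈ lin φ (scale a (twist d p))
  lin-twisted d a φ [] = refl
  lin-twisted d a φ ((β , c) ∷ p) = +-cong (*-congʳ (solve 3 (λ s a c → s :* a :* c := a :* (s :* c)) refl _ a c)) (lin-twisted d a φ p)

  power-replicate : ∀ {N} (v : Point N) → power v (replicate N 0) ≈ 1#
  power-replicate {zero} v = refl
  power-replicate {suc N} v = trans (*-identityˡ _) (power-replicate (v ∘ suc))

  power-unit : ∀ {N} (v : Point N) k → power v (replicate N 0 [ k ]≔ 1) ≈ v k
  power-unit v zero = trans (*-cong (*-identityʳ _) (power-replicate (v ∘ suc))) (*-identityʳ _)
  power-unit v (suc k) = trans (*-identityˡ _) (power-unit (v ∘ suc) k)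

  eval-constant : ∀ {N} (v : Point N) c → eval ((replicate N 0 , c) ∷ []) v ≈ c
  eval-constant v c = trans (+-identityʳ _) (trans (*-congˡ (power-replicate v)) (*-identityʳ c))

  eval-weight : ∀ {N} (v : Point N) k c → eval ((replicate N 0 [ k ]≔ 1 , 1#) ∷ (replicate N 0 , c) ∷ []) v ≈ v k + c
  eval-weight v k c = +-cong (trans (*-identityˡ _) (power-unit v k)) (eval-constant v c)

-- The theorem over ℚ(r).

open import Defs
open RationalFunctions
open import Data.List.Membership.Propositional.Properties.WithK using (unique∧set⇒bag)
open import Data.List.Relation.Binary.BagAndSetEquality using (∼bag⇒↭)

ℚ⟨r⟩-parameters : ParameterField
ℚ⟨r⟩-parameters = record
  { K = ℚ⟨r⟩ ; ι = ℕF ; ι-zero = ℕF-zero ; ι-suc = ℕF-suc ; r = rF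
  ; ι+rι-injective = ℕF+rℕF-injective ; inverse = inverse }

module ℱ = ParameterField ℚ⟨r⟩-parameters
module P = Polynomials ℚ⟨r⟩
open Interpolation ℚ⟨r⟩-parameters using (pt; determined; leading)
open Cherednik ℚ⟨r⟩-parameters using (bar; bar-Bar; value-at)
open GameSums ℚ⟨r⟩-parameters
open Products ℚ⟨r⟩-parameters
open Dehomogenization ℚ⟨r⟩-parameters using (signum; twist; _≐_; Ξ-monomial)
open NonzeroHooks ℚ⟨r⟩-parameters
open import Relation.Binary.Reasoning.Setoid ℱ.setoid

-- The given coefficient skips terms with another exponent, whereas the linear form adds them with
-- factor zero.
coeff-lin : ∀ {N} (β : Vec ℕ N) p → coeff β p ≈F P.coeff β p
coeff-lin β [] = ℱ.refl {0F}
coeff-lin β ((γ , c) ∷ p) with Vec.≡-dec ℕ._≟_ β γ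
... | yes _ = ℱ.+-cong {c} {c *F 1F} {coeff β p} {P.coeff β p} (ℱ.sym {c *F 1F} {c} (ℱ.*-identityʳ c)) (coeff-lin β p)
... | no _ = ℱ.trans {coeff β p} {0F +F P.coeff β p} {c *F 0F +F P.coeff β p}
  (ℱ.trans {coeff β p} {P.coeff β p} {0F +F P.coeff β p} (coeff-lin β p) (ℱ.sym {0F +F P.coeff β p} {P.coeff β p} (ℱ.+-identityˡ (P.coeff β p))))
  (ℱ.+-congʳ {P.coeff β p} {0F} {c *F 0F} (ℱ.sym {c *F 0F} {0F} (ℱ.zeroʳ c)))

≈M⇒≐ : ∀ {N} {p q : MPoly N} → p ≈M q → p ≐ q
≈M⇒≐ {p = p} {q} e β = begin
  P.coeff β p ≈⟨ coeff-lin β p ⟨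
  coeff β p ≈⟨ e β ⟩
  coeff β q ≈⟨ coeff-lin β q ⟩
  P.coeff β q ∎

≐⇒≈M : ∀ {N} {p q : MPoly N} → p ≐ q → p ≈M q
≐⇒≈M {p = p} {q} e β = begin
  coeff β p ≈⟨ coeff-lin β p ⟩
  P.coeff β p ≈⟨ e β ⟩
  P.coeff β q ≈⟨ coeff-lin β q ⟨
  coeff β q ∎

open import Algebra.Properties.Semiring.Exp ℱ.semiring using (_^_)

^F≡^ : ∀ x b → x ^F b ≡ x ^ b
^F≡^ x zero = ≡.refl
^F≡^ x (suc b) = ≡.cong (x *F_) (^F≡^ x b)

power≡ : ∀ {N} (v : Vec 𝔽 N) β → Vec.foldr (λ _ → 𝔽) _*F_ 1F (zipWith _^F_ v β) ≡ P.power (lookup v) β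
power≡ [] [] = ≡.refl
power≡ (x ∷ v) (b ∷ β) = ≡.cong₂ _*F_ (^F≡^ x b) (power≡ v β)

evalM≡ : ∀ {N} p (v : Vec 𝔽 N) → evalM p v ≡ P.eval p (lookup v)
evalM≡ [] v = ≡.refl
evalM≡ ((β , c) ∷ p) v = ≡.cong₂ (λ x y → c *F x +F y) (power≡ v β) (evalM≡ p v)

signF≡ : ∀ k → signF k ≡ signum k
signF≡ zero = ≡.refl
signF≡ (suc k) = ≡.cong negF (signF≡ k)

dη≉0 : ∀ {N} (η : Vec ℕ N) → ¬ dη η ≈F 0F
dη≉0 {N} η = product≉0 (All.concat⁺ (All.map⁺ (All.universal (λ i → All.map⁺ (All.universal (λ j →
  hook≉0 {αF} αF*rF (lookup η i ℕ.∸ j) (legη η i j ℕ.+ 1)) (map suc (upTo (lookup η i))))) (allFin N))))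

barPt-pt : ∀ {N} (γ : Vec ℕ N) j → lookup (barPt γ) j ≈F negF (pt γ j)
barPt-pt γ j = ℱ.trans {lookup (barPt γ) j} {x} {negF (pt γ j)} (ℱ.reflexive (Vec.lookup∘tabulate _ j)) (ℱ.sym {negF (negF x)} {x} (-‿involutive x))
  where
  open import Algebra.Properties.Ring (CommutativeRing.ring ℚ⟨r⟩) using (-‿involutive)
  x : 𝔽
  x = ℕF (lookup γ j) +F rF *F ℕF (rank γ j)

open Evaluations ℚ⟨r⟩-parameters

size-unit : ∀ {N} (k : Fin N) → size (replicate N 0 [ k ]≔ 1) ≡ 1
size-unit {suc N} zero = ≡.cong suc (size-replicate0 N)
size-unit (suc k) = size-unit k

module _ {n : ℕ} where

  size-glWeight : ∀ {η γ : Vec ℕ (suc n)} (g : Glissade η γ) → Size≤ 1 (glWeight g)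
  size-glWeight {η} (star _) = ℕ.≤-reflexive (size-unit (crit η)) ∷ constant≤1 ∷ []
    where
    constant≤1 : size (replicate (suc n) 0) ≤ 1
    constant≤1 = ℕ.≤-trans (ℕ.≤-reflexive (size-replicate0 (suc n))) z≤n
  size-glWeight (up _ _ _ _ _) = ℕ.≤-trans (ℕ.≤-reflexive (size-replicate0 (suc n))) z≤n ∷ []
  size-glWeight (down _ _ _ _ _) = ℕ.≤-trans (ℕ.≤-reflexive (size-replicate0 (suc n))) z≤n ∷ []

  size-gameWeight : ∀ {η : Vec ℕ (suc n)} (G : Game η) → Size≤ (size η) (gameWeight G)
  size-gameWeight done = ℕ.≤-refl ∷ []
  size-gameWeight {η} (step {γ = γ} g G) = ≡.subst (λ d → Size≤ d (gameWeight (step g G))) (size-glissade η g)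
    (Size≤-⊗ {d = 1} {e = size γ} {p = glWeight g} {q = gameWeight G} (size-glWeight g) (size-gameWeight G))

  eval-glWeight : ∀ v {η γ : Vec ℕ (suc n)} (g : Glissade η γ) → P.eval (glWeight g) v ≈F glissade-weight v (γ , g)
  eval-glWeight v {η} (star _) = eval-weight v (crit η) (ℕF (mx η ℕ.∸ 1) +F rF *F ℕF (n ℕ.∸ critLeg η))
  eval-glWeight v (up _ _ _ _ _) = eval-constant v rF
  eval-glWeight v (down _ _ _ _ _) = eval-constant v rF

  eval-gameWeight : ∀ v {η : Vec ℕ (suc n)} (G : Game η) → P.eval (gameWeight G) v ≈F game-weight v G
  eval-gameWeight v done = eval-constant v 1F
  eval-gameWeight v (step {γ = γ} g G) = begin
    P.eval (glWeight g *M gameWeight G) v ≈⟨ eval-⊗ (glWeight g) (gameWeight G) v ⟩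
    P.eval (glWeight g) v *F P.eval (gameWeight G) v ≈⟨ ℱ.*-cong {P.eval (glWeight g) v} {glissade-weight v (γ , g)} {P.eval (gameWeight G) v} {game-weight v G}
                                                             (eval-glWeight v g) (eval-gameWeight v G) ⟩
    glissade-weight v (γ , g) *F game-weight v G ∎

  module _ (η : Vec ℕ (suc n)) (games : List (Game η)) (complete : ∀ G → G ∈ games) (uniq : Unique games) where

    games-sum : MPoly (suc n)
    games-sum = sumM (map gameWeight games)

    size-games : Size≤ (size η) games-sum
    size-games = All.concat⁺ (All.map⁺ (All.universal size-gameWeight games))

    eval-sumM : ∀ v (Gs : List (Game η)) → P.eval (sumM (map gameWeight Gs)) v ≈F total (game-weight v) Gs
    eval-sumM v [] = ℱ.refl {0F}
    eval-sumM v (G ∷ Gs) = begin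
      P.eval (gameWeight G ++ sumM (map gameWeight Gs)) v ≈⟨ P.lin-++ (P.power v) (gameWeight G) (sumM (map gameWeight Gs)) ⟩
      P.eval (gameWeight G) v +F P.eval (sumM (map gameWeight Gs)) v ≈⟨ ℱ.+-cong {P.eval (gameWeight G) v} {game-weight v G} {P.eval (sumM (map gameWeight Gs)) v} {total (game-weight v) Gs}
                                                                           (eval-gameWeight v G) (eval-sumM v Gs) ⟩
      game-weight v G +F total (game-weight v) Gs ∎

    -- Two complete lists without repetition have the same members, each once, so the given list of
    -- games may be replaced by the recursive enumeration.
    games-↭ : games ↭ allGames (size η) η ≡.refl
    games-↭ = ∼bag⇒↭ (unique∧set⇒bag uniq (allGames-unique (size η) η ≡.refl)
      (λ {G} → mk⇔ (λ _ → ∈-allGames (size η) η ≡.refl G) (λ _ → complete G)))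

    eval-games : ∀ γ → P.eval games-sum (pt γ) ≈F value-at γ η
    eval-games γ = begin
      P.eval games-sum (pt γ) ≈⟨ eval-sumM (pt γ) games ⟩
      total (game-weight (pt γ)) games ≈⟨ total-↭ (game-weight (pt γ)) games-↭ ⟩
      total (game-weight (pt γ)) (allGames (size η) η ≡.refl) ≈⟨ game-total (size η) η ≡.refl γ ⟩
      value-at γ η ∎

    -- The leading term of the sum over games is never computed: a bound on its degree suffices, as
    -- the values agree at every point, in particular at those of size at most |η|.
    games-bar : games-sum ≐ bar η
    games-bar = determined games-sum (bar η) (Size≤⇒DegBelow size-games) (P.Leading⇒DegBelow-suc {p = bar η} (leading (bar-Bar η))) (λ γ _ → eval-games γ)

theoremD : (n : ℕ) (E : Vec ℕ (suc n) → MPoly (suc n)) (Ξ : MPoly (suc n) → MPoly (suc n))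
    → IsInterpolation E → IsΞ E Ξ
    → (η : Vec ℕ (suc n)) (games : List (Game η))
    → (∀ G → G ∈ games) → Unique games
    → Ξ (monoM η) ≈M sumM (map gameWeight games)
theoremD n E Ξ interpolation (Ξ-cong , Ξ-+ , Ξ-scale , Ξ-E) η games complete uniq =
  ≐⇒≈M {p = Ξ (monoM η)} {games-sum η games complete uniq} λ β → begin
    P.coeff β (Ξ (monoM η)) ≈⟨ Ξ-monomial E E-deg E-lead E-vanish dη dη≉0 Ξ
                                                           (λ p q e → ≈M⇒≐ {p = Ξ p} {Ξ q} (Ξ-cong p q (≐⇒≈M {p = p} {q} e)))
                                                           (λ p q → ≈M⇒≐ {p = Ξ (p ++ q)} {Ξ p ++ Ξ q} (Ξ-+ p q))
                                                           (λ c p → ≈M⇒≐ {p = Ξ (scaleM c p)} {scaleM c (Ξ p)} (Ξ-scale c p))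
                                                           Ξ-F (bar-Bar η) β ⟩
    P.coeff β (bar η) ≈⟨ games-bar η games complete uniq β ⟨
    P.coeff β (games-sum η games complete uniq) ∎
  where
  E-deg : ∀ η → P.DegBelow (suc (size η)) (E η)
  E-deg η β lt = ℱ.trans {P.coeff β (E η)} {coeff β (E η)} {0F} (ℱ.sym {coeff β (E η)} {P.coeff β (E η)} (coeff-lin β (E η))) (proj₁ (interpolation η) β lt)
  E-lead : ∀ η → P.coeff η (E η) ≈F 1F
  E-lead η = ℱ.trans {P.coeff η (E η)} {coeff η (E η)} {1F} (ℱ.sym {coeff η (E η)} {P.coeff η (E η)} (coeff-lin η (E η))) (proj₁ (proj₂ (interpolation η)))
  E-vanish : ∀ η γ → γ ≢ η → size γ ≤ size η → P.eval (E η) (λ i → negF (pt γ i)) ≈F 0F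
  E-vanish η γ γ≢η le = begin
    P.eval (E η) (λ i → negF (pt γ i)) ≈⟨ P.eval-cong (E η) (barPt-pt γ) ⟨
    P.eval (E η) (lookup (barPt γ)) ≡⟨ evalM≡ (E η) (barPt γ) ⟨
    evalM (E η) (barPt γ) ≈⟨ proj₂ (proj₂ (interpolation η)) γ γ≢η le ⟩
    0F ∎
  Frδ-twist : ∀ η → Frδ E η ≐ P.scale (dη η) (twist (size η) (E η))
  Frδ-twist η β = ℱ.trans {P.coeff β (Frδ E η)} {P.coeff β (twisted (size η) (dη η) (E η))} {P.coeff β (P.scale (dη η) (twist (size η) (E η)))}
    (ℱ.reflexive (≡.cong (P.coeff β) (List.map-cong (λ (γ , c) → ≡.cong (λ s → γ , s *F dη η *F c) (signF≡ (size η ℕ.+ size γ))) (E η))))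
    (lin-twisted (size η) (dη η) (P.δ β) (E η))
  Ξ-F : ∀ η → Ξ (P.scale (dη η) (topComp (size η) (E η))) ≐ P.scale (dη η) (twist (size η) (E η))
  Ξ-F η β = begin
    P.coeff β (Ξ (Fα E η)) ≈⟨ ≈M⇒≐ {p = Ξ (Fα E η)} {Frδ E η} (Ξ-E η) β ⟩
    P.coeff β (Frδ E η) ≈⟨ Frδ-twist η β ⟩
    P.coeff β (P.scale (dη η) (twist (size η) (E η))) ∎
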